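{- The reachability problem for layered grid graphs (given an $n\times n$ layered grid graph $G$ and two vertices $s,t$ of $G$, decide whether there is a directed path from $s$ to $t$ in $G$) belongs to $\mathsf{near\text{ - }SC}$; that is, for every $\epsilon>0$ it can be decided by a deterministic Turing machine simultaneously in time $n^{O(1)}$ and space $O(n^{\epsilon})$.
   Context: An $n\times n$ layered grid graph is a directed graph whose vertices are lattice points $(i,j)$ of an $n\times n$ square grid, in which every edge joins two vertices at $L_1$-distance one and is directed either north (from $(i,j)$ to $(i,j+1)$) or east (from $(i,j)$ to $(i+1,j)$). $\mathsf{TISP}(t(n),s(n))$ denotes languages decided by a deterministic Turing machine (read-only input, space measured on the work tape) in time $O(t(n))$ and space $O(s(n))$; $\mathsf{near\text{ - }SC}:=\bigcap_{\epsilon>0}\mathsf{TISP}(n^{O(1)},n^{\epsilon})$. -}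

module Defs where

open import Data.Nat using (ℕ; zero; suc; _+_; _*_; _^_; _≤_; _<_; _<ᵇ_)
open import Data.Bool using (Bool; true; false; if_then_else_)
open import Data.Fin using (Fin; toℕ)
open import Data.List using (List; []; _∷_; _++_; replicate; length; upTo; concatMap)
open import Data.Product using (Σ; _×_; _,_; proj₁; proj₂; ∃-syntax)
open import Relation.Binary.PropositionalEquality using (_≡_)
open import Data.Nat using (_≟_)
open import Relation.Nullary using (yes; no)

-- An instance: an n×n layered grid graph together with s and t.
-- Vertices are (i , j) with i , j < n.  north i j = true means the edge
-- (i,j) → (i,j+1) is present; east i j = true means (i,j) → (i+1,j)
-- is present.  Bits whose target lies outside the grid are ignored.
record Instance : Set where
  field
    n     : ℕ
    north : ℕ → ℕ → Bool
    east  : ℕ → ℕ → Bool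
    s     : Fin n × Fin n
    t     : Fin n × Fin n
open Instance public

data PathToT (I : Instance) : ℕ → ℕ → Set where
  here  : PathToT I (toℕ (proj₁ (t I))) (toℕ (proj₂ (t I)))
  goN   : ∀ {i j} → north I i j ≡ true → suc j < n I →
          PathToT I i (suc j) → PathToT I i j
  goE   : ∀ {i j} → east I i j ≡ true → suc i < n I →
          PathToT I (suc i) j → PathToT I i j

Reachable : Instance → Set
Reachable I = PathToT I (toℕ (proj₁ (s I))) (toℕ (proj₂ (s I)))

unary : ℕ → List Bool
unary k = replicate k true ++ (false ∷ [])

encode : Instance → List Bool
encode I =
  unary (n I)
  ++ unary (toℕ (proj₁ (s I))) ++ unary (toℕ (proj₂ (s I)))
  ++ unary (toℕ (proj₁ (t I))) ++ unary (toℕ (proj₂ (t I)))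
  ++ concatMap (λ i → concatMap (λ j → north I i j ∷ east I i j ∷ []) (upTo (n I))) (upTo (n I))

-- Deterministic Turing machines with a read-only input tape and one
-- work tape (input alphabet {0,1}, end markers on the input tape).

data InSym : Set where
  lend : InSym
  bit  : Bool → InSym
  rend : InSym

data Dir : Set where
  L S R : Dir

data Action (Q g : ℕ) : Set where
  halt : Bool → Action Q g                       -- halt, accept (true) / reject (false)
  step : Fin Q → Fin (suc g) → Dir → Dir → Action Q g
  -- new state, symbol written on the work tape, input-head move, work-head move

record TM : Set where
  field
    Q     : ℕ
    g     : ℕ                 -- work alphabet is Fin (suc g), blank = zero
    start : Fin Q
    δ     : Fin Q → InSym → Fin (suc g) → Action Q g
open TM public

-- input tape: cell 0 = left marker, cells 1..|x| = x, cell |x|+1 = right marker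
readIn : List Bool → ℕ → InSym
readIn x zero = lend
readIn [] (suc k) = rend
readIn (b ∷ x) (suc zero) = bit b
readIn (b ∷ x) (suc (suc k)) = readIn x (suc k)

moveIn : ℕ → Dir → ℕ → ℕ
moveIn len L zero = zero
moveIn len L (suc p) = p
moveIn len S p = p
moveIn len R p = if p <ᵇ suc len then suc p else p

moveW : Dir → ℕ → ℕ
moveW L zero = zero
moveW L (suc p) = p
moveW S p = p
moveW R p = suc p

module _ (M : TM) where
  data Config : Set where
    run  : Fin (Q M) → (inPos : ℕ) → (work : ℕ → Fin (suc (g M))) → (wPos : ℕ) → Config
    done : Bool → Config

  write : (ℕ → Fin (suc (g M))) → ℕ → Fin (suc (g M)) → ℕ → Fin (suc (g M))
  write w p a k with k ≟ p
  ... | yes _ = a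
  ... | no  _ = w k

  stepC : List Bool → Config → Config
  stepC x (done b) = done b
  stepC x (run q ip w wp) with δ M q (readIn x ip) (w wp)
  ... | halt b = done b
  ... | step q' a di dw = run q' (moveIn (length x) di ip) (write w wp a) (moveW dw wp)

  initC : Config
  initC = run (start M) zero (λ _ → Fin.zero) zero

  confAt : List Bool → ℕ → Config
  confAt x zero = initC
  confAt x (suc τ) = stepC x (confAt x τ)

  workPos : Config → ℕ
  workPos (run _ _ _ wp) = wp
  workPos (done _) = zero

  -- M on input x halts with answer b within T steps, never moving its
  -- work head to a cell ≥ Sp (i.e. using at most Sp work cells).
  HaltsWithin : List Bool → ℕ → ℕ → Bool → Set
  HaltsWithin x T Sp b =
    Σ ℕ λ τ → τ ≤ T × confAt x τ ≡ done b × (∀ τ' → τ' ≤ τ → workPos (confAt x τ') < Sp)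

-- Reachability for n×n layered grid graphs is decidable in time n^{O(1)}
-- and space O(n^ε), ε = p/q; "space ≤ C·n^{p/q}" is written as
-- space^q ≤ C·(n+1)^p.
DecidesLGGReachTISP : (p q : ℕ) → Set
DecidesLGGReachTISP p q =
  Σ TM λ M → Σ ℕ λ C → Σ ℕ λ k →
    ∀ (I : Instance) → Σ ℕ λ Sp → (Sp ^ q ≤ C * (suc (n I)) ^ p) ×
      Σ Bool λ b → HaltsWithin M (encode I) (C * (suc (n I)) ^ k) Sp b
                   × ((b ≡ true → Reachable I) × (Reachable I → b ≡ true))

{-# OPTIONS --safe #-}
module Submission where

open import Defs
open import Data.Bool using (Bool; true; false; if_then_else_; not; _∧_; T)
open import Data.Bool.Properties using (∧-zeroʳ)
open import Data.Empty using (⊥; ⊥-elim)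
open import Data.Fin using (Fin; zero; suc; toℕ; splitAt; _↑ˡ_; _↑ʳ_; combine; remQuot)
open import Data.Fin.Patterns
open import Data.Fin.Properties as Fin using (splitAt-↑ˡ; splitAt-↑ʳ; remQuot-combine; toℕ<n)
open import Data.List as List using (List; []; _∷_; _++_; _ʳ++_; length; replicate; map; concatMap; upTo; applyUpTo)
open import Data.List.Properties using (length-++; length-map; length-replicate; length-ʳ++; ++-assoc)
open import Data.List.Relation.Unary.All using (All; []; _∷_)
open import Data.Nat using (ℕ; zero; suc; pred; _+_; _*_; _∸_; _^_; _⊓_; _≤_; _<_; z≤n; s≤s; _≟_; _<?_; _≤?_; _<ᵇ_; _≡ᵇ_)
open import Data.Nat.Properties
open import Data.Nat.Tactic.RingSolver using (solve-∀)
open import Data.Product using (Σ; _×_; _,_; proj₁; proj₂)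
open import Data.Sum using (_⊎_; inj₁; inj₂; [_,_]′)
open import Data.Unit using (⊤; tt)
open import Data.Vec as Vec using (Vec; []; _∷_; lookup; _[_]≔_)
open import Data.Vec.Properties using (lookup-map; lookup-replicate; lookup∘update; lookup∘update′; []≔-idempotent; []≔-commutes; []≔-lookup; map-[]≔; map-replicate)
open import Function using (_∘_)
open import Relation.Binary.Definitions using (tri<; tri≈; tri>)
open import Relation.Binary.PropositionalEquality
open import Relation.Nullary using (Dec; yes; no; contradiction)

-- Write a vertex (i , j) as its offset (r , h) = (iₜ ∸ i , jₜ ∸ j) from the target; every edge decreases r + h
-- by one, so that the graph is layered by r + h, and each layer is ordered by r.  Let next e take a vertex v
-- and a bound b to the least r ≥ b of a vertex reachable from v in B ^ e steps.  For e + 1, run a depth-first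
-- search over B hops of length B ^ e, calling next e.  Since paths that change sides meet, the vertices visited
-- in a layer increase in r; hence one number per layer records all that is explored, and no vertex is visited
-- twice.  The search thus stores O(B) numbers per level and makes polynomially many calls.  With B ≈ n^(1/D)
-- and D + 1 levels it runs in time n^O(D) and space O(B log n) ⊆ O(B²) = O(n^(2/D)); take D = 2q.
-- The machine keeps every variable as a stack of numerals on a track of its work tape.

-- Structured programs and their Turing machines

-- Halving paths as in Savitch's method needs about log n levels and superpolynomial time; here the
-- number of levels is constant, so the cost of one level must be polynomial. The reason is that at
-- any moment each layer below the last owns exactly one number, the offset of its vertex on the
-- current path or its bound. A successful call turns a bound into an offset that is no smaller, a
-- failed call turns an offset r into the bound r + 1. Hence one run of a level makes O(B n) calls.
-- A bound may jump to the new vertex because whatever is skipped is useless: a skipped vertex was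
-- below the old bound, or succeeds a dead vertex, or by planarity succeeds the end of the path and
-- contradicts the minimality of the answer. Only path lengths that are powers of B occur; this is
-- harmless because the target absorbs. Distances reach 2n, beyond B ^ D, which accounts for level D
-- + 1. From n ≤ B ^ D also log n = O(B), whence the space O(B²), while B ^ D ≤ 2 ^ D n turns powers
-- of B back into powers of n.

module Structured {A : Set} {γ : ℕ} (encA : A → Fin (suc γ)) (decA : Fin (suc γ) → A)
                  (dec-enc : ∀ a → decA (encA a) ≡ a) where

  infixr 5 _⨾_

  data Prog : Set where
    act   : (InSym → A → A × Dir × Dir) → Prog
    _⨾_   : Prog → Prog → Prog
    ite   : (InSym → A → Bool) → Prog → Prog → Prog
    while : (InSym → A → Bool) → Prog → Prog

  size : Prog → ℕ
  size (act _)     = 1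
  size (p ⨾ r)     = size p + size r
  size (ite _ p r) = suc (size p + size r)
  size (while _ p) = suc (size p)

  entry : ∀ p → Fin (size p)
  entry (act _)     = zero
  entry (p ⨾ r)     = entry p ↑ˡ size r
  entry (ite _ _ _) = zero
  entry (while _ _) = zero

  -- The control states of p are embedded by emb into those of the whole
  -- machine; control passes to the state out when p terminates.
  comp : ∀ p {q} → (Fin (size p) → Fin q) → Fin q →
         Fin (size p) → InSym → A → Fin q × A × Dir × Dir
  comp (act f) emb out _ i a = out , f i a
  comp (p ⨾ r) emb out s =
    [ comp p (emb ∘ (_↑ˡ size r)) (emb (size p ↑ʳ entry r))
    , comp r (emb ∘ (size p ↑ʳ_)) out ]′ (splitAt (size p) s)
  comp (ite f p r) emb out zero i a =
    (if f i a then emb (suc (entry p ↑ˡ size r)) else emb (suc (size p ↑ʳ entry r))) , a , S , S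
  comp (ite f p r) emb out (suc s) =
    [ comp p (emb ∘ suc ∘ (_↑ˡ size r)) out
    , comp r (emb ∘ suc ∘ (size p ↑ʳ_)) out ]′ (splitAt (size p) s)
  comp (while f p) emb out zero i a =
    (if f i a then emb (suc (entry p)) else out) , a , S , S
  comp (while f p) emb out (suc s) = comp p (emb ∘ suc) (emb zero) s

  toAction : ∀ {q} → Fin q × A × Dir × Dir → Action q γ
  toAction (q , a , di , dw) = step q (encA a) di dw

  machine-δ : ∀ p → (A → Bool) → Fin (suc (size p)) → InSym → Fin (suc γ) → Action (suc (size p)) γ
  machine-δ p verdict zero    i a = halt (verdict (decA a))
  machine-δ p verdict (suc s) i a = toAction (comp p suc zero s i (decA a))

  machine : Prog → (A → Bool) → TM
  machine p verdict = record
    { Q = suc (size p) ; g = γ ; start = suc (entry p) ; δ = machine-δ p verdict }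

  record Conf : Set where
    constructor ⟨_,_,_⟩
    field
      inp  : ℕ
      tape : ℕ → A
      pos  : ℕ

  -- Step-counted executions and their simulation by the machine

  module Semantics (x : List Bool) (Sp : ℕ) where

    -- The space bound is checked at every step. `act` fixes the new tape `w'` only pointwise: tapes
    -- are functions, and without function extensionality this is what lets a later layer name the
    -- tape that it wants to end with.
    data Exec : Prog → Conf → ℕ → Conf → Set where
      act : ∀ {f ip w wp a di dw w'} → wp < Sp →
            f (readIn x ip) (w wp) ≡ (a , di , dw) →
            w' wp ≡ a → (∀ k → k ≢ wp → w' k ≡ w k) →
            Exec (act f) ⟨ ip , w , wp ⟩ 1 ⟨ moveIn (length x) di ip , w' , moveW dw wp ⟩
      _⨾_ : ∀ {p r c c' c'' m m'} → Exec p c m c' → Exec r c' m' c'' → Exec (p ⨾ r) c (m + m') c''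
      ite-t : ∀ {f p r ip w wp m c'} → wp < Sp → f (readIn x ip) (w wp) ≡ true →
              Exec p ⟨ ip , w , wp ⟩ m c' → Exec (ite f p r) ⟨ ip , w , wp ⟩ (suc m) c'
      ite-f : ∀ {f p r ip w wp m c'} → wp < Sp → f (readIn x ip) (w wp) ≡ false →
              Exec r ⟨ ip , w , wp ⟩ m c' → Exec (ite f p r) ⟨ ip , w , wp ⟩ (suc m) c'
      while-t : ∀ {f p ip w wp m m' c' c''} → wp < Sp → f (readIn x ip) (w wp) ≡ true →
                Exec p ⟨ ip , w , wp ⟩ m c' → Exec (while f p) c' m' c'' →
                Exec (while f p) ⟨ ip , w , wp ⟩ (suc (m + m')) c''
      while-f : ∀ {f p ip w wp} → wp < Sp → f (readIn x ip) (w wp) ≡ false →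
                Exec (while f p) ⟨ ip , w , wp ⟩ 1 ⟨ ip , w , wp ⟩

    module Simulation (M : TM) where

      infix 3 _⟶[_]_
      data _⟶[_]_ : Config M → ℕ → Config M → Set where
        stop : ∀ {c} → c ⟶[ 0 ] c
        next : ∀ {c m c'} → workPos M c < Sp → stepC M x c ⟶[ m ] c' → c ⟶[ suc m ] c'

      _▷_ : ∀ {c c' c'' m m'} → c ⟶[ m ] c' → c' ⟶[ m' ] c'' → c ⟶[ m + m' ] c''
      stop     ▷ b = b
      next l a ▷ b = next l (a ▷ b)

      stepC-step : ∀ {q ip w wp q' a di dw} → δ M q (readIn x ip) (w wp) ≡ step q' a di dw →
        stepC M x (run q ip w wp) ≡ run q' (moveIn (length x) di ip) (write M w wp a) (moveW dw wp)
      stepC-step e rewrite e = refl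

      stepC-halt : ∀ {q ip w wp b} → δ M q (readIn x ip) (w wp) ≡ halt b →
        stepC M x (run q ip w wp) ≡ done b
      stepC-halt e rewrite e = refl

      -- `confAt` adds a step at the end, `_⟶[_]_` at the front. Recursion on the run with the
      -- elapsed time τ as accumulator reconciles the two, carrying along the space bound for all
      -- earlier times.
      confAt-⟶ : ∀ {m c c'} τ → confAt M x τ ≡ c → c ⟶[ m ] c' → workPos M c' < Sp →
        (∀ τ' → τ' ≤ τ → workPos M (confAt M x τ') < Sp) →
        confAt M x (m + τ) ≡ c' × (∀ τ' → τ' ≤ m + τ → workPos M (confAt M x τ') < Sp)
      confAt-⟶ τ e stop _ h = e , h
      confAt-⟶ {suc m} {c} {c'} τ e (next l r) l' h =
        subst (λ y → confAt M x y ≡ c') (+-suc m τ) (proj₁ rest) ,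
        λ τ' τ'≤ → proj₂ rest τ' (subst (τ' ≤_) (sym (+-suc m τ)) τ'≤)
        where
        bound : ∀ {c c'} → c ⟶[ m ] c' → workPos M c' < Sp → workPos M c < Sp
        bound stop l = l
        bound (next l _) _ = l
        h' : ∀ τ' → τ' ≤ suc τ → workPos M (confAt M x τ') < Sp
        h' τ' τ'≤ with m≤n⇒m<n∨m≡n τ'≤
        ... | inj₁ (s≤s le) = h τ' le
        ... | inj₂ refl     = subst (λ y → workPos M (stepC M x y) < Sp) (sym e) (bound r l')
        rest = confAt-⟶ (suc τ) (cong (stepC M x) e) r l' h'

      ⟶-haltsWithin : ∀ {m T b} → initC M ⟶[ m ] done b → m ≤ T → 0 < Sp → HaltsWithin M x T Sp b
      ⟶-haltsWithin {m} r m≤T 0<Sp = m , m≤T , subst (λ y → confAt M x y ≡ _) (+-identityʳ m) (proj₁ c) ,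
        λ τ' τ'≤ → proj₂ c τ' (subst (τ' ≤_) (sym (+-identityʳ m)) τ'≤)
        where c = confAt-⟶ 0 refl r 0<Sp λ { zero z≤n → 0<Sp }

    module Simulate (p₀ : Prog) (verdict : A → Bool) where
      M : TM
      M = machine p₀ verdict
      open Simulation M public

      Implements : ∀ p → (Fin (size p) → Fin (Q M)) → Fin (Q M) → Set
      Implements p emb out = ∀ s i a → δ M (emb s) i a ≡ toAction (comp p emb out s i (decA a))

      _≈_ : (ℕ → Fin (suc γ)) → (ℕ → A) → Set
      w₁ ≈ w = ∀ k → decA (w₁ k) ≡ w k

      module _ {p r : Prog} {emb out} (h : Implements (p ⨾ r) emb out) where
        implements-⨾ˡ : Implements p (emb ∘ (_↑ˡ size r)) (emb (size p ↑ʳ entry r))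
        implements-⨾ˡ s i a = trans (h (s ↑ˡ size r) i a)
          (cong (λ z → toAction ([ comp p _ _ , comp r _ _ ]′ z i (decA a))) (splitAt-↑ˡ (size p) s (size r)))
        implements-⨾ʳ : Implements r (emb ∘ (size p ↑ʳ_)) out
        implements-⨾ʳ s i a = trans (h (size p ↑ʳ s) i a)
          (cong (λ z → toAction ([ comp p _ _ , comp r _ _ ]′ z i (decA a))) (splitAt-↑ʳ (size p) (size r) s))

      module _ {f} {p r : Prog} {emb out} (h : Implements (ite f p r) emb out) where
        implements-iteˡ : Implements p (emb ∘ suc ∘ (_↑ˡ size r)) out
        implements-iteˡ s i a = trans (h (suc (s ↑ˡ size r)) i a)
          (cong (λ z → toAction ([ comp p _ _ , comp r _ _ ]′ z i (decA a))) (splitAt-↑ˡ (size p) s (size r)))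
        implements-iteʳ : Implements r (emb ∘ suc ∘ (size p ↑ʳ_)) out
        implements-iteʳ s i a = trans (h (suc (size p ↑ʳ s)) i a)
          (cong (λ z → toAction ([ comp p _ _ , comp r _ _ ]′ z i (decA a))) (splitAt-↑ʳ (size p) (size r) s))

      -- The machine's tape is known only up to decoding, since different symbols may decode to the
      -- same cell; hence the quantification over all tapes `w₁` that represent `w`.
      Simulates : (c c' : Conf) → ℕ → Fin (Q M) → Fin (Q M) → Set
      Simulates ⟨ ip , w , wp ⟩ ⟨ ip' , w' , wp' ⟩ m q q' = ∀ w₁ → w₁ ≈ w →
        Σ (ℕ → Fin (suc γ)) λ w₁' → (w₁' ≈ w') × (run q ip w₁ wp ⟶[ m ] run q' ip' w₁' wp')

      simulates-cons : ∀ {ip w wp q q₁ q₂ q' a di dw w' m c} → wp < Sp →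
        (∀ e → decA e ≡ w wp → δ M q (readIn x ip) e ≡ toAction (q₁ , a , di , dw)) → q₁ ≡ q₂ →
        w' wp ≡ a → (∀ k → k ≢ wp → w' k ≡ w k) →
        Simulates ⟨ moveIn (length x) di ip , w' , moveW dw wp ⟩ c m q₂ q' →
        Simulates ⟨ ip , w , wp ⟩ c (suc m) q q'
      simulates-cons {ip} {w} {wp} {w' = w'} {m = m} l hδ refl same other k w₁ w₁≈
        with k (write M w₁ wp (encA _)) written
        where
        written : write M w₁ wp (encA _) ≈ w'
        written j with j ≟ wp
        ... | yes refl = trans (dec-enc _) (sym same)
        ... | no j≢    = trans (w₁≈ j) (sym (other j j≢))
      ... | w₁' , ≈' , r = w₁' , ≈' ,
        next l (subst (λ y → y ⟶[ m ] _) (sym (stepC-step (hδ (w₁ wp) (w₁≈ wp)))) r)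

      simulates-⨾ : ∀ {c c' c'' m m' q q' q''} → Simulates c c' m q q' → Simulates c' c'' m' q' q'' →
        Simulates c c'' (m + m') q q''
      simulates-⨾ h k w₁ w₁≈ with h w₁ w₁≈
      ... | w₂ , w₂≈ , r with k w₂ w₂≈
      ... | w₃ , w₃≈ , r' = w₃ , w₃≈ , (r ▷ r')

      simulates-stop : ∀ {c q} → Simulates c c 0 q q
      simulates-stop w₁ w₁≈ = w₁ , w₁≈ , stop

      simulate : ∀ {p emb out c m c'} → Exec p c m c' → Implements p emb out →
        Simulates c c' m (emb (entry p)) out
      simulate {emb = emb} {out} (act {f} l e same other) h =
        simulates-cons l (λ b db → trans (h zero _ b)
            (trans (cong (λ z → toAction (comp (act f) emb out zero _ z)) db) (cong (λ z → toAction (out , z)) e)))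
          refl same other simulates-stop
      simulate (_⨾_ {p} {r} ep er) h =
        simulates-⨾ (simulate ep (implements-⨾ˡ {p} {r} h)) (simulate er (implements-⨾ʳ {p} {r} h))
      simulate {emb = emb} {out} (ite-t {f} {p} {r} l e ep) h =
        simulates-cons l
          (λ b db → trans (h zero _ b) (cong (λ z → toAction (comp (ite f p r) emb out zero _ z)) db))
          (cong (λ z → if z then _ else _) e)
          refl (λ _ _ → refl) (simulate ep (implements-iteˡ {f} {p} {r} h))
      simulate {emb = emb} {out} (ite-f {f} {p} {r} l e er) h =
        simulates-cons l
          (λ b db → trans (h zero _ b) (cong (λ z → toAction (comp (ite f p r) emb out zero _ z)) db))
          (cong (λ z → if z then _ else _) e)
          refl (λ _ _ → refl) (simulate er (implements-iteʳ {f} {p} {r} h))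
      simulate {emb = emb} {out} (while-t {f} {p} l e ep ew) h =
        simulates-cons l
          (λ b db → trans (h zero _ b) (cong (λ z → toAction (comp (while f p) emb out zero _ z)) db))
          (cong (λ z → if z then _ else _) e)
          refl (λ _ _ → refl) (simulates-⨾ (simulate ep (λ s → h (suc s))) (simulate ew h))
      simulate {emb = emb} {out} (while-f {f} {p} l e) h =
        simulates-cons l
          (λ b db → trans (h zero _ b) (cong (λ z → toAction (comp (while f p) emb out zero _ z)) db))
          (cong (λ z → if z then _ else _) e)
          refl (λ _ _ → refl) simulates-stop

      exec-haltsWithin : ∀ {m T w' ip'} → Exec p₀ ⟨ 0 , (λ _ → decA zero) , 0 ⟩ m ⟨ ip' , w' , 0 ⟩ → 0 < Sp →
        suc m ≤ T → HaltsWithin M x T Sp (verdict (w' 0))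
      exec-haltsWithin {m} {T} {w'} {ip'} ex 0<Sp m<T
        with simulate {emb = suc} {out = zero} ex (λ _ _ _ → refl) (λ _ → zero) (λ _ → refl)
      -- The state `zero` in which the program ends is not yet `done`: one further step halts with
      -- the verdict on cell 0, where the head stands.
      ... | w₁' , ≈' , r = ⟶-haltsWithin
        (subst (λ b → initC M ⟶[ m + 1 ] done b) (cong verdict (≈' 0)) (r ▷ next 0<Sp (subst (λ y → y ⟶[ 0 ] done (verdict (decA (w₁' 0)))) (sym (stepC-halt {q = zero} {ip'} {w₁'} {0} refl)) stop)))
        (subst (_≤ T) (+-comm 1 m) m<T) 0<Sp

-- Encoding of tape cells and stacks

encVec : ∀ {b m} → Vec (Fin b) m → Fin (b ^ m)
encVec []       = zero
encVec (a ∷ as) = combine a (encVec as)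

decVec : ∀ {b} m → Fin (b ^ m) → Vec (Fin b) m
decVec zero    _ = []
decVec {b} (suc m) i = proj₁ (remQuot {b} (b ^ m) i) ∷ decVec m (proj₂ (remQuot {b} (b ^ m) i))

decVec-encVec : ∀ {b m} (as : Vec (Fin b) m) → decVec m (encVec as) ≡ as
decVec-encVec []       = refl
decVec-encVec {b} {suc m} (a ∷ as) =
  trans (cong (λ z → proj₁ z ∷ decVec m (proj₂ z)) (remQuot-combine {b} a (encVec as)))
        (cong (a ∷_) (decVec-encVec as))

Sym : Set
Sym = Fin 3

-- Stacks are listed top first and stored bottom first: the bottom is in
-- cell 0, and every cell above the top is blank (= zero).
at : List Sym → ℕ → Fin 4
at []      k = zero
at (a ∷ l) k = if k ≡ᵇ length l then suc a else at l k

≡ᵇ-refl : ∀ k → (k ≡ᵇ k) ≡ true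
≡ᵇ-refl zero    = refl
≡ᵇ-refl (suc k) = ≡ᵇ-refl k

≡ᵇ-≢ : ∀ {k m} → k ≢ m → (k ≡ᵇ m) ≡ false
≡ᵇ-≢ {zero}  {zero}  ne = ⊥-elim (ne refl)
≡ᵇ-≢ {zero}  {suc m} ne = refl
≡ᵇ-≢ {suc k} {zero}  ne = refl
≡ᵇ-≢ {suc k} {suc m} ne = ≡ᵇ-≢ (ne ∘ cong suc)

at-top : ∀ a l → at (a ∷ l) (length l) ≡ suc a
at-top a l rewrite ≡ᵇ-refl (length l) = refl

at-below : ∀ a l {k} → k ≢ length l → at (a ∷ l) k ≡ at l k
at-below a l ne rewrite ≡ᵇ-≢ ne = refl

at-blank : ∀ l {k} → length l ≤ k → at l k ≡ zero
at-blank []      _  = refl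
at-blank (a ∷ l) lt = trans (at-below a l (<⇒≢ lt ∘ sym)) (at-blank l (<⇒≤ lt))

blank? : Fin 4 → Bool
blank? zero    = true
blank? (suc _) = false

at-nonblank : ∀ l {k} → k < length l → blank? (at l k) ≡ false
at-nonblank (a ∷ l) {k} (s≤s k≤) with k ≟ length l
... | yes refl rewrite at-top a l = refl
... | no ne rewrite at-below a l ne = at-nonblank l (≤∧≢⇒< k≤ ne)

pop : List Sym → List Sym
pop []      = []
pop (_ ∷ l) = l

top : List Sym → Fin 4
top []      = zero
top (a ∷ _) = suc a

-- Stacks on the tracks of the work tape

module Stacks (K : ℕ) where

  Cell : Set
  Cell = Vec (Fin 4) (suc K)

  -- The machine's blank `zero` has to decode to the all-blank cell whatever number `encVec` assigns
  -- to that cell; the shift by `suc` keeps `zero` free for this.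
  encC : Cell → Fin (suc (4 ^ suc K))
  encC c = suc (encVec c)

  decC : Fin (suc (4 ^ suc K)) → Cell
  decC zero    = Vec.replicate (suc K) zero
  decC (suc i) = decVec (suc K) i

  open Structured encC decC decVec-encVec public

  -- The first track is blank except in cell 0, where it holds the flag.
  home : Bool → ℕ → Fin 4
  home false zero    = 1F
  home true  zero    = 2F
  home _     (suc _) = 0F

  cells : Bool → Vec (List Sym) K → ℕ → Cell
  cells fl ss k = home fl k ∷ Vec.map (λ l → at l k) ss

  track : Fin K → Cell → Fin 4
  track v c = lookup c (suc v)

  flag? : InSym → Cell → Bool
  flag? _ (2F ∷ _) = true
  flag? _ _        = false

  scanR : Fin K → Prog
  scanR v = while (λ _ c → not (blank? (track v c))) (act λ _ c → c , S , R)

  goHome : Prog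
  goHome = while (λ _ c → blank? (Vec.head c)) (act λ _ c → c , S , L)

  setFlag : (InSym → Bool) → Prog
  setFlag f = act λ i c → (home (f i) 0 ∷ Vec.tail c) , S , S

  stepL : Prog
  stepL = act λ _ c → c , S , L

  push : Fin K → Sym → Prog
  push v a = scanR v ⨾ act (λ _ c → (c [ suc v ]≔ suc a) , S , S) ⨾ goHome

  popP : Fin K → Prog
  popP v = scanR v ⨾ stepL ⨾ act (λ _ c → (c [ suc v ]≔ zero) , S , S) ⨾ goHome

  -- The outcome is known at the top of the stack but needed in cell 0. Branching into two copies of
  -- `goHome` makes the finite control remember it on the way.
  answer : Fin K → (Fin 4 → Bool) → Prog
  answer v f = ite (λ _ c → f (track v c)) (goHome ⨾ setFlag (λ _ → true)) (goHome ⨾ setFlag (λ _ → false))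

  test : Fin K → (Fin 4 → Bool) → Prog
  test v f = scanR v ⨾ stepL ⨾ answer v f

  moveHead : Dir → Prog
  moveHead d = act λ _ c → c , d , S

  whileT : Fin K → (Fin 4 → Bool) → Prog → Prog
  whileT v f p = test v f ⨾ while flag? (p ⨾ test v f)

  record State : Set where
    constructor ⟪_,_,_⟫
    field
      ip : ℕ
      fl : Bool
      ss : Vec (List Sym) K

  -- Running times of the stack operations

  module Timed (x : List Bool) (H : ℕ) where

    open Semantics x (suc H) public

    -- A stack operation walks from home to the top of a stack and back, over at most `H` cells each
    -- way; each cell walked costs one guard step and one move, which gives the term `4 * H`. The
    -- constant covers the remaining steps.
    unit : ℕ
    unit = 8 + 4 * H

    conf : State → Conf
    conf ⟪ ip , fl , ss ⟫ = ⟨ ip , cells fl ss , 0 ⟩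

    -- Time is counted in multiples of unit.
    record SRun (p : Prog) (s : State) (j : ℕ) (s' : State) : Set where
      constructor srun
      field
        steps  : ℕ
        steps≤ : steps ≤ j * unit
        exec   : Exec p (conf s) steps (conf s')

    module _ {ip : ℕ} {fl : Bool} {ss : Vec (List Sym) K} where

      track-cells : ∀ v k → track v (cells fl ss k) ≡ at (lookup ss v) k
      track-cells v k = lookup-map v (λ l → at l k) ss

      exec-scanR : ∀ v d j → j + d ≡ length (lookup ss v) → length (lookup ss v) ≤ H →
        Exec (scanR v) ⟨ ip , cells fl ss , j ⟩ (suc (2 * d)) ⟨ ip , cells fl ss , length (lookup ss v) ⟩
      exec-scanR v zero j e lt rewrite +-identityʳ j | sym e =
        while-f (s≤s lt) (cong (not ∘ blank?) (trans (track-cells v j) (at-blank (lookup ss v) (≤-reflexive (sym e)))))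
      exec-scanR v (suc d) j e lt =
        subst (λ m → Exec (scanR v) ⟨ ip , cells fl ss , j ⟩ (suc (suc m)) ⟨ ip , cells fl ss , length (lookup ss v) ⟩) (sym (+-suc d (d + 0)))
          (while-t (s≤s (≤-trans (<⇒≤ j<) lt)) (trans (cong (not ∘ blank?) (track-cells v j)) (cong not (at-nonblank (lookup ss v) j<)))
            (act (s≤s (≤-trans (<⇒≤ j<) lt)) refl refl (λ _ _ → refl))
            (exec-scanR v d (suc j) (trans (sym (+-suc j d)) e) lt))
        where
        j< : j < length (lookup ss v)
        j< = ≤-trans (s≤s (m≤m+n j d)) (≤-reflexive (trans (sym (+-suc j d)) e))

      exec-goHome : ∀ j → j ≤ H →
        Exec (goHome) ⟨ ip , cells fl ss , j ⟩ (suc (2 * j)) ⟨ ip , cells fl ss , 0 ⟩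
      exec-goHome zero lt = while-f (s≤s lt) (at-home fl)
        where
        at-home : ∀ fl → blank? (home fl 0) ≡ false
        at-home true  = refl
        at-home false = refl
      exec-goHome (suc j) lt =
        subst (λ m → Exec (goHome) ⟨ ip , cells fl ss , suc j ⟩ (suc (suc m)) ⟨ ip , cells fl ss , 0 ⟩) (sym (+-suc j (j + 0)))
          (while-t (s≤s lt) (away fl) (act (s≤s lt) refl refl (λ _ _ → refl)) (exec-goHome j (<⇒≤ lt)))
        where
        away : ∀ fl → blank? (home fl (suc j)) ≡ true
        away true  = refl
        away false = refl

      exec-write : ∀ v {j} a l' → j ≤ H → at l' j ≡ a →
        (∀ k → k ≢ j → at l' k ≡ at (lookup ss v) k) →
        Exec (act (λ _ c → (c [ suc v ]≔ a) , S , S)) ⟨ ip , cells fl ss , j ⟩ 1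
             ⟨ ip , cells fl (ss [ v ]≔ l') , j ⟩
      exec-write v {j} a l' lt here' elsewhere = act (s≤s lt) refl
        (cong (home fl j ∷_) (trans (map-[]≔ (λ l → at l j) ss v) (cong (Vec.map (λ l → at l j) ss [ v ]≔_) here')))
        (λ k ne → cong (home fl k ∷_) (trans (map-[]≔ (λ l → at l k) ss v)
          (trans (cong (Vec.map (λ l → at l k) ss [ v ]≔_) (trans (elsewhere k ne) (sym (lookup-map v (λ l → at l k) ss))))
                 ([]≔-lookup (Vec.map (λ l → at l k) ss) v))))

    length-pop : ∀ l → pred (length l) ≡ length (pop l)
    length-pop []      = refl
    length-pop (_ ∷ _) = refl

    -- The empty stack is included: there the left move is blocked in cell 0, and the blank read
    -- there is `top []`.
    at-pred : ∀ l → at l (pred (length l)) ≡ top l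
    at-pred []      = refl
    at-pred (a ∷ l) = at-top a l

    at-pop : ∀ l k → k ≢ length (pop l) → at (pop l) k ≡ at l k
    at-pop []      k ne = refl
    at-pop (a ∷ l) k ne = sym (at-below a l ne)

    moveW-L : ∀ k → moveW L k ≡ pred k
    moveW-L zero    = refl
    moveW-L (suc k) = refl

    pred≤ : ∀ {k} → k ≤ H → pred k ≤ H
    pred≤ le = ≤-trans pred[n]≤n le

    cost≤ : ∀ {a b} → a ≤ H → b ≤ H → suc (2 * a) + (1 + (1 + (suc (2 * b) + 1))) ≤ 1 * unit
    cost≤ {a} {b} a≤ b≤ = begin
      suc (2 * a) + (1 + (1 + (suc (2 * b) + 1))) ≡⟨ cong (λ z → suc (2 * a) + (2 + z)) (+-comm (suc (2 * b)) 1) ⟩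
      suc (2 * a) + (4 + 2 * b)                   ≤⟨ +-mono-≤ (s≤s (*-monoʳ-≤ 2 a≤)) (+-monoʳ-≤ 4 (*-monoʳ-≤ 2 b≤)) ⟩
      suc (2 * H) + (4 + 2 * H)                   ≡⟨ cong suc (trans (sym (+-assoc (2 * H) 4 (2 * H))) (trans (cong (_+ 2 * H) (+-comm (2 * H) 4)) (+-assoc 4 (2 * H) (2 * H)))) ⟩
      5 + (2 * H + 2 * H)                         ≡⟨ cong (5 +_) (sym (*-distribʳ-+ H 2 2)) ⟩
      5 + 4 * H                                   ≤⟨ +-monoˡ-≤ (4 * H) (m≤m+n 5 3) ⟩
      8 + 4 * H                                   ≡⟨ sym (+-identityʳ _) ⟩
      1 * unit                                    ∎
      where open ≤-Reasoning

    1≤unit : ∀ {m j} → m ≤ j * unit → suc m ≤ (1 + j) * unit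
    1≤unit le = +-mono-≤ (s≤s z≤n) le

    module _ {ip : ℕ} {fl : Bool} (ss : Vec (List Sym) K) where

      exec-stepL : ∀ {j} → j ≤ H → Exec stepL ⟨ ip , cells fl ss , j ⟩ 1 ⟨ ip , cells fl ss , pred j ⟩
      exec-stepL {j} le = subst (λ z → Exec stepL ⟨ ip , cells fl ss , j ⟩ 1 ⟨ ip , cells fl ss , z ⟩) (moveW-L j)
        (act (s≤s le) refl refl (λ _ _ → refl))

      run-push : ∀ v a → length (lookup ss v) ≤ H →
        SRun (push v a) ⟪ ip , fl , ss ⟫ 1 ⟪ ip , fl , ss [ v ]≔ (a ∷ lookup ss v) ⟫
      run-push v a le = srun _
        (≤-trans (+-monoʳ-≤ (suc (2 * length (lookup ss v))) (s≤s (≤-trans (m≤m+n _ 1) (n≤1+n _)))) (cost≤ le le))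
        (exec-scanR v (length (lookup ss v)) 0 refl le ⨾
         exec-write v (suc a) (a ∷ lookup ss v) le (at-top a (lookup ss v)) (λ k ne → at-below a (lookup ss v) ne) ⨾
         exec-goHome _ le)

      run-pop : ∀ v → length (lookup ss v) ≤ H →
        SRun (popP v) ⟪ ip , fl , ss ⟫ 1 ⟪ ip , fl , ss [ v ]≔ pop (lookup ss v) ⟫
      run-pop v le = srun _ (≤-trans (+-monoʳ-≤ (suc (2 * length (lookup ss v))) (s≤s (s≤s (m≤m+n _ 1)))) (cost≤ le (pred≤ le)))
        (exec-scanR v (length l) 0 refl le ⨾
         exec-stepL le ⨾
         exec-write v zero (pop l) (pred≤ le)
           (at-blank (pop l) (≤-reflexive (sym (length-pop l))))
           (λ k ne → at-pop l k (subst (k ≢_) (length-pop l) ne)) ⨾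
         exec-goHome _ (pred≤ le))
        where l = lookup ss v

      exec-setFlag : ∀ f → Exec (setFlag f) ⟨ ip , cells fl ss , 0 ⟩ 1 ⟨ ip , cells (f (readIn x ip)) ss , 0 ⟩
      exec-setFlag f = act (s≤s z≤n) refl refl
        (λ { zero ne → ⊥-elim (ne refl) ; (suc k) _ → cong (_∷ _) (trans (home-suc (f (readIn x ip))) (sym (home-suc fl))) })
        where
        home-suc : ∀ fl {k} → home fl (suc k) ≡ 0F
        home-suc true  = refl
        home-suc false = refl

      run-test : ∀ v f → length (lookup ss v) ≤ H →
        SRun (test v f) ⟪ ip , fl , ss ⟫ 1 ⟪ ip , f (top (lookup ss v)) , ss ⟫
      run-test v f le = srun _ (cost≤ le (pred≤ le))
        (exec-scanR v (length l) 0 refl le ⨾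
         exec-stepL le ⨾
         branch (f (top l)) refl)
        where
        l = lookup ss v
        branch : ∀ b → f (top l) ≡ b →
          Exec (answer v f) ⟨ ip , cells fl ss , pred (length l) ⟩ (suc (suc (2 * pred (length l)) + 1)) ⟨ ip , cells b ss , 0 ⟩
        branch true  e = ite-t (s≤s (pred≤ le)) (trans (cong f (trans (track-cells {ip} {fl} {ss} v _) (at-pred l))) e)
          (exec-goHome _ (pred≤ le) ⨾ exec-setFlag (λ _ → true))
        branch false e = ite-f (s≤s (pred≤ le)) (trans (cong f (trans (track-cells {ip} {fl} {ss} v _) (at-pred l))) e)
          (exec-goHome _ (pred≤ le) ⨾ exec-setFlag (λ _ → false))

      one≤unit : 1 ≤ 1 * unit
      one≤unit = s≤s z≤n

      run-setFlag : ∀ f → SRun (setFlag f) ⟪ ip , fl , ss ⟫ 1 ⟪ ip , f (readIn x ip) , ss ⟫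
      run-setFlag f = srun 1 one≤unit (exec-setFlag f)

      run-moveHead : ∀ d → SRun (moveHead d) ⟪ ip , fl , ss ⟫ 1 ⟪ moveIn (length x) d ip , fl , ss ⟫
      run-moveHead d = srun 1 one≤unit (act (s≤s z≤n) refl refl (λ _ _ → refl))

    infixr 5 _⨟_
    _⨟_ : ∀ {p r s s' s'' j j'} → SRun p s j s' → SRun r s' j' s'' → SRun (p ⨾ r) s (j + j') s''
    _⨟_ {j = j} {j'} (srun m m≤ e) (srun m' m'≤ e') =
      srun (m + m') (≤-trans (+-mono-≤ m≤ m'≤) (≤-reflexive (sym (*-distribʳ-+ unit j j')))) (e ⨾ e')

    run-weaken : ∀ {p s s' j j'} → j ≤ j' → SRun p s j s' → SRun p s j' s'
    run-weaken le (srun m m≤ e) = srun m (≤-trans m≤ (*-monoˡ-≤ unit le)) e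

    run-ite-t : ∀ {p r ip ss s' j} → SRun p ⟪ ip , true , ss ⟫ j s' → SRun (ite flag? p r) ⟪ ip , true , ss ⟫ (1 + j) s'
    run-ite-t {j = j} (srun m m≤ e) = srun (suc m) (1≤unit {j = j} m≤) (ite-t (s≤s z≤n) refl e)

    run-ite-f : ∀ {p r ip ss s' j} → SRun r ⟪ ip , false , ss ⟫ j s' → SRun (ite flag? p r) ⟪ ip , false , ss ⟫ (1 + j) s'
    run-ite-f {j = j} (srun m m≤ e) = srun (suc m) (1≤unit {j = j} m≤) (ite-f (s≤s z≤n) refl e)

    -- Loops whose guard is a subprogram leaving its verdict in the flag.
    run-loop-f : ∀ {g p s ip ss j} → SRun g s j ⟪ ip , false , ss ⟫ →
      SRun (g ⨾ while flag? (p ⨾ g)) s (j + 1) ⟪ ip , false , ss ⟫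
    run-loop-f rg = rg ⨟ srun 1 (s≤s z≤n) (while-f (s≤s z≤n) refl)

    run-loop-t : ∀ {g p s ip ss s' s'' j j' j''} → SRun g s j ⟪ ip , true , ss ⟫ → SRun p ⟪ ip , true , ss ⟫ j' s' →
      SRun (g ⨾ while flag? (p ⨾ g)) s' j'' s'' →
      SRun (g ⨾ while flag? (p ⨾ g)) s (j + (1 + (j' + j''))) s''
    run-loop-t {j' = j'} {j''} rg (srun m m≤ e) (srun _ n≤ (_⨾_ {m = a} {m' = b} eg ew)) = rg ⨟
      -- The guard that opens the rest of the loop is the guard that closes the present round, so
      -- its run is split off and regrouped with the body.
      srun (suc ((m + a) + b))
       (1≤unit {j = j' + j''} (≤-trans (≤-reflexive (+-assoc m a b)) (≤-trans (+-mono-≤ m≤ n≤) (≤-reflexive (sym (*-distribʳ-+ unit j' j''))))))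
       (while-t (s≤s z≤n) refl (e ⨾ eg) ew)

-- Stacks of numbers

-- Bijective binary numerals, least significant digit first: false is the digit 1 and true the digit 2.
incD : List Bool → List Bool
incD []           = false ∷ []
incD (false ∷ ds) = true ∷ ds
incD (true ∷ ds)  = false ∷ incD ds

bin : ℕ → List Bool
bin zero    = []
bin (suc k) = incD (bin k)

-- The two shapes that an increment distinguishes: the carry runs through a block of 2s and either
-- leaves the numeral, which grows by a digit, or stops at a 1.
data Carry : List Bool → Set where
  all-2s  : ∀ k → Carry (replicate k true)
  then-1 : ∀ k ds → Carry (replicate k true ++ false ∷ ds)

carry : ∀ ds → Carry ds
carry []           = all-2s 0
carry (false ∷ ds) = then-1 0 ds
carry (true ∷ ds) with carry ds
... | all-2s k   = all-2s (suc k)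
... | then-1 k _ = then-1 (suc k) _

incD-all-2s : ∀ k → incD (replicate k true) ≡ replicate (suc k) false
incD-all-2s zero    = refl
incD-all-2s (suc k) = cong (false ∷_) (incD-all-2s k)

incD-then-1 : ∀ k ds → incD (replicate k true ++ false ∷ ds) ≡ replicate k false ++ true ∷ ds
incD-then-1 zero    ds = refl
incD-then-1 (suc k) ds = cong (false ∷_) (incD-then-1 k ds)

value : List Bool → ℕ
value []           = 0
value (false ∷ ds) = 1 + 2 * value ds
value (true ∷ ds)  = 2 + 2 * value ds

value-incD : ∀ ds → value (incD ds) ≡ suc (value ds)
value-incD []           = refl
value-incD (false ∷ ds) = refl
value-incD (true ∷ ds)  rewrite value-incD ds = cong suc (*-suc 2 (value ds))

value-bin : ∀ k → value (bin k) ≡ k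
value-bin zero    = refl
value-bin (suc k) = trans (value-incD (bin k)) (cong suc (value-bin k))

-- The smallest bijective numeral with m digits consists of 1s only and has the value 2 ^ m - 1.
2^length≤value : ∀ ds → 2 ^ length ds ≤ suc (value ds)
2^length≤value []       = ≤-refl
2^length≤value (d ∷ ds) = ≤-trans (*-monoʳ-≤ 2 (2^length≤value ds)) (≤-trans (≤-reflexive (*-suc 2 (value ds))) (s≤s (lower d)))
  where
  lower : ∀ d → suc (2 * value ds) ≤ value (d ∷ ds)
  lower false = ≤-refl
  lower true  = n≤1+n _

2^length-bin≤ : ∀ k → 2 ^ length (bin k) ≤ suc k
2^length-bin≤ k = subst (λ z → 2 ^ length (bin k) ≤ suc z) (value-bin k) (2^length≤value (bin k))

digit : Bool → Sym
digit false = 0F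
digit true  = 1F

sep : Sym
sep = 2F

digits : List Bool → List Sym
digits = map digit

-- As zero has no digits, the top symbol alone tells the cases apart: a digit for a positive number,
-- `sep` for zero, a blank for an empty stack. Zero tests thus cost a single stack operation.
enc : List ℕ → List Sym
enc []       = []
enc (x ∷ xs) = digits (bin x) ++ sep ∷ enc xs

is1 is2 isSep isDigit nonblank : Fin 4 → Bool
is1 1F = true
is1 _  = false
is2 2F = true
is2 _  = false
isSep 3F = true
isSep _  = false
isDigit 1F = true
isDigit 2F = true
isDigit _  = false
nonblank a = not (blank? a)

isDigit-top : ∀ d l → isDigit (top (digit d ∷ l)) ≡ true
isDigit-top false l = refl
isDigit-top true  l = refl

module Numbers (K : ℕ) where

  open Stacks (suc K) public

  aux : Fin (suc K)
  aux = zero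

  data Op : Set where
    push0 drop inc dec : Fin K → Op
    dup                : (from to : Fin K) → Op
    head               : Dir → Op

  flush : Fin K → Bool → Prog
  flush v d = whileT aux nonblank (popP aux ⨾ push (suc v) (digit d))

  spill : Fin K → (Fin 4 → Bool) → Prog
  spill v f = whileT (suc v) f (popP (suc v) ⨾ push aux 0F)

  -- An increment turns a leading block of 2s into 1s and a decrement does the reverse. The block
  -- therefore only needs to be counted, in unary on the track `aux`, and `flush` writes it back
  -- with the other digit.
  dropP incP decP : Fin K → Prog
  dropP v = whileT (suc v) isDigit (popP (suc v)) ⨾ popP (suc v)
  incP v = spill v is2 ⨾ (test (suc v) is1 ⨾ ite flag? (popP (suc v) ⨾ push (suc v) 1F) (push (suc v) 0F)) ⨾ flush v false
  decP v = spill v is1 ⨾ (test (suc v) is2 ⨾ ite flag? (popP (suc v) ⨾ push (suc v) 0F) (popP aux)) ⨾ flush v true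

  -- Reading the digits of a number removes them. They go to `aux` in reverse order, and popping
  -- them from there restores the order while both the source and the copy are rebuilt.
  unloadP : Fin K → Prog
  unloadP v = whileT (suc v) isDigit
    (test (suc v) is1 ⨾ ite flag? (popP (suc v) ⨾ push aux 0F) (popP (suc v) ⨾ push aux 1F))

  reloadP : Fin K → Fin K → Prog
  reloadP v u = whileT aux nonblank
    (test aux is1 ⨾ ite flag? (popP aux ⨾ push (suc v) 0F ⨾ push (suc u) 0F) (popP aux ⨾ push (suc v) 1F ⨾ push (suc u) 1F))

  opP : Op → Prog
  opP (push0 v) = push (suc v) sep
  opP (drop v)  = dropP v
  opP (inc v)   = incP v
  opP (dec v)   = decP v
  opP (dup v u) = unloadP v ⨾ push (suc u) sep ⨾ reloadP v u
  opP (head d)  = moveHead d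

  -- Correctness and cost of the operations on numerals

  module SymbolRuns (x : List Bool) (H : ℕ) where

    open Timed x H public

    module _ {ip : ℕ} {fl : Bool} {ss : Vec (List Sym) (suc K)} where

      push-at : ∀ w s {m ss'} → lookup ss w ≡ m → ss [ w ]≔ (s ∷ m) ≡ ss' → length m ≤ H →
        SRun (push w s) ⟪ ip , fl , ss ⟫ 1 ⟪ ip , fl , ss' ⟫
      push-at w s refl refl le = run-push ss w s le

      pop-at : ∀ w {s m ss'} → lookup ss w ≡ s ∷ m → ss [ w ]≔ m ≡ ss' → suc (length m) ≤ H →
        SRun (popP w) ⟪ ip , fl , ss ⟫ 1 ⟪ ip , fl , ss' ⟫
      pop-at w {s} {m} e refl le =
        subst (λ z → SRun (popP w) ⟪ ip , fl , ss ⟫ 1 ⟪ ip , fl , ss [ w ]≔ pop z ⟫) e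
          (run-pop ss w (subst (λ z → length z ≤ H) (sym e) le))

      test-at : ∀ w f {m b} → lookup ss w ≡ m → f (top m) ≡ b → length m ≤ H →
        SRun (test w f) ⟪ ip , fl , ss ⟫ 1 ⟪ ip , b , ss ⟫
      test-at w f refl refl le = run-test ss w f le

    replicate-snoc : ∀ k (s : Sym) l → replicate k s ++ (s ∷ l) ≡ s ∷ (replicate k s ++ l)
    replicate-snoc zero    s l = refl
    replicate-snoc (suc k) s l = cong (s ∷_) (replicate-snoc k s l)

    module OnStack (ip : ℕ) (v : Fin K) (ss : Vec (List Sym) K) where

      X : List Sym → List Sym → Vec (List Sym) (suc K)
      X a m = a ∷ (ss [ v ]≔ m)

      X-get : ∀ m → lookup (ss [ v ]≔ m) v ≡ m
      X-get m = lookup∘update v ss m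

      X-set : ∀ a m m' → X a m [ suc v ]≔ m' ≡ X a m'
      X-set a m m' = cong (a ∷_) ([]≔-idempotent ss v)

      flush-run : ∀ d k m {fl} → k + length m ≤ H →
        SRun (flush v d) ⟪ ip , fl , X (replicate k 0F) m ⟫ (2 + k * 4) ⟪ ip , false , X [] (replicate k (digit d) ++ m) ⟫
      flush-run d zero    m le = run-loop-f (test-at aux nonblank refl refl z≤n)
      flush-run d (suc k) m {fl} le =
        subst (λ z → SRun (flush v d) ⟪ ip , fl , X (replicate (suc k) 0F) m ⟫ (2 + suc k * 4) ⟪ ip , false , X [] z ⟫)
          (replicate-snoc k (digit d) m)
          (run-weaken (≤-reflexive (solve₁ k))
          (run-loop-t (test-at aux nonblank refl refl kH)
            (pop-at aux refl refl kH ⨟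
             push-at (suc v) (digit d) (X-get m) (X-set _ m _) (≤-trans (m≤n+m (length m) (suc k)) le))
            (flush-run d k (digit d ∷ m) (≤-trans (≤-reflexive (+-suc k (length m))) le))))
        where
        kH : suc (length (replicate k (digit false))) ≤ H
        kH rewrite length-replicate k {digit false} = ≤-trans (m≤m+n (suc k) (length m)) le
        solve₁ : ∀ k → 1 + (1 + (2 + (2 + k * 4))) ≡ 2 + suc k * 4
        solve₁ = solve-∀

      spill-run : ∀ f d k a m {fl} → f (suc (digit d)) ≡ true → f (top m) ≡ false → k + a ≤ H → k + length m ≤ H →
        SRun (spill v f) ⟪ ip , fl , X (replicate a 0F) (replicate k (digit d) ++ m) ⟫ (2 + k * 4)
                         ⟪ ip , false , X (replicate (k + a) 0F) m ⟫
      spill-run f d zero a m ft ff le le' = run-loop-f (test-at (suc v) f (X-get m) ff le')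
      spill-run f d (suc k) a m {fl} ft ff le le' =
        subst (λ z → SRun (spill v f) ⟪ ip , fl , X (replicate a 0F) (replicate (suc k) (digit d) ++ m) ⟫ (2 + suc k * 4) ⟪ ip , false , X (replicate z 0F) m ⟫)
          (+-suc k a)
          (run-weaken (≤-reflexive (solve₁ k))
          (run-loop-t (test-at (suc v) f (X-get _) ft kH)
            (pop-at (suc v) (X-get _) (X-set _ _ _) kH ⨟
             push-at aux 0F refl refl (≤-trans (≤-reflexive (length-replicate a)) (≤-trans (m≤n+m a (suc k)) le)))
            (spill-run f d k (suc a) m ft ff (≤-trans (≤-reflexive (+-suc k a)) le) (<⇒≤ le'))))
        where
        kH : suc (length (replicate k (digit d) ++ m)) ≤ H
        kH rewrite length-++ (replicate k (digit d)) {m} | length-replicate k {digit d} = le'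
        solve₁ : ∀ k → 1 + (1 + (2 + (2 + k * 4))) ≡ 2 + suc k * 4
        solve₁ = solve-∀

      module _ (tl : List Sym) where

        S+ : List Bool → List Sym
        S+ ds = digits ds ++ sep ∷ tl

        S+-replicate : ∀ k d ds → S+ (replicate k d ++ ds) ≡ replicate k (digit d) ++ S+ ds
        S+-replicate zero    d ds = refl
        S+-replicate (suc k) d ds = cong (digit d ∷_) (S+-replicate k d ds)

        S+-replicate₀ : ∀ k d → S+ (replicate k d) ≡ replicate k (digit d) ++ sep ∷ tl
        S+-replicate₀ zero    d = refl
        S+-replicate₀ (suc k) d = cong (digit d ∷_) (S+-replicate₀ k d)

        length-rep : ∀ k (s : Sym) m → length (replicate k s ++ m) ≡ k + length m
        length-rep k s m = trans (length-++ (replicate k s)) (cong (_+ length m) (length-replicate k))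

        inc-run : ∀ ds {fl} → length (S+ ds) ≤ H → length (S+ (incD ds)) ≤ H →
          SRun (incP v) ⟪ ip , fl , X [] (S+ ds) ⟫ (8 + length ds * 8) ⟪ ip , false , X [] (S+ (incD ds)) ⟫
        inc-run ds {fl} le le' with carry ds
        ... | all-2s k rewrite incD-all-2s k | S+-replicate₀ k true | S+-replicate₀ k false
                             | length-rep k 1F (sep ∷ tl) | length-rep k 0F (sep ∷ tl) | length-replicate k {true} =
          run-weaken (≤-trans (≤-reflexive (solve₁ k)) (n≤1+n _))
          (spill-run is2 true k 0 (sep ∷ tl) refl refl (≤-trans (+-monoʳ-≤ k z≤n) le) le ⨟
           (test-at (suc v) is1 (X-get _) refl (≤-trans (m≤n+m _ k) le) ⨟
            run-ite-f (push-at (suc v) 0F (X-get _) (X-set _ _ _) (≤-trans (m≤n+m _ k) le))) ⨟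
           subst₂ (λ y z → SRun (flush v false) ⟪ ip , false , X (replicate y 0F) (0F ∷ sep ∷ tl) ⟫ (2 + k * 4) ⟪ ip , false , X [] z ⟫)
             (sym (+-identityʳ k)) (replicate-snoc k 0F (sep ∷ tl))
             (flush-run false k (0F ∷ sep ∷ tl) (≤-trans (≤-reflexive (+-suc k _)) le')))
          where
          solve₁ : ∀ k → (2 + k * 4) + ((1 + (1 + 1)) + (2 + k * 4)) ≡ 7 + k * 8
          solve₁ = solve-∀
        ... | then-1 k ds' rewrite incD-then-1 k ds' | S+-replicate k true (false ∷ ds') | S+-replicate k false (true ∷ ds')
                             | length-rep k 1F (S+ (false ∷ ds')) | length-rep k 0F (S+ (true ∷ ds'))
                             | length-++ (replicate k true) {false ∷ ds'} | length-replicate k {true} =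
          run-weaken (≤-trans (≤-reflexive (solve₁ k)) (+-monoʳ-≤ 8 (*-monoˡ-≤ 8 (m≤m+n k _))))
          (spill-run is2 true k 0 (S+ (false ∷ ds')) refl refl (≤-trans (+-monoʳ-≤ k z≤n) le) le ⨟
           (test-at (suc v) is1 (X-get _) refl (≤-trans (m≤n+m _ k) le) ⨟
            run-ite-t (pop-at (suc v) (X-get _) (X-set _ _ _) (≤-trans (m≤n+m _ k) le) ⨟
                       push-at (suc v) 1F (X-get _) (X-set _ _ _) (≤-trans (n≤1+n _) (≤-trans (m≤n+m _ k) le)))) ⨟
           subst (λ y → SRun (flush v false) ⟪ ip , true , X (replicate y 0F) (S+ (true ∷ ds')) ⟫ (2 + k * 4) ⟪ ip , false , X [] (replicate k 0F ++ S+ (true ∷ ds')) ⟫)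
             (sym (+-identityʳ k))
             (flush-run false k (S+ (true ∷ ds')) le'))
          where
          solve₁ : ∀ k → (2 + k * 4) + ((1 + (1 + (1 + 1))) + (2 + k * 4)) ≡ 8 + k * 8
          solve₁ = solve-∀

        dec-run : ∀ ds {fl} → length (S+ ds) ≤ H → length (S+ (incD ds)) ≤ H →
          SRun (decP v) ⟪ ip , fl , X [] (S+ (incD ds)) ⟫ (13 + length ds * 8) ⟪ ip , false , X [] (S+ ds) ⟫
        dec-run ds {fl} le le' with carry ds
        ... | all-2s k rewrite incD-all-2s k | S+-replicate₀ k true | S+-replicate₀ k false
                             | length-rep k 1F (sep ∷ tl) | length-rep k 0F (sep ∷ tl) | length-replicate k {true} =
          run-weaken (≤-trans (≤-reflexive (solve₁ k)) (+-monoˡ-≤ (k * 8) (m≤m+n 11 2)))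
          -- The successor of a numeral of k digits 2 has one digit more. So `suc k` tallies are
          -- spilled, and the `popP aux` in the negative branch discards the extra one.
          (spill-run is1 false (suc k) 0 (sep ∷ tl) refl refl (≤-trans (s≤s (+-monoʳ-≤ k z≤n)) le') le' ⨟
           (test-at (suc v) is2 (X-get _) refl (≤-trans (m≤n+m _ k) le) ⨟
            run-ite-f (pop-at aux refl refl (≤-trans (≤-reflexive (trans (cong suc (length-replicate (k + 0))) (cong suc (+-identityʳ k)))) (≤-trans (m≤m+n _ _) le')))) ⨟
           subst (λ y → SRun (flush v true) ⟪ ip , false , X (replicate y 0F) (sep ∷ tl) ⟫ (2 + k * 4) ⟪ ip , false , X [] (replicate k 1F ++ sep ∷ tl) ⟫)
             (sym (+-identityʳ k))
             (flush-run true k (sep ∷ tl) le))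
          where
          solve₁ : ∀ k → (2 + suc k * 4) + ((1 + (1 + 1)) + (2 + k * 4)) ≡ 11 + k * 8
          solve₁ = solve-∀
        ... | then-1 k ds' rewrite incD-then-1 k ds' | S+-replicate k true (false ∷ ds') | S+-replicate k false (true ∷ ds')
                             | length-rep k 1F (S+ (false ∷ ds')) | length-rep k 0F (S+ (true ∷ ds'))
                             | length-++ (replicate k true) {false ∷ ds'} | length-replicate k {true} =
          run-weaken (≤-trans (≤-reflexive (solve₁ k)) (+-mono-≤ (m≤m+n 8 5) (*-monoˡ-≤ 8 (m≤m+n k _))))
          (spill-run is1 false k 0 (S+ (true ∷ ds')) refl refl (≤-trans (+-monoʳ-≤ k z≤n) le) le' ⨟
           (test-at (suc v) is2 (X-get _) refl (≤-trans (m≤n+m _ k) le) ⨟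
            run-ite-t (pop-at (suc v) (X-get _) (X-set _ _ _) (≤-trans (m≤n+m _ k) le) ⨟
                       push-at (suc v) 0F (X-get _) (X-set _ _ _) (≤-trans (n≤1+n _) (≤-trans (m≤n+m _ k) le)))) ⨟
           subst (λ y → SRun (flush v true) ⟪ ip , true , X (replicate y 0F) (S+ (false ∷ ds')) ⟫ (2 + k * 4) ⟪ ip , false , X [] (replicate k 1F ++ S+ (false ∷ ds')) ⟫)
             (sym (+-identityʳ k))
             (flush-run true k (S+ (false ∷ ds')) le))
          where
          solve₁ : ∀ k → (2 + k * 4) + ((1 + (1 + (1 + 1))) + (2 + k * 4)) ≡ 8 + k * 8
          solve₁ = solve-∀

        drop-run : ∀ ds {fl} → length (S+ ds) ≤ H →
          SRun (dropP v) ⟪ ip , fl , X [] (S+ ds) ⟫ (3 + length ds * 3) ⟪ ip , false , X [] tl ⟫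
        drop-run ds le = run-weaken (≤-reflexive (+-comm (2 + length ds * 3) 1))
          (digits-off ds le ⨟ pop-at (suc v) (X-get _) (X-set _ _ _) (last ds le))
          where
          last : ∀ ds → length (S+ ds) ≤ H → suc (length tl) ≤ H
          last []       le = le
          last (d ∷ ds) le = last ds (<⇒≤ le)
          digits-off : ∀ ds {fl} → length (S+ ds) ≤ H →
            SRun (whileT (suc v) isDigit (popP (suc v))) ⟪ ip , fl , X [] (S+ ds) ⟫ (2 + length ds * 3) ⟪ ip , false , X [] (sep ∷ tl) ⟫
          digits-off []       le = run-loop-f (test-at (suc v) isDigit (X-get _) refl le)
          digits-off (d ∷ ds) le = run-weaken (≤-reflexive (solve₁ (length ds)))
            (run-loop-t (test-at (suc v) isDigit (X-get _) (isDigit-top d (S+ ds)) le)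
              (pop-at (suc v) (X-get _) (X-set _ _ _) le) (digits-off ds (<⇒≤ le)))
            where
            solve₁ : ∀ k → 1 + (1 + (1 + (2 + k * 3))) ≡ 2 + suc k * 3
            solve₁ = solve-∀

    module OnTwo (ip : ℕ) (v u : Fin K) (v≢u : v ≢ u) (ss : Vec (List Sym) K) (tl : List Sym) where

      Y : List Bool → List Sym → List Sym → Vec (List Sym) (suc K)
      Y a m m' = digits a ∷ ((ss [ v ]≔ m) [ u ]≔ m')

      get-v : ∀ m m' → lookup ((ss [ v ]≔ m) [ u ]≔ m') v ≡ m
      get-v m m' = trans (lookup∘update′ v≢u (ss [ v ]≔ m) m') (lookup∘update v ss m)

      get-u : ∀ m m' → lookup ((ss [ v ]≔ m) [ u ]≔ m') u ≡ m'
      get-u m m' = lookup∘update u (ss [ v ]≔ m) m'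

      set-v : ∀ a m m' m'' → Y a m m' [ suc v ]≔ m'' ≡ Y a m'' m'
      set-v a m m' m'' = cong (digits a ∷_)
        (trans ([]≔-commutes (ss [ v ]≔ m) u v (v≢u ∘ sym)) (cong (_[ u ]≔ m') ([]≔-idempotent ss v)))

      set-u : ∀ a m m' m'' → Y a m m' [ suc u ]≔ m'' ≡ Y a m m''
      set-u a m m' m'' = cong (digits a ∷_) ([]≔-idempotent (ss [ v ]≔ m) u)

      unload-run : ∀ ds a {m' fl} → length ds + length a ≤ H → length (digits ds ++ sep ∷ tl) ≤ H →
        SRun (unloadP v) ⟪ ip , fl , Y a (digits ds ++ sep ∷ tl) m' ⟫ (2 + length ds * 6)
                         ⟪ ip , false , Y (ds ʳ++ a) (sep ∷ tl) m' ⟫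
      unload-run [] a le le' = run-loop-f (test-at (suc v) isDigit (get-v _ _) refl le')
      unload-run (d ∷ ds) a le le' = run-weaken (≤-reflexive (solve₁ (length ds)))
        (run-loop-t (test-at (suc v) isDigit (get-v _ _) (isDigit-top d (digits ds ++ sep ∷ tl)) le')
          (body d le le')
          (unload-run ds (d ∷ a) (≤-trans (≤-reflexive (+-suc (length ds) (length a))) le) (<⇒≤ le')))
        where
        solve₁ : ∀ k → 1 + (1 + (4 + (2 + k * 6))) ≡ 2 + suc k * 6
        solve₁ = solve-∀
        aH : length (digits a) ≤ H
        aH = ≤-trans (≤-reflexive (length-map digit a)) (≤-trans (m≤n+m (length a) (suc (length ds))) le)
        body : ∀ d {m' fl} → length (d ∷ ds) + length a ≤ H → length (digits (d ∷ ds) ++ sep ∷ tl) ≤ H →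
          SRun (test (suc v) is1 ⨾ ite flag? (popP (suc v) ⨾ push aux 0F) (popP (suc v) ⨾ push aux 1F))
            ⟪ ip , fl , Y a (digits (d ∷ ds) ++ sep ∷ tl) m' ⟫ 4 ⟪ ip , not d , Y (d ∷ a) (digits ds ++ sep ∷ tl) m' ⟫
        body false le le' = test-at (suc v) is1 (get-v _ _) refl le' ⨟
          run-ite-t (pop-at (suc v) (get-v _ _) (set-v _ _ _ _) le' ⨟ push-at aux 0F refl refl aH)
        body true le le' = test-at (suc v) is1 (get-v _ _) refl le' ⨟
          run-ite-f (pop-at (suc v) (get-v _ _) (set-v _ _ _ _) le' ⨟ push-at aux 1F refl refl aH)

      reload-run : ∀ a m m' {fl} → length a + length m ≤ H → length a + length m' ≤ H →
        SRun (reloadP v u) ⟪ ip , fl , Y a m m' ⟫ (2 + length a * 7)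
                           ⟪ ip , false , Y [] (digits a ʳ++ m) (digits a ʳ++ m') ⟫
      reload-run [] m m' le le' = run-loop-f (test-at aux nonblank refl refl z≤n)
      reload-run (d ∷ a) m m' le le' = run-weaken (≤-reflexive (solve₁ (length a)))
        (run-loop-t (test-at aux nonblank refl refl aH) (body d)
          (reload-run a (digit d ∷ m) (digit d ∷ m') (≤-trans (≤-reflexive (+-suc (length a) _)) le) (≤-trans (≤-reflexive (+-suc (length a) _)) le')))
        where
        solve₁ : ∀ k → 1 + (1 + (5 + (2 + k * 7))) ≡ 2 + suc k * 7
        solve₁ = solve-∀
        aH : suc (length (digits a)) ≤ H
        aH = ≤-trans (≤-reflexive (cong suc (length-map digit a))) (≤-trans (m≤m+n (suc (length a)) (length m)) le)
        mH : length m ≤ H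
        mH = ≤-trans (m≤n+m (length m) (suc (length a))) le
        m'H : length m' ≤ H
        m'H = ≤-trans (m≤n+m (length m') (suc (length a))) le'
        body : ∀ d {fl} →
          SRun (test aux is1 ⨾ ite flag? (popP aux ⨾ push (suc v) 0F ⨾ push (suc u) 0F) (popP aux ⨾ push (suc v) 1F ⨾ push (suc u) 1F))
            ⟪ ip , fl , Y (d ∷ a) m m' ⟫ 5 ⟪ ip , not d , Y a (digit d ∷ m) (digit d ∷ m') ⟫
        body false = test-at aux is1 refl refl aH ⨟ run-ite-t (pop-at aux refl refl aH ⨟
          push-at (suc v) 0F (get-v _ _) (set-v a m m' _) mH ⨟ push-at (suc u) 0F (get-u _ _) (set-u a _ m' _) m'H)
        body true = test-at aux is1 refl refl aH ⨟ run-ite-f (pop-at aux refl refl aH ⨟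
          push-at (suc v) 1F (get-v _ _) (set-v a m m' _) mH ⨟ push-at (suc u) 1F (get-u _ _) (set-u a _ m' _) m'H)

      digits-ʳ++ : ∀ ds a m → digits (ds ʳ++ a) ʳ++ m ≡ digits a ʳ++ (digits ds ++ m)
      digits-ʳ++ []       a m = refl
      digits-ʳ++ (d ∷ ds) a m = digits-ʳ++ ds (d ∷ a) m

      dup-run : ∀ ds m' {fl} → length (digits ds ++ sep ∷ tl) ≤ H → length (digits ds ++ sep ∷ m') ≤ H →
        SRun (opP (dup v u)) ⟪ ip , fl , Y [] (digits ds ++ sep ∷ tl) m' ⟫ (5 + length ds * 13)
                             ⟪ ip , false , Y [] (digits ds ++ sep ∷ tl) (digits ds ++ sep ∷ m') ⟫
      dup-run ds m' {fl} le le' =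
        subst₂ (λ y z → SRun (opP (dup v u)) ⟪ ip , fl , Y [] (digits ds ++ sep ∷ tl) m' ⟫ (5 + length ds * 13) ⟪ ip , false , Y [] y z ⟫)
          (digits-ʳ++ ds [] (sep ∷ tl)) (digits-ʳ++ ds [] (sep ∷ m'))
          (run-weaken (≤-reflexive (trans (cong (λ z → 2 + length ds * 6 + (1 + (2 + z * 7))) len) (solve₁ (length ds))))
          (unload-run ds [] (subst (_≤ H) (sym (+-identityʳ _)) (≤-trans (len≤ tl) le)) le ⨟
           push-at (suc u) sep (get-u _ _) (set-u (ds ʳ++ []) _ m' _) (<⇒≤ (bump le')) ⨟
           reload-run (ds ʳ++ []) (sep ∷ tl) (sep ∷ m') (fits tl le) (fits m' le')))
        where
        solve₁ : ∀ k → 2 + k * 6 + (1 + (2 + k * 7)) ≡ 5 + k * 13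
        solve₁ = solve-∀
        len : length (ds ʳ++ []) ≡ length ds
        len = trans (length-ʳ++ ds) (+-identityʳ _)
        total : ∀ l → length (digits ds ++ sep ∷ l) ≡ length ds + suc (length l)
        total l = trans (length-++ (digits ds)) (cong (_+ suc (length l)) (length-map digit ds))
        fits : ∀ l → length (digits ds ++ sep ∷ l) ≤ H → length (ds ʳ++ []) + length (sep ∷ l) ≤ H
        fits l h = ≤-trans (≤-reflexive (trans (cong (_+ suc (length l)) len) (sym (total l)))) h
        len≤ : ∀ l → length ds ≤ length (digits ds ++ sep ∷ l)
        len≤ l = ≤-trans (m≤m+n _ _) (≤-reflexive (sym (total l)))
        bump : length (digits ds ++ sep ∷ m') ≤ H → suc (length m') ≤ H
        bump h = ≤-trans (m≤n+m _ (length ds)) (≤-trans (≤-reflexive (sym (total m'))) h)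

  -- Programs over stacks of numbers and their compilation

  data Guard : Set where
    nz z  : Fin K → Guard
    inp   : (InSym → Bool) → Guard
    _and_ : Guard → Guard → Guard

  infixr 6 _and_
  infixr 5 _⨟ₙ_

  testG : Guard → Prog
  testG (nz v)    = test (suc v) isDigit
  testG (z v)     = test (suc v) isSep
  testG (inp f)   = setFlag f
  testG (g and h) = testG g ⨾ ite flag? (testG h) (moveHead S)

  guardCost : Guard → ℕ
  guardCost (g and h) = guardCost g + (1 + guardCost h)
  guardCost _         = 1

  1≤guardCost : ∀ g → 1 ≤ guardCost g
  1≤guardCost (nz _)    = ≤-refl
  1≤guardCost (z _)     = ≤-refl
  1≤guardCost (inp _)   = ≤-refl
  1≤guardCost (g and _) = ≤-trans (1≤guardCost g) (m≤m+n _ _)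

  data NProg : Set where
    op    : Op → NProg
    _⨟ₙ_  : NProg → NProg → NProg
    ite   : Guard → NProg → NProg → NProg
    while : Guard → NProg → NProg

  compile : NProg → Prog
  compile (op o)      = opP o
  compile (p ⨟ₙ r)    = compile p ⨾ compile r
  compile (ite g p r) = testG g ⨾ ite flag? (compile p) (compile r)
  compile (while g p) = testG g ⨾ while flag? (compile p ⨾ testG g)

  -- The leading `setFlag` writes the home marker into cell 0 of the blank tape; every later
  -- `goHome` relies on it.
  decider : NProg → Guard → Prog
  decider p g = setFlag (λ _ → false) ⨾ compile p ⨾ testG g

  accepting : Cell → Bool
  accepting = flag? lend

  NState : Set
  NState = ℕ × Vec (List ℕ) K

  empty : Vec (List ℕ) K
  empty = Vec.replicate K []

  incTop decTop dropTop : List ℕ → List ℕ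
  incTop []        = []
  incTop (k ∷ l)   = suc k ∷ l
  decTop []        = []
  decTop (k ∷ l)   = pred k ∷ l
  dropTop []       = []
  dropTop (_ ∷ l)  = l

  dupTop : List ℕ → List ℕ → List ℕ
  dupTop []      l = l
  dupTop (k ∷ _) l = k ∷ l

  positive? zero? : List ℕ → Bool
  positive? (suc _ ∷ _) = true
  positive? _           = false
  zero? (zero ∷ _) = true
  zero? _          = false

  module Semanticsₙ (x : List Bool) (M Lm : ℕ) where

    holds : Guard → NState → Bool
    holds (nz v)    (_ , σ)  = positive? (lookup σ v)
    holds (z v)     (_ , σ)  = zero? (lookup σ v)
    holds (inp f)   (ip , _) = f (readIn x ip)
    holds (g and h) s        = holds g s ∧ holds h s

    exec : Op → NState → NState
    exec (push0 v) (ip , σ) = ip , σ [ v ]≔ (0 ∷ lookup σ v)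
    exec (drop v)  (ip , σ) = ip , σ [ v ]≔ dropTop (lookup σ v)
    exec (inc v)   (ip , σ) = ip , σ [ v ]≔ incTop (lookup σ v)
    exec (dec v)   (ip , σ) = ip , σ [ v ]≔ decTop (lookup σ v)
    exec (dup v u) (ip , σ) = ip , σ [ u ]≔ dupTop (lookup σ v) (lookup σ u)
    exec (head d)  (ip , σ) = moveIn (length x) d ip , σ

    data NonEmpty : List ℕ → Set where
      nonEmpty : ∀ {k l} → NonEmpty (k ∷ l)

    data Positive : List ℕ → Set where
      positive : ∀ {k l} → Positive (suc k ∷ l)

    data Roomy : List ℕ → Set where
      roomy : ∀ {k l} → suc k ≤ M → Roomy (k ∷ l)

    -- `exec` is total and returns default values where an operation makes no sense. These
    -- conditions restrict runs to the cases in which the compiled code agrees with `exec` and in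
    -- which numbers stay at most `M` and stacks at most `Lm` long.
    Pre : Op → NState → Set
    Pre (push0 v) (_ , σ) = suc (length (lookup σ v)) ≤ Lm
    Pre (drop v)  (_ , σ) = NonEmpty (lookup σ v)
    Pre (inc v)   (_ , σ) = Roomy (lookup σ v)
    Pre (dec v)   (_ , σ) = Positive (lookup σ v)
    Pre (dup v u) (_ , σ) = v ≢ u × NonEmpty (lookup σ v) × suc (length (lookup σ u)) ≤ Lm
    Pre (head d)  _       = ⊤

    data Run : NProg → NState → ℕ → NState → Set where
      op      : ∀ {o s} → Pre o s → Run (op o) s 1 (exec o s)
      _⨟ₙ_    : ∀ {p r s s' s'' j j'} → Run p s j s' → Run r s' j' s'' → Run (p ⨟ₙ r) s (j + j') s''
      ite-t   : ∀ {g p r s s' j} → holds g s ≡ true → Run p s j s' → Run (ite g p r) s (guardCost g + (1 + j)) s'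
      ite-f   : ∀ {g p r s s' j} → holds g s ≡ false → Run r s j s' → Run (ite g p r) s (guardCost g + (1 + j)) s'
      while-t : ∀ {g p s s' s'' j j'} → holds g s ≡ true → Run p s j s' → Run (while g p) s' j' s'' →
                Run (while g p) s (guardCost g + (1 + (j + j'))) s''
      while-f : ∀ {g p s} → holds g s ≡ false → Run (while g p) s (guardCost g + 1) s
      weaken  : ∀ {p s s' j j'} → j ≤ j' → Run p s j s' → Run p s j' s'

    module Compiled (bits : ℕ) (bits-ok : ∀ k → k ≤ M → length (bin k) ≤ bits) where

      H : ℕ
      H = Lm * suc bits

      open SymbolRuns x H public

      -- 13 symbol operations per digit suffice for each of the operations on numbers.
      opUnit : ℕ
      opUnit = 13 * suc bits

      Fits : List ℕ → Set
      Fits l = All (_≤ M) l × length l ≤ Lm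

      Good : Vec (List ℕ) K → Set
      Good σ = ∀ v → Fits (lookup σ v)

      length-enc : ∀ {l} → All (_≤ M) l → length (enc l) ≤ length l * suc bits
      length-enc [] = z≤n
      length-enc {k ∷ l} (k≤ ∷ ks) = ≤-trans (≤-reflexive (length-++ (digits (bin k))))
        (≤-trans (≤-reflexive (cong (_+ suc (length (enc l))) (length-map digit (bin k))))
        (≤-trans (≤-reflexive (+-suc (length (bin k)) (length (enc l)))) (+-mono-≤ (s≤s (bits-ok k k≤)) (length-enc ks))))

      enc≤H : ∀ {l} → Fits l → length (enc l) ≤ H
      enc≤H (all , le) = ≤-trans (length-enc all) (*-monoˡ-≤ (suc bits) le)

      good-set : ∀ (σ : Vec (List ℕ) K) v {l} → Good σ → Fits l → Good (σ [ v ]≔ l)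
      good-set σ v {l} good fit w with w Fin.≟ v
      ... | yes refl = subst Fits (sym (lookup∘update v σ l)) fit
      ... | no ne    = subst Fits (sym (lookup∘update′ ne σ l)) (good w)

      rep : Vec (List ℕ) K → Vec (List Sym) (suc K)
      rep σ = [] ∷ Vec.map enc σ

      rep-get : ∀ (σ : Vec (List ℕ) K) v → Vec.map enc σ ≡ Vec.map enc σ [ v ]≔ enc (lookup σ v)
      rep-get σ v = sym (trans (cong (Vec.map enc σ [ v ]≔_) (sym (lookup-map v enc σ))) ([]≔-lookup (Vec.map enc σ) v))

      cost-le : ∀ a b k → k ≤ bits → a ≤ 13 → b ≤ 13 → a + k * b ≤ 1 * opUnit
      cost-le a b k k≤ a≤ b≤ = ≤-trans (+-mono-≤ a≤ (*-mono-≤ k≤ b≤))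
        (≤-reflexive (trans (cong (13 +_) (*-comm bits 13)) (trans (sym (*-suc 13 bits)) (sym (+-identityʳ _)))))

      13≤ : ∀ {a b} → a + b ≡ 13 → a ≤ 13
      13≤ {a} {b} e = ≤-trans (m≤m+n a b) (≤-reflexive e)

      single : ∀ {p ip fl fl' j σ l l'} v → lookup σ v ≡ l → j ≤ 1 * opUnit →
        SRun p ⟪ ip , fl , [] ∷ (Vec.map enc σ [ v ]≔ enc l) ⟫ j ⟪ ip , fl' , [] ∷ (Vec.map enc σ [ v ]≔ enc l') ⟫ →
        SRun p ⟪ ip , fl , rep σ ⟫ (1 * opUnit) ⟪ ip , fl' , rep (σ [ v ]≔ l') ⟫
      single {p} {ip} {fl} {fl'} {σ = σ} v refl le r = run-weaken le
        (subst₂ (λ y z → SRun p ⟪ ip , fl , [] ∷ y ⟫ _ ⟪ ip , fl' , [] ∷ z ⟫) (sym (rep-get σ v)) (sym (map-[]≔ enc σ v)) r)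

      -- The flag is not part of the state of a number program: it may be arbitrary before a run,
      -- and is left at some value after it.
      Result : Prog → ℕ → Vec (List ℕ) K → ℕ → ℕ → Vec (List ℕ) K → Set
      Result p ip σ j ip' σ' = ∀ fl → Σ Bool λ fl' → SRun p ⟪ ip , fl , rep σ ⟫ (j * opUnit) ⟪ ip' , fl' , rep σ' ⟫ × Good σ'

      op-ok : ∀ o {ip σ} → Good σ → Pre o (ip , σ) → Result (opP o) ip σ 1 (proj₁ (exec o (ip , σ))) (proj₂ (exec o (ip , σ)))
      op-ok (push0 v) {ip} {σ} good room fl = fl ,
        single v refl (s≤s z≤n) (push-at (suc v) sep (lookup∘update v (Vec.map enc σ) _) (cong ([] ∷_) ([]≔-idempotent (Vec.map enc σ) v)) (enc≤H (good v))) ,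
        good-set σ v good (z≤n ∷ proj₁ (good v) , room)
      op-ok (drop v) {ip} {σ} good ne fl with lookup σ v in eq
      op-ok (drop v) {ip} {σ} good nonEmpty fl | k ∷ l with subst Fits eq (good v)
      ... | fit@(k≤ ∷ ks , len) = false ,
        single v eq (cost-le 3 3 (length (bin k)) (bits-ok k k≤) (13≤ refl) (13≤ refl))
          (OnStack.drop-run ip v (Vec.map enc σ) (enc l) (bin k) (enc≤H fit)) ,
        good-set σ v good (ks , <⇒≤ len)
      op-ok (inc v) {ip} {σ} good r fl with lookup σ v in eq
      op-ok (inc v) {ip} {σ} good (roomy k<M) fl | k ∷ l with subst Fits eq (good v)
      ... | fit@(k≤ ∷ ks , len) = false ,
        single v eq (cost-le 8 8 (length (bin k)) (bits-ok k k≤) (13≤ refl) (13≤ refl))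
          (OnStack.inc-run ip v (Vec.map enc σ) (enc l) (bin k) (enc≤H fit) (enc≤H {suc k ∷ l} (k<M ∷ ks , len))) ,
        good-set σ v good (k<M ∷ ks , len)
      op-ok (dec v) {ip} {σ} good r fl with lookup σ v in eq
      op-ok (dec v) {ip} {σ} good positive fl | suc k ∷ l with subst Fits eq (good v)
      ... | fit@(k≤ ∷ ks , len) = false ,
        single v eq (cost-le 13 8 (length (bin k)) (bits-ok k (<⇒≤ k≤)) ≤-refl (13≤ refl))
          (OnStack.dec-run ip v (Vec.map enc σ) (enc l) (bin k) (enc≤H {k ∷ l} (<⇒≤ k≤ ∷ ks , len)) (enc≤H fit)) ,
        good-set σ v good (<⇒≤ k≤ ∷ ks , len)
      op-ok (dup v u) {ip} {σ} good (v≢u , ne , room) fl with lookup σ v in eq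
      op-ok (dup v u) {ip} {σ} good (v≢u , nonEmpty , room) fl | k ∷ l with subst Fits eq (good v)
      ... | fit@(k≤ ∷ ks , len) = false ,
        run-weaken (cost-le 5 13 (length (bin k)) (bits-ok k k≤) (13≤ refl) ≤-refl)
          (subst₂ (λ y y' → SRun (opP (dup v u)) ⟪ ip , fl , [] ∷ y ⟫ _ ⟪ ip , false , [] ∷ y' ⟫)
            (sym before) (sym after)
            (OnTwo.dup-run ip v u v≢u (Vec.map enc σ) (enc l) (bin k) (enc (lookup σ u)) (enc≤H fit) (enc≤H {k ∷ lookup σ u} fit'))) ,
        good-set σ u good fit'
        where
        fit' : Fits (k ∷ lookup σ u)
        fit' = k≤ ∷ proj₁ (good u) , room
        v-own : Vec.map enc σ ≡ Vec.map enc σ [ v ]≔ enc (k ∷ l)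
        v-own = subst (λ y → Vec.map enc σ ≡ Vec.map enc σ [ v ]≔ enc y) eq (rep-get σ v)
        before : Vec.map enc σ ≡ (Vec.map enc σ [ v ]≔ enc (k ∷ l)) [ u ]≔ enc (lookup σ u)
        before = trans (rep-get σ u) (cong (_[ u ]≔ enc (lookup σ u)) v-own)
        after : Vec.map enc (σ [ u ]≔ (k ∷ lookup σ u)) ≡ (Vec.map enc σ [ v ]≔ enc (k ∷ l)) [ u ]≔ enc (k ∷ lookup σ u)
        after = trans (map-[]≔ enc σ u) (cong (_[ u ]≔ enc (k ∷ lookup σ u)) v-own)
      op-ok (head d) {ip} {σ} good _ fl = fl , run-weaken (s≤s z≤n) (run-moveHead (rep σ) d) , good

      top-digit : ∀ l → isDigit (top (enc l)) ≡ positive? l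
      top-digit []          = refl
      top-digit (zero ∷ l)  = refl
      top-digit (suc k ∷ l) with bin k
      ... | []         = refl
      ... | false ∷ _  = refl
      ... | true ∷ _   = refl

      top-sep : ∀ l → isSep (top (enc l)) ≡ zero? l
      top-sep []          = refl
      top-sep (zero ∷ l)  = refl
      top-sep (suc k ∷ l) with bin k
      ... | []         = refl
      ... | false ∷ _  = refl
      ... | true ∷ _   = refl

      guard-run : ∀ g {ip σ fl} → Good σ → SRun (testG g) ⟪ ip , fl , rep σ ⟫ (guardCost g) ⟪ ip , holds g (ip , σ) , rep σ ⟫
      guard-run (nz v) {σ = σ} good = test-at (suc v) isDigit (lookup-map v enc σ) (top-digit (lookup σ v)) (enc≤H (good v))
      guard-run (z v)  {σ = σ} good = test-at (suc v) isSep (lookup-map v enc σ) (top-sep (lookup σ v)) (enc≤H (good v))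
      guard-run (inp f) {σ = σ} good = run-setFlag (rep σ) f
      guard-run (g and h) {ip} {σ} good with holds g (ip , σ) | guard-run g {ip} {σ} good
      ... | true  | r = r ⨟ run-ite-t (guard-run h good)
      ... | false | r = r ⨟ run-ite-f (run-weaken (1≤guardCost h) (run-moveHead (rep σ) S))

      1≤opUnit : ∀ k → k ≤ k * opUnit
      1≤opUnit k = m≤m*n k opUnit

      compile-ok : ∀ {p ip σ j ip' σ'} → Run p (ip , σ) j (ip' , σ') → Good σ → Result (compile p) ip σ j ip' σ'
      compile-ok (op {o} pre) good = op-ok o good pre
      compile-ok (_⨟ₙ_ {s' = ip₁ , σ₁} {j = j} {j'} r r') good fl with compile-ok r good fl
      ... | fl₁ , run₁ , good₁ with compile-ok r' good₁ fl₁
      ... | fl₂ , run₂ , good₂ = fl₂ , run-weaken (≤-reflexive (sym (*-distribʳ-+ opUnit j j'))) (run₁ ⨟ run₂) , good₂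
      compile-ok {ip = ip} {σ} (ite-t {g} {j = j} e r) good fl with holds g (ip , σ) | guard-run g {ip} {σ} {fl} good
      compile-ok {ip = ip} {σ} (ite-t {g} {j = j} refl r) good fl | true | rg with compile-ok r good true
      ... | fl₁ , run₁ , good₁ = fl₁ , run-weaken (ite-cost g j) (rg ⨟ run-ite-t run₁) , good₁
        where
        ite-cost : ∀ g j → guardCost g + (1 + j * opUnit) ≤ (guardCost g + (1 + j)) * opUnit
        ite-cost g j = ≤-trans (+-mono-≤ (1≤opUnit (guardCost g)) (+-monoˡ-≤ (j * opUnit) (s≤s z≤n)))
          (≤-reflexive (sym (*-distribʳ-+ opUnit (guardCost g) (suc j))))
      compile-ok {ip = ip} {σ} (ite-f {g} {j = j} e r) good fl with holds g (ip , σ) | guard-run g {ip} {σ} {fl} good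
      compile-ok {ip = ip} {σ} (ite-f {g} {j = j} refl r) good fl | false | rg with compile-ok r good false
      ... | fl₁ , run₁ , good₁ = fl₁ , run-weaken (ite-cost g j) (rg ⨟ run-ite-f run₁) , good₁
        where
        ite-cost : ∀ g j → guardCost g + (1 + j * opUnit) ≤ (guardCost g + (1 + j)) * opUnit
        ite-cost g j = ≤-trans (+-mono-≤ (1≤opUnit (guardCost g)) (+-monoˡ-≤ (j * opUnit) (s≤s z≤n)))
          (≤-reflexive (sym (*-distribʳ-+ opUnit (guardCost g) (suc j))))
      compile-ok {ip = ip} {σ} (while-t {g} {j = j} {j'} e r r') good fl with holds g (ip , σ) | guard-run g {ip} {σ} {fl} good
      compile-ok {ip = ip} {σ} (while-t {g} {j = j} {j'} refl r r') good fl | true | rg with compile-ok r good true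
      ... | fl₁ , run₁ , good₁ with compile-ok r' good₁ fl₁
      ... | fl₂ , run₂ , good₂ = fl₂ , run-weaken cost (run-loop-t rg run₁ run₂) , good₂
        where
        cost : guardCost g + (1 + (j * opUnit + j' * opUnit)) ≤ (guardCost g + (1 + (j + j'))) * opUnit
        cost = ≤-trans (+-mono-≤ (1≤opUnit (guardCost g)) (+-mono-≤ (s≤s z≤n) (≤-reflexive (sym (*-distribʳ-+ opUnit j j')))))
          (≤-reflexive (sym (*-distribʳ-+ opUnit (guardCost g) (suc (j + j')))))
      compile-ok {ip = ip} {σ} (while-f {g} e) good fl with holds g (ip , σ) | guard-run g {ip} {σ} {fl} good
      compile-ok {ip = ip} {σ} (while-f {g} refl) good fl | false | rg =
        false , run-weaken (1≤opUnit (guardCost g + 1)) (run-loop-f rg) , good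
      compile-ok (weaken le r) good fl with compile-ok r good fl
      ... | fl₁ , run₁ , good₁ = fl₁ , run-weaken (*-monoˡ-≤ opUnit le) run₁ , good₁

      rep-empty : ∀ k → Vec.map (λ l → at l k) (rep empty) ≡ Vec.replicate (suc K) zero
      rep-empty k = cong (zero ∷_) (trans (cong (Vec.map (λ l → at l k)) (map-replicate enc [] K)) (map-replicate (λ l → at l k) [] K))

      start-run : Exec (setFlag (λ _ → false)) ⟨ 0 , (λ _ → decC zero) , 0 ⟩ 1 (conf ⟪ 0 , false , rep empty ⟫)
      start-run = act (s≤s z≤n) refl (cong (1F ∷_) (rep-empty 0))
        (λ { zero ne → ⊥-elim (ne refl) ; (suc k) _ → cong (0F ∷_) (rep-empty (suc k)) })

      empty-good : Good empty
      empty-good v = subst Fits (sym (lookup-replicate v [])) ([] , z≤n)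

      accepting-flag : ∀ b ss → accepting (cells b ss 0) ≡ b
      accepting-flag true  ss = refl
      accepting-flag false ss = refl

      -- The summand 2 accounts for the step that writes the home marker and for the halting step.
      decider-halts : ∀ {p g j s' b T} → Run p (0 , empty) j s' → holds g s' ≡ b →
        2 + (j * opUnit + guardCost g) * unit ≤ T →
        HaltsWithin (machine (decider p g) accepting) x T (suc H) b
      decider-halts {p} {g} {j} {ip' , σ'} {b} {T} r refl le with compile-ok r empty-good false
      ... | fl' , srun m m≤ ex , good' with guard-run g {ip'} {σ'} {fl'} good'
      ... | srun m' m'≤ ex' =
        subst (HaltsWithin (machine (decider p g) accepting) x T (suc H)) (accepting-flag (holds g (ip' , σ')) (rep σ'))
          (Simulate.exec-haltsWithin (decider p g) accepting (start-run ⨾ (ex ⨾ ex')) (s≤s z≤n)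
            (≤-trans (s≤s (s≤s (≤-trans (+-mono-≤ m≤ m'≤) (≤-reflexive (sym (*-distribʳ-+ unit (j * opUnit) (guardCost g))))))) le))

-- Paths in layered grid graphs

-- The target (0 , 0) absorbs: every path of length ≥ r + h from (r , h) ends there.
module Paths (eastBit northBit : ℕ → ℕ → Bool) where

  data Edge : (r h r' h' : ℕ) → Set where
    toE   : ∀ {r h} → eastBit (suc r) h ≡ true → Edge (suc r) h r h
    toN   : ∀ {r h} → northBit r (suc h) ≡ true → Edge r (suc h) r h
    stay  : Edge 0 0 0 0

  data Path : (k r h r' h' : ℕ) → Set where
    []  : ∀ {r h} → Path 0 r h r h
    _∷_ : ∀ {k r h r₁ h₁ r' h'} → Edge r h r₁ h₁ → Path k r₁ h₁ r' h' → Path (suc k) r h r' h'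

  _⊕_ : ∀ {k l r h r₁ h₁ r' h'} → Path k r h r₁ h₁ → Path l r₁ h₁ r' h' → Path (k + l) r h r' h'
  []      ⊕ b = b
  (e ∷ a) ⊕ b = e ∷ (a ⊕ b)

  split : ∀ k {l r h r' h'} → Path (k + l) r h r' h' →
    Σ ℕ λ r₁ → Σ ℕ λ h₁ → Path k r h r₁ h₁ × Path l r₁ h₁ r' h'
  split zero    a       = _ , _ , [] , a
  split (suc k) (e ∷ a) with split k a
  ... | r₁ , h₁ , b , c = r₁ , h₁ , e ∷ b , c

  edge-layer : ∀ {r h r' h'} → Edge r h r' h' → r' + h' ≡ (r + h) ∸ 1
  edge-layer (toE _)              = refl
  edge-layer (toN {r} {h} _)     = cong (_∸ 1) (sym (+-suc r h))
  edge-layer stay                  = refl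

  path-layer : ∀ {k r h r' h'} → Path k r h r' h' → r' + h' ≡ (r + h) ∸ k
  path-layer []      = refl
  path-layer {suc k} {r} {h} (e ∷ a) = trans (path-layer a) (trans (cong (_∸ k) (edge-layer e)) (∸-+-assoc (r + h) 1 k))

  same-vertex : ∀ {r h r' h'} → r + h ≡ r' + h' → r ≡ r' → h ≡ h'
  same-vertex {r} e refl = +-cancelˡ-≡ r _ _ e

  edge-≤ : ∀ {r h r' h'} → Edge r h r' h' → r' ≤ r × h' ≤ h
  edge-≤ (toE _)  = n≤1+n _ , ≤-refl
  edge-≤ (toN _) = ≤-refl , n≤1+n _
  edge-≤ stay      = z≤n , z≤n

  edge-≥ : ∀ {r h r' h'} → Edge r h r' h' → r ≤ suc r'
  edge-≥ (toE _)  = ≤-refl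
  edge-≥ (toN _) = n≤1+n _
  edge-≥ stay      = z≤n

  path-≤ : ∀ {k r h r' h'} → Path k r h r' h' → r' ≤ r × h' ≤ h
  path-≤ []      = ≤-refl , ≤-refl
  path-≤ (e ∷ a) = ≤-trans (proj₁ (path-≤ a)) (proj₁ (edge-≤ e)) , ≤-trans (proj₂ (path-≤ a)) (proj₂ (edge-≤ e))

  -- Planarity: two paths that start in the same layer and change sides meet in a common vertex.
  crossing : ∀ {k r h r' h' s u s' u'} → Path k r h r' h' → Path k s u s' u' →
    r + h ≡ s + u → r < s → s' < r' → Path k r h s' u'
  crossing [] [] _ r<s s<r = ⊥-elim (<-asym r<s s<r)
  crossing {suc k} (_∷_ {r₁ = a} e p) (_∷_ {r₁ = c} e' p') eq r<s s'<r' with <-cmp a c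
  ... | tri< a<c _ _ = e ∷ crossing p p' layer a<c s'<r'
    where layer = trans (edge-layer e) (trans (cong (_∸ 1) eq) (sym (edge-layer e')))
  ... | tri≈ _ refl _ with same-vertex {a} (trans (edge-layer e) (trans (cong (_∸ 1) eq) (sym (edge-layer e')))) refl
  ... | refl = e ∷ p'
  -- An edge lowers r by at most one and never raises it, so two paths cannot exchange sides in one
  -- step without meeting.
  crossing {suc k} (_∷_ {r₁ = a} e p) (_∷_ {r₁ = c} e' p') eq r<s s'<r' | tri> _ _ c<a =
    ⊥-elim (<-irrefl refl (≤-trans c<a (≤-trans (proj₁ (edge-≤ e)) (≤-pred (≤-trans r<s (edge-≥ e'))))))

  path-end : ∀ {k r h r' h'} → r + h ≤ k → Path k r h r' h' → r' ≡ 0 × h' ≡ 0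
  path-end {k} {r} {h} {r'} le a = m+n≡0⇒m≡0 r' e , m+n≡0⇒n≡0 r' e
    where e = trans (path-layer a) (m≤n⇒m∸n≡0 le)

  loiter : ∀ k → Path k 0 0 0 0
  loiter zero    = []
  loiter (suc k) = stay ∷ loiter k

  -- The ordered depth-first search over hops

  data Verdict (k r h b : ℕ) : Set where
    found : ∀ r' h' → Path k r h r' h' → b ≤ r' → (∀ {s u} → Path k r h s u → b ≤ s → r' ≤ s) → Verdict k r h b
    none  : (∀ {s u} → Path k r h s u → s < b) → Verdict k r h b

  -- A path from (r₀ , h₀) of B hops of length hop, ending at offset y₀ or more, is sought by a depth-first
  -- search that tries the vertices of each layer in the order of r.
  module Search (hop B r₀ h₀ y₀ : ℕ) where

    Dead : (k s u : ℕ) → Set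
    Dead k s u = ∀ {s' u'} → Path (k * hop) s u s' u' → s' < y₀

    -- All vertices reached by `i * hop` edges lie in one layer, where r determines the vertex. This
    -- is why a single number m can describe a set of dead vertices.
    Explored : (i k m : ℕ) → Set
    Explored i k m = ∀ {s u} → Path (i * hop) r₀ h₀ s u → s < m → Dead k s u

    -- The current path, latest vertex first as on the machine's stacks. Each vertex keeps the
    -- `Explored` fact of its own layer, so that a pop finds the invariant of the previous layer
    -- intact.
    data Chain : (ℓ k r : ℕ) (rs : List ℕ) (h : ℕ) (hs : List ℕ) → Set where
      origin : Chain 0 B r₀ [] h₀ []
      extend : ∀ {ℓ k r rs h hs r' h'} → Chain ℓ (suc k) r rs h hs → Path hop r h r' h' →
               Explored (suc ℓ) k r' → Chain (suc ℓ) k r' (r ∷ rs) h' (h ∷ hs)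

    data Bounds : (i k : ℕ) → List ℕ → Set where
      []  : ∀ {i} → Bounds i 0 []
      _∷_ : ∀ {i k b bs} → Explored i (suc k) b → Bounds (suc i) k bs → Bounds i (suc k) (b ∷ bs)

    flip-hop : ∀ ℓ {r h r' h'} → Path (ℓ * hop + hop) r h r' h' → Path (suc ℓ * hop) r h r' h'
    flip-hop ℓ {r} {h} {r'} {h'} = subst (λ z → Path z r h r' h') (+-comm (ℓ * hop) hop)

    chain-path : ∀ {ℓ k r rs h hs} → Chain ℓ k r rs h hs → Path (ℓ * hop) r₀ h₀ r h
    chain-path origin                  = []
    chain-path (extend {ℓ = ℓ} c p _) = flip-hop ℓ (chain-path c ⊕ p)

    chain-explored : ∀ {ℓ k r rs h hs} → Chain ℓ k r rs h hs → Explored ℓ k r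
    chain-explored origin          []  lt = ⊥-elim (<-irrefl refl lt)
    chain-explored (extend _ _ e) p   lt = e p lt

    chain-sum : ∀ {ℓ k r rs h hs} → Chain ℓ k r rs h hs → ℓ + k ≡ B
    chain-sum origin                  = refl
    chain-sum (extend {ℓ} {k} c _ _) = trans (sym (+-suc ℓ k)) (chain-sum c)

    -- For unwinding: this says how many entries must be dropped to uncover the origin, which the
    -- caller expects to find again.
    chain-rs : ∀ {ℓ k r rs h hs} → Chain ℓ k r rs h hs → Σ (List ℕ) λ l → r ∷ rs ≡ l ++ r₀ ∷ [] × length l ≡ ℓ
    chain-rs origin = [] , refl , refl
    chain-rs (extend {r' = r'} c _ _) with chain-rs c
    ... | l , e , len = r' ∷ l , cong (r' ∷_) e , cong suc len

    chain-hs : ∀ {ℓ k r rs h hs} → Chain ℓ k r rs h hs → Σ (List ℕ) λ l → h ∷ hs ≡ l ++ h₀ ∷ [] × length l ≡ ℓ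
    chain-hs origin = [] , refl , refl
    chain-hs (extend {h' = h'} c _ _) with chain-hs c
    ... | l , e , len = h' ∷ l , cong (h' ∷_) e , cong suc len

    chain-length : ∀ {ℓ k r rs h hs} → Chain ℓ k r rs h hs → length rs ≡ ℓ × length hs ≡ ℓ
    chain-length origin         = refl , refl
    chain-length (extend c _ _) = cong suc (proj₁ (chain-length c)) , cong suc (proj₂ (chain-length c))

    bounds-length : ∀ {i k bs} → Bounds i k bs → length bs ≡ k
    bounds-length []       = refl
    bounds-length (_ ∷ bs) = cong suc (bounds-length bs)

    bounds-zero : ∀ i k → Bounds i k (replicate k 0)
    bounds-zero i zero    = []
    bounds-zero i (suc k) = (λ _ ()) ∷ bounds-zero (suc i) k

    -- With no hop left, being dead means lying below `y₀`. So the caller's bound serves as the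
    -- initial bound of the last layer.
    explored-last : Explored B 0 y₀
    explored-last _ s<y₀ [] = s<y₀

    -- A skipped vertex (s , u) is reached through a dead vertex, or its path crosses the hop just taken.
    explored-push : ∀ {ℓ k r rs h hs b r' h'} → Chain ℓ (suc k) r rs h hs → Explored (suc ℓ) k b →
      Path hop r h r' h' → (∀ {s u} → Path hop r h s u → b ≤ s → r' ≤ s) → Explored (suc ℓ) k r'
    explored-push {ℓ} {k} {r} {b = b} c eb p least {s} {u} q s<r' with s <? b
    ... | yes s<b = eb q s<b
    ... | no s≮b with split (ℓ * hop) (subst (λ z → Path z r₀ h₀ s u) (+-comm hop (ℓ * hop)) q)
    ... | w , v , a , a' with <-cmp w r
    ... | tri< w<r _ _ = λ a'' → chain-explored c a w<r (a' ⊕ a'')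
    ... | tri> _ _ r<w = ⊥-elim (<⇒≱ s<r' (least (crossing p a' (trans (path-layer (chain-path c)) (sym (path-layer a))) r<w s<r') (≮⇒≥ s≮b)))
    ... | tri≈ _ refl _ with same-vertex {w} (trans (path-layer a) (sym (path-layer (chain-path c)))) refl
    ... | refl = ⊥-elim (<⇒≱ s<r' (least a' (≮⇒≥ s≮b)))

    -- All successors of the end (r , h) of the path lie below b and are dead, hence (r , h) is dead
    -- too. It is the only vertex of its layer with offset r, so the bound advances by one.
    explored-pop : ∀ {ℓ k r rs h hs b} → Chain ℓ (suc k) r rs h hs → Explored (suc ℓ) k b →
      (∀ {s u} → Path hop r h s u → s < b) → Explored ℓ (suc k) (suc r)
    explored-pop {ℓ} {r = r} c eb fails {s} {u} q (s≤s s≤r) with m≤n⇒m<n∨m≡n s≤r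
    ... | inj₁ s<r = chain-explored c q s<r
    ... | inj₂ refl with same-vertex {r} (trans (path-layer q) (sym (path-layer (chain-path c)))) refl
    ... | refl = λ a → let (w , v , a₁ , a₂) = split hop a in eb (flip-hop ℓ (q ⊕ a₁)) (fails a₁) a₂

-- Paths in offsets and paths in the instance

module Target (I : Instance) where

  iₜ jₜ : ℕ
  iₜ = toℕ (proj₁ (t I))
  jₜ = toℕ (proj₂ (t I))

  eastBit northBit : ℕ → ℕ → Bool
  eastBit  r h = east I (iₜ ∸ r) (jₜ ∸ h)
  northBit r h = north I (iₜ ∸ r) (jₜ ∸ h)

  open Paths eastBit northBit public

  path⇒toT : ∀ {k r h} → r ≤ iₜ → h ≤ jₜ → Path k r h 0 0 → PathToT I (iₜ ∸ r) (jₜ ∸ h)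
  path⇒toT _ _ [] = here
  path⇒toT {r = suc r} {h} r≤ h≤ (toE e ∷ p) =
    goE e (≤-trans (s≤s (≤-trans (≤-reflexive i) (m∸n≤m iₜ r))) (toℕ<n (proj₁ (t I))))
        (subst (λ z → PathToT I z (jₜ ∸ h)) (sym i) (path⇒toT (<⇒≤ r≤) h≤ p))
    where i = sym (+-∸-assoc 1 r≤)
  path⇒toT {r = r} {suc h} r≤ h≤ (toN e ∷ p) =
    goN e (≤-trans (s≤s (≤-trans (≤-reflexive j) (m∸n≤m jₜ h))) (toℕ<n (proj₂ (t I))))
        (subst (PathToT I (iₜ ∸ r)) (sym j) (path⇒toT r≤ (<⇒≤ h≤) p))
    where j = sym (+-∸-assoc 1 h≤)
  path⇒toT _ _ (stay ∷ p) = path⇒toT z≤n z≤n p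

  toT⇒path : ∀ {i j} → PathToT I i j →
    i ≤ iₜ × j ≤ jₜ × Path ((iₜ ∸ i) + (jₜ ∸ j)) (iₜ ∸ i) (jₜ ∸ j) 0 0
  toT⇒path here rewrite n∸n≡0 iₜ | n∸n≡0 jₜ = ≤-refl , ≤-refl , []
  toT⇒path {i} {j} (goN e _ p) with toT⇒path p
  ... | i≤ , j< , a = i≤ , <⇒≤ j< ,
    subst (λ z → Path ((iₜ ∸ i) + z) (iₜ ∸ i) z 0 0) (sym step-j)
      (subst (λ k → Path k (iₜ ∸ i) (suc (jₜ ∸ suc j)) 0 0) (sym (+-suc (iₜ ∸ i) (jₜ ∸ suc j)))
        (toN (trans (cong₂ (north I) (m∸[m∸n]≡n i≤) (trans (cong (jₜ ∸_) (sym step-j)) (m∸[m∸n]≡n (<⇒≤ j<)))) e) ∷ a))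
    where
    step-j : jₜ ∸ j ≡ suc (jₜ ∸ suc j)
    step-j = +-∸-assoc 1 j<
  toT⇒path {i} {j} (goE e _ p) with toT⇒path p
  ... | i< , j≤ , a = <⇒≤ i< , j≤ ,
    subst (λ z → Path (z + (jₜ ∸ j)) z (jₜ ∸ j) 0 0) (sym step-i)
      (toE (trans (cong₂ (east I) (trans (cong (iₜ ∸_) (sym step-i)) (m∸[m∸n]≡n (<⇒≤ i<))) (m∸[m∸n]≡n j≤)) e) ∷ a)
    where
    step-i : iₜ ∸ i ≡ suc (iₜ ∸ suc i)
    step-i = +-∸-assoc 1 i<

  path⇒reachable : ∀ {k i j r' h'} → i ≤ iₜ → j ≤ jₜ → (iₜ ∸ i) + (jₜ ∸ j) ≤ k →
    Path k (iₜ ∸ i) (jₜ ∸ j) r' h' → PathToT I i j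
  path⇒reachable {i = i} {j} i≤ j≤ le p with path-end le p
  ... | refl , refl = subst₂ (PathToT I) (m∸[m∸n]≡n i≤) (m∸[m∸n]≡n j≤)
    (path⇒toT (m∸n≤m iₜ i) (m∸n≤m jₜ j) p)

  reachable⇒path : ∀ {k i j} → PathToT I i j → (iₜ ∸ i) + (jₜ ∸ j) ≤ k → Path k (iₜ ∸ i) (jₜ ∸ j) 0 0
  reachable⇒path p le with proj₂ (proj₂ (toT⇒path p))
  -- The path is padded to length k by staying at the target.
  ... | a = subst (λ z → Path z _ _ 0 0) (m+[n∸m]≡n le) (a ⊕ loiter _)

-- Positions of the edge bits in the encoding

readIn-++ : ∀ xs ys k → readIn (xs ++ ys) (suc (length xs + k)) ≡ readIn ys (suc k)
readIn-++ []       ys k = refl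
readIn-++ (x ∷ xs) ys k = readIn-++ xs ys k

readIn-prefix : ∀ xs ys k → k < length xs → readIn (xs ++ ys) (suc k) ≡ readIn xs (suc k)
readIn-prefix (x ∷ xs) ys zero    _        = refl
readIn-prefix (x ∷ xs) ys (suc k) (s≤s lt) = readIn-prefix xs ys k lt

module _ (f : ℕ → List Bool) (m : ℕ) (f-length : ∀ i → length (f i) ≡ m) where

  length-blocks : ∀ (g : ℕ → ℕ) k → length (concatMap f (applyUpTo g k)) ≡ k * m
  length-blocks g zero    = refl
  length-blocks g (suc k) = trans (length-++ (f (g 0))) (cong₂ _+_ (f-length (g 0)) (length-blocks (λ i → g (suc i)) k))

  -- Stated for `applyUpTo g` with arbitrary `g`, because removing the first block shifts the index
  -- function.
  readIn-blocks : ∀ (g : ℕ → ℕ) k i o → i < k → o < m →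
    readIn (concatMap f (applyUpTo g k)) (suc (i * m + o)) ≡ readIn (f (g i)) (suc o)
  readIn-blocks g (suc k) zero o _ o< =
    readIn-prefix (f (g 0)) _ o (subst (o <_) (sym (f-length (g 0))) o<)
  readIn-blocks g (suc k) (suc i) o (s≤s i<) o< =
    trans (cong (λ z → readIn (f (g 0) ++ concatMap f (applyUpTo (λ i → g (suc i)) k)) (suc z))
            (trans (+-assoc m (i * m) o) (cong (_+ (i * m + o)) (sym (f-length (g 0))))))
      (trans (readIn-++ (f (g 0)) _ (i * m + o)) (readIn-blocks (λ i → g (suc i)) k i o i< o<))

module Layout (I : Instance) where

  cellBits : ℕ → ℕ → List Bool
  cellBits i j = north I i j ∷ east I i j ∷ []

  column : ℕ → List Bool
  column i = concatMap (cellBits i) (upTo (n I))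

  edgeBits : List Bool
  edgeBits = concatMap column (upTo (n I))

  length-column : ∀ i → length (column i) ≡ n I * 2
  length-column i = length-blocks (cellBits i) 2 (λ _ → refl) (λ z → z) (n I)

  length-edgeBits : length edgeBits ≡ n I * (n I * 2)
  length-edgeBits = length-blocks column (n I * 2) length-column (λ z → z) (n I)

  readIn-cell : ∀ i j o → i < n I → j < n I → o < 2 →
    readIn edgeBits (suc (i * (n I * 2) + (j * 2 + o))) ≡ readIn (cellBits i j) (suc o)
  readIn-cell i j o i< j< o< = trans
    (readIn-blocks column (n I * 2) length-column (λ z → z) (n I) i (j * 2 + o) i<
      (≤-trans (s≤s (≤-reflexive (+-comm (j * 2) o))) (≤-trans (+-monoˡ-≤ (j * 2) o<) (*-monoˡ-≤ 2 j<))))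
    (readIn-blocks (cellBits i) 2 (λ _ → refl) (λ z → z) (n I) j o j< o<)

-- The search program

open Numbers 12

-- vP, vT: offsets r and h of the vertices on the current path; vQ: lower bounds for r in the coming layers;
-- vL, vM: numbers of vertices on the path and of hops to go; vF: results of calls; vC, vW: scratch;
-- vN, vI, vJ: the grid size and the target; vB: the number of hops minus one.
pattern vP = 0F
pattern vT = 1F
pattern vQ = 2F
pattern vL = 3F
pattern vM = 4F
pattern vF = 5F
pattern vC = 6F
pattern vW = 7F
pattern vN = 8F
pattern vI = 9F
pattern vJ = suc 9F
pattern vB = suc (suc 9F)

one? inside? : InSym → Bool
one? (bit true) = true
one? _          = false
inside? lend = false
inside? _    = true

-- Nested loops share the stack `vC`: each pushes its own counter above that of the enclosing loop.
forN : Fin 12 → NProg → NProg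
forN v body = op (dup v vC) ⨟ₙ while (nz vC) (op (dec vC) ⨟ₙ body) ⨟ₙ op (drop vC)

-- `seek` needs no arithmetic on addresses. The head goes forward to the cell of the target and then
-- back by r columns and h cells, two bits per cell, which performs the subtractions from iₜ and jₜ.
rewind skipUnary rightTwice leftTwice seek : NProg
rewind     = while (inp inside?) (op (head L)) ⨟ₙ op (head R)
skipUnary  = while (inp one?) (op (head R)) ⨟ₙ op (head R)
rightTwice = op (head R) ⨟ₙ op (head R)
leftTwice  = op (head L) ⨟ₙ op (head L)
seek = rewind ⨟ₙ skipUnary ⨟ₙ skipUnary ⨟ₙ skipUnary ⨟ₙ skipUnary ⨟ₙ skipUnary ⨟ₙ
  forN vI (forN vN rightTwice) ⨟ₙ forN vJ rightTwice ⨟ₙ forN vP (forN vN leftTwice) ⨟ₙ forN vT leftTwice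

-- `dup` requires two different stacks, so doubling a top goes through the scratch stack `vW`.
again : Fin 12 → NProg
again v = op (dup v vW) ⨟ₙ op (dup vW v) ⨟ₙ op (drop vW)

succeed : NProg
succeed = op (push0 vF) ⨟ₙ op (inc vF)

-- The comparison leaves r ∸ b on `vC` and b ∸ r on `vW`. East leads to r - 1, admissible iff the
-- former is positive; north and staying keep r, admissible iff the latter is zero. East comes
-- before the others because it yields the smaller r. In a cell the north bit precedes the east bit,
-- hence the moves of the head.
goEast goNorth goNowhere giveUp choose nextEdge : NProg
goEast    = op (drop vQ) ⨟ₙ again vP ⨟ₙ again vT ⨟ₙ op (dec vP) ⨟ₙ succeed
goNorth   = op (drop vQ) ⨟ₙ again vP ⨟ₙ again vT ⨟ₙ op (dec vT) ⨟ₙ succeed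
goNowhere = op (drop vQ) ⨟ₙ again vP ⨟ₙ again vT ⨟ₙ succeed
giveUp    = op (dup vP vQ) ⨟ₙ op (inc vQ) ⨟ₙ op (drop vP) ⨟ₙ op (drop vT) ⨟ₙ op (push0 vF)
choose    = ite (nz vC and inp one?) goEast
  (op (head L) ⨟ₙ ite (z vW and nz vT and inp one?) goNorth (ite (z vW and z vP and z vT) goNowhere giveUp))
nextEdge  = op (dup vP vC) ⨟ₙ op (dup vQ vW) ⨟ₙ while (nz vC and nz vW) (op (dec vC) ⨟ₙ op (dec vW)) ⨟ₙ
  seek ⨟ₙ op (head R) ⨟ₙ choose ⨟ₙ op (drop vC) ⨟ₙ op (drop vW)

-- After a search the β intermediate layers have left their vertices, or their bounds, between the
-- result and the caller's entry. The result is parked on another stack while these are dropped.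
unwindFound unwindNone : NProg
unwindFound = op (dup vP vQ) ⨟ₙ op (dup vT vQ) ⨟ₙ op (drop vP) ⨟ₙ op (drop vT) ⨟ₙ
  forN vB (op (drop vP) ⨟ₙ op (drop vT)) ⨟ₙ
  op (dup vQ vT) ⨟ₙ op (drop vQ) ⨟ₙ op (dup vQ vP) ⨟ₙ op (drop vQ) ⨟ₙ succeed
unwindNone = op (dup vQ vP) ⨟ₙ op (drop vQ) ⨟ₙ forN vB (op (drop vQ)) ⨟ₙ op (dup vP vQ) ⨟ₙ op (drop vP) ⨟ₙ op (push0 vF)

-- A call of `hop` already rearranges the stacks as the search requires: success exchanges the next
-- layer's bound for a vertex, failure exchanges the vertex for its layer's raised bound. The loop
-- only updates the two counters. The β zeros are the bounds of the intermediate layers; below them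
-- the caller's bound serves the last layer.
hopLoop hops : NProg → NProg
hopLoop hop = while (nz vL and nz vM)
  (hop ⨟ₙ ite (nz vF) (op (inc vL) ⨟ₙ op (dec vM)) (op (dec vL) ⨟ₙ op (inc vM)) ⨟ₙ op (drop vF))
hops hop = forN vB (op (push0 vQ)) ⨟ₙ op (push0 vL) ⨟ₙ op (inc vL) ⨟ₙ op (dup vB vM) ⨟ₙ op (inc vM) ⨟ₙ
  hopLoop hop ⨟ₙ ite (z vM) unwindFound unwindNone ⨟ₙ op (drop vL) ⨟ₙ op (drop vM)

-- next e finds the first vertex, in the order of r, that is reachable by a path of length (β + 1) ^ e.
next : ℕ → NProg
next zero    = nextEdge
next (suc e) = hops (next e)

-- Head movements and loops

moveIn-R : ∀ {len k} → k ≤ len → moveIn len R k ≡ suc k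
moveIn-R {len} {k} le with k <ᵇ suc len | <⇒<ᵇ (s≤s le)
... | true | _ = refl

moveIn-≤ : ∀ len d {k} → k ≤ suc len → moveIn len d k ≤ suc len
moveIn-≤ len L {zero}  le = le
moveIn-≤ len L {suc k} le = <⇒≤ le
moveIn-≤ len S         le = le
moveIn-≤ len R {k}     le with k <ᵇ suc len in eq
... | true  = <ᵇ⇒< k (suc len) (subst T (sym eq) tt)
... | false = le

inside : ∀ x k → inside? (readIn x (suc k)) ≡ true
inside []      k       = refl
inside (b ∷ x) zero    = refl
inside (b ∷ x) (suc k) = inside x k

module Moves (x : List Bool) (M Lm : ℕ) where

  open Semanticsₙ x M Lm public

  -- The cost of `rewind` depends on where the head was left. This bound holds for every run, so
  -- specifications may leave the final head position unspecified.
  run-inp≤ : ∀ {p s j s'} → Run p s j s' → proj₁ s ≤ suc (length x) → proj₁ s' ≤ suc (length x)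
  run-inp≤ (op {push0 _} _) le = le
  run-inp≤ (op {drop _} _)  le = le
  run-inp≤ (op {inc _} _)   le = le
  run-inp≤ (op {dec _} _)   le = le
  run-inp≤ (op {dup _ _} _) le = le
  run-inp≤ (op {head d} _)  le = moveIn-≤ (length x) d le
  run-inp≤ (a ⨟ₙ b)         le = run-inp≤ b (run-inp≤ a le)
  run-inp≤ (ite-t _ a)      le = run-inp≤ a le
  run-inp≤ (ite-f _ a)      le = run-inp≤ a le
  run-inp≤ (while-t _ a b)  le = run-inp≤ b (run-inp≤ a le)
  run-inp≤ (while-f _)      le = le
  run-inp≤ (weaken _ a)     le = run-inp≤ a le

  run-from : ∀ {p ip ip' σ j s'} → ip ≡ ip' → Run p (ip' , σ) j s' → Run p (ip , σ) j s'
  run-from refl r = r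

  record At (ip : ℕ) (ys : List Bool) : Set where
    constructor at-suffix
    field
      prefix : List Bool
      whole  : x ≡ prefix ++ ys
      here-is : ip ≡ suc (length prefix)

  at-first : At 1 x
  at-first = at-suffix [] refl refl

  at-read : ∀ {ip ys} → At ip ys → ∀ o → readIn x (o + ip) ≡ readIn ys (suc o)
  at-read {ys = ys} (at-suffix pre e refl) o =
    trans (cong₂ readIn e (trans (+-suc o (length pre)) (cong suc (+-comm o (length pre))))) (readIn-++ pre ys o)

  at-room : ∀ {ip ys} → At ip ys → length ys + ip ≡ suc (length x)
  at-room {ys = ys} (at-suffix pre e refl) =
    trans (+-suc (length ys) (length pre)) (cong suc (trans (+-comm (length ys) (length pre)) (trans (sym (length-++ pre)) (cong length (sym e)))))

  at-next : ∀ {ip b ys} → At ip (b ∷ ys) → At (suc ip) ys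
  at-next {b = b} {ys} (at-suffix pre e refl) = at-suffix (pre ++ b ∷ []) (trans e (sym (++-assoc pre (b ∷ []) ys)))
    (cong suc (sym (trans (length-++ pre) (+-comm (length pre) 1))))

  right-run : ∀ {ip σ} → ip ≤ length x → Run (op (head R)) (ip , σ) 1 (suc ip , σ)
  right-run {ip} {σ} le = subst (λ k → Run (op (head R)) (ip , σ) 1 (k , σ)) (moveIn-R le) (op tt)

  at-right : ∀ {ip b ys σ} → At ip (b ∷ ys) → Run (op (head R)) (ip , σ) 1 (suc ip , σ)
  at-right {ip} {ys = ys} a = right-run (≤-pred (≤-trans (s≤s (m≤n+m ip (length ys))) (≤-reflexive (at-room a))))

  skip-run : ∀ k {ip ys σ} → At ip (unary k ++ ys) →
    Run skipUnary (ip , σ) (3 + k * 3) (suc k + ip , σ) × At (suc k + ip) ys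
  skip-run k {ip} {ys} {σ} a with ones k a
    where
    ones : ∀ k {ip} → At ip (unary k ++ ys) →
      Run (while (inp one?) (op (head R))) (ip , σ) (2 + k * 3) (k + ip , σ) × At (k + ip) (false ∷ ys)
    ones zero    a = while-f (cong one? (at-read a 0)) , a
    ones (suc k) {ip} a with ones k (at-next a)
    ... | r , a' rewrite +-suc k ip = while-t (cong one? (at-read a 0)) (at-right a) r , a'
  ... | r , a' = weaken (≤-reflexive (+-comm (2 + k * 3) 1)) (r ⨟ₙ at-right a') , at-next a'

  rewind-run : ∀ ip {σ} → Run rewind (ip , σ) (3 + ip * 3) (1 , σ)
  rewind-run ip {σ} = weaken (≤-reflexive (+-comm (2 + ip * 3) 1)) (lefts ip ⨟ₙ right-run z≤n)
    where
    lefts : ∀ ip → Run (while (inp inside?) (op (head L))) (ip , σ) (2 + ip * 3) (0 , σ)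
    lefts zero     = while-f refl
    lefts (suc ip) = while-t (inside x ip) (op tt) (lefts ip)

module Loops (x : List Bool) (M Lm N It Jt β : ℕ) where

  open Moves x M Lm public

  st : (ip : ℕ) (p t q l m f c w : List ℕ) → NState
  st ip p t q l m f c w =
    ip , p ∷ t ∷ q ∷ l ∷ m ∷ f ∷ c ∷ w ∷ (N ∷ []) ∷ (It ∷ []) ∷ (Jt ∷ []) ∷ (β ∷ []) ∷ []

  module _ {l m f c w : List ℕ} where

    -- The families give the head position and the stacks after i rounds. The body runs with the
    -- counter `o` of the rounds still to come on top of `vC`.
    for-run : ∀ v {k rest body j} (ipf : ℕ → ℕ) (pf tf qf : ℕ → List ℕ) → v ≢ vC →
      lookup (proj₂ (st (ipf 0) (pf 0) (tf 0) (qf 0) l m f c w)) v ≡ k ∷ rest → suc (length c) ≤ Lm →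
      (∀ i o → i + suc o ≡ k → Run body (st (ipf i) (pf i) (tf i) (qf i) l m f (o ∷ c) w) j
                                        (st (ipf (suc i)) (pf (suc i)) (tf (suc i)) (qf (suc i)) l m f (o ∷ c) w)) →
      Run (forN v body) (st (ipf 0) (pf 0) (tf 0) (qf 0) l m f c w) (4 + k * (3 + j)) (st (ipf k) (pf k) (tf k) (qf k) l m f c w)
    for-run v {k} {rest} {body} {j} ipf pf tf qf v≢C eq room body-run =
      weaken (≤-reflexive (solve₁ (k * (3 + j)))) (copy ⨟ₙ count k 0 refl ⨟ₙ op nonEmpty)
      where
      solve₁ : ∀ y → 1 + ((2 + y) + 1) ≡ 4 + y
      solve₁ = solve-∀
      solve₂ : ∀ j y → 1 + (1 + ((1 + j) + (2 + y))) ≡ 2 + ((3 + j) + y)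
      solve₂ = solve-∀
      G : ℕ → List ℕ → NState
      G i c = st (ipf i) (pf i) (tf i) (qf i) l m f c w
      copy : Run (op (dup v vC)) (G 0 c) 1 (G 0 (k ∷ c))
      copy = subst (λ y → Run (op (dup v vC)) (G 0 c) 1 (G 0 (dupTop y c))) eq
        (op (v≢C , subst NonEmpty (sym eq) nonEmpty , room))
      count : ∀ o i → i + o ≡ k → Run (while (nz vC) (op (dec vC) ⨟ₙ body)) (G i (o ∷ c)) (2 + o * (3 + j)) (G k (0 ∷ c))
      count zero    i e rewrite trans (sym (+-identityʳ i)) e = while-f refl
      count (suc o) i e = weaken (≤-reflexive (solve₂ j (o * (3 + j))))
        (while-t refl (op positive ⨟ₙ body-run i o e) (count o (suc i) (trans (sym (+-suc i o)) e)))

    module _ {p t q : List ℕ} where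

      at-ip : ℕ → NState
      at-ip ip = st ip p t q l m f c w

      forward-run : ∀ v {k rest body j} a ip → v ≢ vC → lookup (proj₂ (at-ip ip)) v ≡ k ∷ rest → suc (length c) ≤ Lm →
        k * a + ip ≤ suc (length x) →
        (∀ o {ip} → a + ip ≤ suc (length x) → Run body (st ip p t q l m f (o ∷ c) w) j (st (a + ip) p t q l m f (o ∷ c) w)) →
        Run (forN v body) (at-ip ip) (4 + k * (3 + j)) (at-ip (k * a + ip))
      forward-run v {k} {body = body} {j} a ip ne eq room fits body-run =
        for-run v (λ i → i * a + ip) (λ _ → p) (λ _ → t) (λ _ → q) ne eq room
          (λ i o e → subst (λ y → Run body (st (i * a + ip) p t q l m f (o ∷ c) w) j (st y p t q l m f (o ∷ c) w)) (sym (+-assoc a (i * a) ip))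
            (body-run o (≤-trans (≤-reflexive (sym (+-assoc a (i * a) ip)))
              (≤-trans (+-monoˡ-≤ ip (*-monoˡ-≤ a (≤-trans (s≤s (m≤m+n i o)) (≤-reflexive (trans (sym (+-suc i o)) e))))) fits))))

      backward-run : ∀ v {k rest body j} a ip → v ≢ vC → lookup (proj₂ (at-ip (k * a + ip))) v ≡ k ∷ rest → suc (length c) ≤ Lm →
        (∀ o {ip} → Run body (st (a + ip) p t q l m f (o ∷ c) w) j (st ip p t q l m f (o ∷ c) w)) →
        Run (forN v body) (at-ip (k * a + ip)) (4 + k * (3 + j)) (at-ip ip)
      backward-run v {k} {body = body} {j} a ip ne eq room body-run =
        subst (λ y → Run (forN v body) (at-ip (k * a + ip)) (4 + k * (3 + j)) (at-ip (y * a + ip))) (n∸n≡0 k)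
          (for-run v (λ i → (k ∸ i) * a + ip) (λ _ → p) (λ _ → t) (λ _ → q) ne eq room
            (λ i o e → subst₂ (λ y y' → Run body (st (y * a + ip) p t q l m f (o ∷ c) w) j (st (y' * a + ip) p t q l m f (o ∷ c) w))
              (sym (before i o e)) (sym (after i o e))
              (subst (λ y → Run body (st y p t q l m f (o ∷ c) w) j (st (o * a + ip) p t q l m f (o ∷ c) w)) (sym (+-assoc a (o * a) ip)) (body-run o))))
        where
        before : ∀ i o → i + suc o ≡ k → k ∸ i ≡ suc o
        before i o e = trans (cong (_∸ i) (sym e)) (m+n∸m≡n i (suc o))
        after : ∀ i o → i + suc o ≡ k → k ∸ suc i ≡ o
        after i o e = trans (cong (_∸ suc i) (trans (sym e) (+-suc i o))) (m+n∸m≡n i o)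

  rightTwice-run : ∀ {ip σ} → 2 + ip ≤ suc (length x) → Run rightTwice (ip , σ) 2 (2 + ip , σ)
  rightTwice-run le = right-run (≤-pred (<⇒≤ le)) ⨟ₙ right-run (≤-pred le)

  leftTwice-run : ∀ {ip σ} → Run leftTwice (2 + ip , σ) 2 (ip , σ)
  leftTwice-run = op tt ⨟ₙ op tt

  compare-run : ∀ r b {ip p t q l m f c w} →
    Run (while (nz vC and nz vW) (op (dec vC) ⨟ₙ op (dec vW))) (st ip p t q l m f (r ∷ c) (b ∷ w)) (4 + r * 6)
        (st ip p t q l m f (r ∸ b ∷ c) (b ∸ r ∷ w))
  compare-run zero    zero    = while-f refl
  compare-run zero    (suc b) = while-f refl
  compare-run (suc r) zero    = weaken (m≤m+n 4 (suc r * 6)) (while-f refl)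
  compare-run (suc r) (suc b) = weaken (≤-reflexive (solve₁ (r * 6))) (while-t refl (op positive ⨟ₙ op positive) (compare-run r b))
    where
    solve₁ : ∀ y → 3 + (1 + (2 + (4 + y))) ≡ 4 + (6 + y)
    solve₁ = solve-∀

-- Cost and correctness of a single edge

forCost : ℕ → ℕ → ℕ
forCost k j = 4 + k * (3 + j)

inputBound headerCost seekCost edgeCost : ℕ → ℕ
inputBound k = k * (k * 2) + (k * 5 + 6)
headerCost k = (3 + k * 3) + ((3 + k * 3) + ((3 + k * 3) + ((3 + k * 3) + (3 + k * 3))))
seekCost k = (3 + inputBound k * 3) + (headerCost k +
  (forCost k (forCost k 2) + (forCost k 2 + (forCost k (forCost k 2) + forCost k 2))))
edgeCost k = 1 + (1 + ((4 + k * 6) + (seekCost k + (1 + (30 + 2)))))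

module OneEdge (I : Instance) (M Lm β : ℕ) (n≤M : n I ≤ M) where

  open Target I public
  open Layout I public

  x : List Bool
  x = encode I

  open Loops x M Lm (n I) iₜ jₜ β public

  iₜ< : iₜ < n I
  iₜ< = toℕ<n (proj₁ (t I))

  jₜ< : jₜ < n I
  jₜ< = toℕ<n (proj₂ (t I))

  iₛ jₛ : ℕ
  iₛ = toℕ (proj₁ (s I))
  jₛ = toℕ (proj₂ (s I))

  dataStart : ℕ
  dataStart = suc jₜ + (suc iₜ + (suc jₛ + (suc iₛ + (suc (n I) + 1))))

  X : ℕ
  X = suc (length x)

  -- `seek` is nested to the right, so that skipping the header is not a subprogram of it; the lemma
  -- instead puts the header before the run of an arbitrary continuation.
  header-run : ∀ {σ} → At dataStart edgeBits ×
    (∀ {prog j s} → Run prog (dataStart , σ) j s →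
      Run (skipUnary ⨟ₙ skipUnary ⨟ₙ skipUnary ⨟ₙ skipUnary ⨟ₙ skipUnary ⨟ₙ prog) (1 , σ) (headerCost (n I) + j) s)
  header-run {σ} with skip-run (n I) {σ = σ} at-first
  ... | r₁ , a₁ with skip-run iₛ {σ = σ} a₁
  ... | r₂ , a₂ with skip-run jₛ {σ = σ} a₂
  ... | r₃ , a₃ with skip-run iₜ {σ = σ} a₃
  ... | r₄ , a₄ with skip-run jₜ {σ = σ} a₄
  ... | r₅ , a₅ = a₅ , λ {_} {j} r → weaken (≤-reflexive (solve₁ (3 + n I * 3) j))
      (r₁ ⨟ₙ weaken (small (toℕ<n (proj₁ (s I)))) r₂ ⨟ₙ weaken (small (toℕ<n (proj₂ (s I)))) r₃ ⨟ₙ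
       weaken (small iₜ<) r₄ ⨟ₙ weaken (small jₜ<) r₅ ⨟ₙ r)
    where
    small : ∀ {k} → k < n I → 3 + k * 3 ≤ 3 + n I * 3
    small lt = +-monoʳ-≤ 3 (*-monoˡ-≤ 3 (<⇒≤ lt))
    solve₁ : ∀ a j → a + (a + (a + (a + (a + j)))) ≡ (a + (a + (a + (a + a)))) + j
    solve₁ = solve-∀

  at-data : At dataStart edgeBits
  at-data = proj₁ (header-run {proj₂ (st 0 [] [] [] [] [] [] [] [])})

  cellPos : ℕ → ℕ → ℕ
  cellPos i j = j * 2 + (i * (n I * 2) + dataStart)

  cellPos-fits : ∀ {i j} → i < n I → j < n I → 2 + cellPos i j ≤ X
  cellPos-fits {i} {j} i< j< = begin
    2 + (j * 2 + (i * (n I * 2) + dataStart))     ≡⟨ sym (+-assoc (suc j * 2) (i * (n I * 2)) dataStart) ⟩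
    (suc j * 2 + i * (n I * 2)) + dataStart       ≤⟨ +-monoˡ-≤ dataStart (+-monoˡ-≤ (i * (n I * 2)) (*-monoˡ-≤ 2 j<)) ⟩
    suc i * (n I * 2) + dataStart                 ≤⟨ +-monoˡ-≤ dataStart (*-monoˡ-≤ (n I * 2) i<) ⟩
    n I * (n I * 2) + dataStart                   ≡⟨ cong (_+ dataStart) (sym length-edgeBits) ⟩
    length edgeBits + dataStart                   ≡⟨ at-room at-data ⟩
    X                                             ∎
    where open ≤-Reasoning

  read-cell : ∀ {i j} o → i < n I → j < n I → o < 2 → readIn x (o + cellPos i j) ≡ readIn (cellBits i j) (suc o)
  read-cell {i} {j} o i< j< o< = trans (cong (readIn x) (solve₁ o (j * 2) (i * (n I * 2)) dataStart))
    (trans (at-read at-data (i * (n I * 2) + (j * 2 + o))) (readIn-cell i j o i< j< o<))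
    where
    solve₁ : ∀ o a b d → o + (a + (b + d)) ≡ (b + (a + o)) + d
    solve₁ = solve-∀

  cellPos-split : ∀ {r h} → r ≤ iₜ → h ≤ jₜ →
    cellPos iₜ jₜ ≡ r * (n I * 2) + (h * 2 + cellPos (iₜ ∸ r) (jₜ ∸ h))
  cellPos-split {r} {h} r≤ h≤ = trans
    (cong₂ (λ i j → cellPos i j) (sym (m+[n∸m]≡n r≤)) (sym (m+[n∸m]≡n h≤)))
    (solve₁ r h (iₜ ∸ r) (jₜ ∸ h) (n I * 2) dataStart)
    where
    solve₁ : ∀ r h a b k d → (h + b) * 2 + ((r + a) * k + d) ≡ r * k + (h * 2 + (b * 2 + (a * k + d)))
    solve₁ = solve-∀

  X≤inputBound : X ≤ inputBound (n I)
  X≤inputBound = ≤-trans (≤-reflexive (trans (sym (at-room at-data)) (cong (_+ dataStart) length-edgeBits)))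
    (+-monoʳ-≤ (n I * (n I * 2)) (≤-trans
      (+-mono-≤ jₜ< (+-mono-≤ iₜ< (+-mono-≤ (toℕ<n (proj₂ (s I))) (+-mono-≤ (toℕ<n (proj₁ (s I))) (≤-refl {suc (n I) + 1})))))
      (≤-trans (≤-reflexive (solve₁ (n I))) (+-monoʳ-≤ (n I * 5) (m≤m+n 2 4)))))
    where
    solve₁ : ∀ k → k + (k + (k + (k + (suc k + 1)))) ≡ k * 5 + 2
    solve₁ = solve-∀

  forCost-mono : ∀ {k k' j} → k ≤ k' → forCost k j ≤ forCost k' j
  forCost-mono le = +-monoʳ-≤ 4 (*-monoˡ-≤ _ le)

  seek-run : ∀ {ip r h p t q l m f c w} → ip ≤ X → r ≤ iₜ → h ≤ jₜ → 2 + length c ≤ Lm →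
    Run seek (st ip (r ∷ p) (h ∷ t) q l m f c w) (seekCost (n I)) (st (cellPos (iₜ ∸ r) (jₜ ∸ h)) (r ∷ p) (h ∷ t) q l m f c w)
  seek-run {ip} {r} {h} {p} {t} {q} {l} {m} {f} {c} {w} ip≤ r≤ h≤ room =
    weaken (+-monoˡ-≤ _ (+-monoʳ-≤ 3 (*-monoˡ-≤ 3 (≤-trans ip≤ X≤inputBound))))
    (rewind-run ip ⨟ₙ proj₂ header-run
      (weaken (forCost-mono (<⇒≤ iₜ<)) (forward-run vI (n I * 2) dataStart (λ ()) refl (<⇒≤ room)
         (≤-trans (m≤n+m (iₜ * (n I * 2) + dataStart) (2 + jₜ * 2)) fits)
         (λ o le → forward-run vN 2 _ (λ ()) refl room le (λ o' → rightTwice-run))) ⨟ₙ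
       weaken (forCost-mono (<⇒≤ jₜ<)) (forward-run vJ 2 (iₜ * (n I * 2) + dataStart) (λ ()) refl (<⇒≤ room)
         (≤-trans (m≤n+m (cellPos iₜ jₜ) 2) fits) (λ o → rightTwice-run)) ⨟ₙ
       run-from (cellPos-split r≤ h≤)
         (weaken (forCost-mono (<⇒≤ (≤-<-trans r≤ iₜ<))) (backward-run vP (n I * 2) _ (λ ()) refl (<⇒≤ room)
           (λ o → backward-run vN 2 _ (λ ()) refl room (λ o' → leftTwice-run))) ⨟ₙ
          weaken (forCost-mono (<⇒≤ (≤-<-trans h≤ jₜ<))) (backward-run vT 2 _ (λ ()) refl (<⇒≤ room) (λ o → leftTwice-run)))))
    where
    fits : 2 + cellPos iₜ jₜ ≤ X
    fits = cellPos-fits iₜ< jₜ<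

  positive-∸ : ∀ {r b c} → b < r → positive? (r ∸ b ∷ c) ≡ true
  positive-∸ {suc r} {zero}  _        = refl
  positive-∸ {suc r} {suc b} (s≤s lt) = positive-∸ {r} {b} lt

  positive-∸-≤ : ∀ {r b c} → r ≤ b → positive? (r ∸ b ∷ c) ≡ false
  positive-∸-≤ le rewrite m≤n⇒m∸n≡0 le = refl

  zero-∸ : ∀ {r b c} → b ≤ r → zero? (b ∸ r ∷ c) ≡ true
  zero-∸ le rewrite m≤n⇒m∸n≡0 le = refl

  zero-∸-< : ∀ {r b c} → r < b → zero? (b ∸ r ∷ c) ≡ false
  zero-∸-< {zero}  {suc b} _        = refl
  zero-∸-< {suc r} {suc b} (s≤s lt) = zero-∸-< {r} {b} lt

  -- The calling convention. Success consumes the bound b and stacks the new vertex on the old one.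
  -- Failure consumes the vertex, keeps b, and puts `suc r` above it as the bound of the layer that
  -- the vertex has left.
  after : ∀ {k r h b} → Verdict k r h b → (ip : ℕ) (p t q l m f c w : List ℕ) → NState
  after {r = r} {h}     (found r' h' _ _ _) ip p t q l m f c w = st ip (r' ∷ r ∷ p) (h' ∷ h ∷ t) q l m (1 ∷ f) c w
  after {r = r} {b = b} (none _)            ip p t q l m f c w = st ip p t (suc r ∷ b ∷ q) l m (0 ∷ f) c w

  record Short (d : ℕ) (p t q l m f c w : List ℕ) : Set where
    field
      p≤ : length p ≤ d
      t≤ : length t ≤ d
      q≤ : length q ≤ d
      l≤ : length l ≤ d
      m≤ : length m ≤ d
      f≤ : length f ≤ d
      c≤ : length c ≤ d
      w≤ : length w ≤ d

  -- k is the path length decided by prog; need is the stack room it takes.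
  NextSpec : (prog : NProg) (k cost need : ℕ) → Set
  NextSpec prog k cost need = ∀ {ip r h b p t q l m f c w d} → ip ≤ X → r ≤ iₜ → h ≤ jₜ →
    Short d p t q l m f c w → d + need ≤ Lm →
    Σ (Verdict k r h b) λ v → Σ ℕ λ ip' →
      Run prog (st ip (r ∷ p) (h ∷ t) (b ∷ q) l m f c w) cost (after v ip' p t q l m f c w)

  within : ∀ {l : List ℕ} {d need} j → j ≤ need → length l ≤ d → d + need ≤ Lm → j + length l ≤ Lm
  within {l} {d} {need} j j≤ l≤ room = ≤-trans (+-mono-≤ j≤ l≤) (≤-trans (≤-reflexive (+-comm need d)) room)

  edgeVerdict : ∀ {r h b r' h'} → Edge r h r' h' → b ≤ r' → (∀ {s u} → Edge r h s u → b ≤ s → r' ≤ s) → Verdict 1 r h b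
  edgeVerdict e le least = found _ _ (e ∷ []) le λ { (e' ∷ []) → least e' }

  module _ {p t q l m f c w : List ℕ} {d : ℕ} (short : Short d p t q l m f c w) (room : d + 3 ≤ Lm) where

    open Short short

    private
      r1 : ∀ {l : List ℕ} → length l ≤ d → suc (length l) ≤ Lm
      r1 {l} le = within {l} 1 (s≤s z≤n) le room
      r2 : ∀ {l : List ℕ} → length l ≤ d → 2 + length l ≤ Lm
      r2 {l} le = within {l} 2 (s≤s (s≤s z≤n)) le room
      1≤M : 1 ≤ M
      1≤M = ≤-trans (≤-trans (s≤s z≤n) iₜ<) n≤M

    againP-run : ∀ {ip r t q c b} → Run (again vP)
      (st ip (r ∷ p) t q l m f c (b ∷ w)) 3 (st ip (r ∷ r ∷ p) t q l m f c (b ∷ w))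
    againP-run = op ((λ ()) , nonEmpty , r2 {w} w≤) ⨟ₙ op ((λ ()) , nonEmpty , r2 {p} p≤) ⨟ₙ op nonEmpty

    againT-run : ∀ {ip h p q c b} → Run (again vT)
      (st ip p (h ∷ t) q l m f c (b ∷ w)) 3 (st ip p (h ∷ h ∷ t) q l m f c (b ∷ w))
    againT-run = op ((λ ()) , nonEmpty , r2 {w} w≤) ⨟ₙ op ((λ ()) , nonEmpty , r2 {t} t≤) ⨟ₙ op nonEmpty

    succeed-run : ∀ {ip p t q l m c w} → Run succeed (st ip p t q l m f c w) 2 (st ip p t q l m (1 ∷ f) c w)
    succeed-run = op (r1 {f} f≤) ⨟ₙ op (roomy 1≤M)

    giveUp-run : ∀ {ip r h b c w} → r ≤ iₜ →
      Run giveUp (st ip (r ∷ p) (h ∷ t) (b ∷ q) l m f c w) 5 (st ip p t (suc r ∷ b ∷ q) l m (0 ∷ f) c w)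
    giveUp-run r≤ = op ((λ ()) , nonEmpty , r2 {q} q≤) ⨟ₙ op (roomy (≤-trans (≤-trans (s≤s r≤) iₜ<) n≤M)) ⨟ₙ
      op nonEmpty ⨟ₙ op nonEmpty ⨟ₙ op (r1 {f} f≤)

    ChooseSpec : NProg → (j ip r h b : ℕ) → Set
    ChooseSpec prog j ip r h b = Σ (Verdict 1 r h b) λ v → Σ ℕ λ ip' →
      Run prog (st ip (r ∷ p) (h ∷ t) (b ∷ q) l m f (r ∸ b ∷ c) (b ∸ r ∷ w)) j
               (after v ip' p t q l m f (r ∸ b ∷ c) (b ∸ r ∷ w))

    chooseRest : NProg
    chooseRest = ite (z vW and nz vT and inp one?) goNorth (ite (z vW and z vP and z vT) goNowhere giveUp)

    none-run : ∀ {pos r h b} → r ≤ iₜ → (∀ {s u} → Edge r h s u → s < b) →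
      holds (z vW and nz vT and inp one?) (st pos (r ∷ p) (h ∷ t) (b ∷ q) l m f (r ∸ b ∷ c) (b ∸ r ∷ w)) ≡ false →
      holds (z vW and z vP and z vT) (st pos (r ∷ p) (h ∷ t) (b ∷ q) l m f (r ∸ b ∷ c) (b ∸ r ∷ w)) ≡ false →
      ChooseSpec chooseRest 25 pos r h b
    none-run r≤ no-edge g₁ g₂ = none (λ { (e ∷ []) → no-edge e }) , _ ,
      weaken (≤ᵇ⇒≤ 17 25 tt) (ite-f g₁ (ite-f g₂ (giveUp-run r≤)))

    -- Once an admissible east edge is excluded, every remaining candidate keeps r. So `b ≤? r`
    -- decides admissibility, and minimality among the candidates is immediate.
    rest-run : ∀ {pos r h b} → readIn x pos ≡ bit (northBit r h) → r ≤ iₜ →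
      (b < r → eastBit r h ≢ true) → ChooseSpec chooseRest 25 pos r h b
    rest-run {pos} {r} {h} {b} readN r≤ noEast with b ≤? r
    ... | no b≰r = none-run r≤ (λ e → ≤-<-trans (proj₁ (edge-≤ e)) (≰⇒> b≰r))
          (cong (_∧ (positive? (h ∷ t) ∧ one? (readIn x pos))) (zero-∸-< {r} {b} {w} (≰⇒> b≰r)))
          (cong (_∧ (zero? (r ∷ p) ∧ zero? (h ∷ t))) (zero-∸-< {r} {b} {w} (≰⇒> b≰r)))
    rest-run {pos} {zero} {zero} {b} readN r≤ noEast | yes b≤r =
      edgeVerdict stay b≤r (λ _ _ → z≤n) , pos ,
      weaken (≤ᵇ⇒≤ 21 25 tt)
        (ite-f (trans (cong (_∧ _) (zero-∸ {0} {b} {w} b≤r)) refl)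
          (ite-t (trans (cong (_∧ _) (zero-∸ {0} {b} {w} b≤r)) refl)
            (op nonEmpty ⨟ₙ againP-run ⨟ₙ againT-run ⨟ₙ succeed-run)))
    rest-run {pos} {suc r} {zero} {b} readN r≤ noEast | yes b≤r =
      none-run r≤ (λ { (toE e) → ≰⇒> (λ b≤s → noEast (s≤s b≤s) e) })
        (trans (cong (_∧ _) (zero-∸ {suc r} {b} {w} b≤r)) refl) (trans (cong (_∧ _) (zero-∸ {suc r} {b} {w} b≤r)) refl)
    rest-run {pos} {r} {suc h} {b} readN r≤ noEast | yes b≤r with northBit r (suc h) in bN
    ... | true =
      edgeVerdict (toN bN) b≤r (λ { (toE e) b≤s → ⊥-elim (noEast (s≤s b≤s) e) ; (toN _) _ → ≤-refl }) , pos ,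
      weaken (≤ᵇ⇒≤ 16 25 tt)
        (ite-t (trans (cong (_∧ _) (zero-∸ {r} {b} {w} b≤r)) (cong one? readN))
          (op nonEmpty ⨟ₙ againP-run ⨟ₙ againT-run ⨟ₙ op positive ⨟ₙ succeed-run))
    ... | false =
      none-run r≤ (λ { (toE e) → ≰⇒> (λ b≤s → noEast (s≤s b≤s) e) ; (toN e) → contradiction (trans (sym bN) e) (λ ()) })
        (trans (cong (_∧ _) (zero-∸ {r} {b} {w} b≤r)) (cong one? readN))
        (trans (cong (_∧ (zero? (r ∷ p) ∧ false)) (zero-∸ {r} {b} {w} b≤r)) (∧-zeroʳ (zero? (r ∷ p))))

    choose-run : ∀ {pos r h b} → readIn x (suc pos) ≡ bit (eastBit r h) → readIn x pos ≡ bit (northBit r h) → r ≤ iₜ →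
      ChooseSpec choose 30 (suc pos) r h b
    choose-run {pos} {r} {h} {b} readE readN r≤ = cases (b <? r) (eastBit r h) refl
      where
      skipped : holds (nz vC and inp one?) (st (suc pos) (r ∷ p) (h ∷ t) (b ∷ q) l m f (r ∸ b ∷ c) (b ∸ r ∷ w)) ≡ false →
        (b < r → eastBit r h ≢ true) → ChooseSpec choose 30 (suc pos) r h b
      skipped g noEast with rest-run {pos} {r} {h} {b} readN r≤ noEast
      ... | v , ip' , chosen = v , ip' , ite-f g (op tt ⨟ₙ chosen)
      cases : Dec (b < r) → (e : Bool) → eastBit r h ≡ e → ChooseSpec choose 30 (suc pos) r h b
      cases (no b≮r) e eq = skipped (cong (_∧ _) (positive-∸-≤ {r} {b} {c} (≮⇒≥ b≮r))) (λ b<r → ⊥-elim (b≮r b<r))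
      cases (yes b<r) false eq = skipped
        (trans (cong₂ _∧_ (positive-∸ {r} {b} {c} b<r) (trans (cong one? readE) (cong (one? ∘ bit) eq))) refl)
        (λ _ e → contradiction (trans (sym eq) e) (λ ()))
      cases (yes b<r) true eq = east-case b<r eq
        (cong₂ _∧_ (positive-∸ {r} {b} {c} b<r) (trans (cong one? readE) (cong (one? ∘ bit) eq)))
        where
        east-case : ∀ {r} → b < r → eastBit r h ≡ true →
          holds (nz vC and inp one?) (st (suc pos) (r ∷ p) (h ∷ t) (b ∷ q) l m f (r ∸ b ∷ c) (b ∸ r ∷ w)) ≡ true →
          ChooseSpec choose 30 (suc pos) r h b
        east-case {suc r} (s≤s b≤r) eq g =
          -- No edge lowers r by more than one, so the east edge attains the minimum.
          edgeVerdict (toE eq) b≤r (λ e _ → ≤-pred (edge-≥ e)) , suc pos ,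
          weaken (≤ᵇ⇒≤ 14 30 tt) (ite-t g (op nonEmpty ⨟ₙ againP-run ⨟ₙ againT-run ⨟ₙ op positive ⨟ₙ succeed-run))

  nextEdge-spec : NextSpec nextEdge 1 (edgeCost (n I)) 3
  nextEdge-spec {ip} {r} {h} {b} {p} {t} {q} {l} {m} {f} {c} {w} ip≤ r≤ h≤ short room
    with choose-run short room {cellPos (iₜ ∸ r) (jₜ ∸ h)} {r} {h} {b}
           (read-cell 1 i< j< ≤-refl) (read-cell 0 i< j< (s≤s z≤n)) r≤
    where
    i< = ≤-<-trans (m∸n≤m iₜ r) iₜ<
    j< = ≤-<-trans (m∸n≤m jₜ h) jₜ<
  ... | v , ip' , chosen = v , ip' ,
    (op ((λ ()) , nonEmpty , within {c} 1 (s≤s z≤n) c≤ room) ⨟ₙ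
     op ((λ ()) , nonEmpty , within {w} 1 (s≤s z≤n) w≤ room) ⨟ₙ
     weaken (+-monoʳ-≤ 4 (*-monoˡ-≤ 6 (<⇒≤ (≤-<-trans r≤ iₜ<)))) (compare-run r b) ⨟ₙ
     seek-run ip≤ r≤ h≤ (within {c} 3 ≤-refl c≤ room) ⨟ₙ
     right-run (<⇒≤ (≤-pred (cellPos-fits (≤-<-trans (m∸n≤m iₜ r) iₜ<) (≤-<-trans (m∸n≤m jₜ h) jₜ<)))) ⨟ₙ
     chosen ⨟ₙ finish v)
    where
    open Short short
    finish : ∀ v → Run (op (drop vC) ⨟ₙ op (drop vW)) (after {1} {r} {h} {b} v ip' p t q l m f (r ∸ b ∷ c) (b ∸ r ∷ w)) 2
                       (after v ip' p t q l m f c w)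
    finish (found _ _ _ _ _) = op nonEmpty ⨟ₙ op nonEmpty
    finish (none _)          = op nonEmpty ⨟ₙ op nonEmpty

-- One level of the recursion

drop-cons : ∀ i {o} (l : List ℕ) → i + suc o ≡ length l → Σ ℕ λ a → List.drop i l ≡ a ∷ List.drop (suc i) l
drop-cons zero    (a ∷ l) e = a , refl
drop-cons (suc i) (a ∷ l) e = drop-cons i l (cong pred e)
drop-cons (suc i) []      ()
drop-cons zero    []      ()

drop-all : ∀ (l : List ℕ) → List.drop (length l) l ≡ []
drop-all []      = refl
drop-all (_ ∷ l) = drop-all l

-- The initial potential for β ≤ k: β + 1 numbers of weight at most k each, counted twice, and β + 1
-- hops to go.
fuelBound : ℕ → ℕ
fuelBound k = 2 * (suc k * k) + suc k

hopsCost : ℕ → ℕ → ℕ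
hopsCost κ k = (4 + k * 4) + (1 + (1 + (1 + (1 + ((4 + fuelBound k * (9 + κ)) + ((2 + (14 + k * 5)) + 2))))))

nextCost : ℕ → ℕ → ℕ
nextCost zero    k = edgeCost k
nextCost (suc e) k = hopsCost (nextCost e k) k

module Level (I : Instance) (M Lm β : ℕ) (n≤M : n I ≤ M) (β<M : 2 + β ≤ M) (β≤n : β ≤ n I)
             (child : NProg) (hop κ need : ℕ) (child-spec : OneEdge.NextSpec I M Lm β n≤M child hop κ need) where

  open OneEdge I M Lm β n≤M

  -- Measures how far offsets and bounds can still rise. A push replaces a bound by an offset that
  -- is no smaller and uses up one hop. A pop replaces r by r + 1, which lowers the weight by one,
  -- but gives a hop back; doubling the weight makes the sum decrease in this case as well.
  weight : List ℕ → ℕ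
  weight []       = 0
  weight (r ∷ rs) = (suc iₜ ∸ r) + weight rs

  fuel₀ : ℕ
  fuel₀ = fuelBound (n I)

  module Call {r₀ h₀ y₀ : ℕ} {p t q l m f c w : List ℕ} {d : ℕ} (r₀≤ : r₀ ≤ iₜ) (h₀≤ : h₀ ≤ jₜ)
              (short : Short d p t q l m f c w) (room : d + (need + (β + 4)) ≤ Lm) where

    open Short short
    open Search hop (suc β) r₀ h₀ y₀

    room' : (d + (β + 2)) + need ≤ Lm
    room' = ≤-trans (≤-trans (≤-reflexive (solve₁ d β need)) (+-monoʳ-≤ d (+-monoʳ-≤ need (+-monoʳ-≤ β (m≤m+n 2 2))))) room
      where
      solve₁ : ∀ d β k → (d + (β + 2)) + k ≡ d + (k + (β + 2))
      solve₁ = solve-∀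

    fits : ∀ j {o : List ℕ} → j ≤ 4 → length o ≤ d → j + length o ≤ Lm
    fits j {o} j≤ le = within {o} j (≤-trans j≤ (≤-trans (m≤n+m 4 β) (m≤n+m (β + 4) need))) le room

    -- The loop stops when one counter is zero: `vM` after a hit, `vL` after a miss, when even the
    -- origin has been popped. The other counter then stands at β + 2, its largest value, whence the
    -- hypothesis `2 + β ≤ M`.
    data LoopResult (s : NState) (j : ℕ) : Set where
      hit  : ∀ {r rs h hs r' h' ip'} → Chain (suc β) 0 r' (r ∷ rs) h' (h ∷ hs) → y₀ ≤ r' →
             Run (hopLoop child) s j (st ip' (r' ∷ (r ∷ rs) ++ p) (h' ∷ (h ∷ hs) ++ t) q (suc (suc β) ∷ l) (0 ∷ m) f c w) →
             LoopResult s j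
      miss : ∀ {bs ip'} → length bs ≡ β → Explored 0 (suc β) (suc r₀) →
             Run (hopLoop child) s j (st ip' p t (suc r₀ ∷ bs ++ y₀ ∷ q) (0 ∷ l) (suc (suc β) ∷ m) f c w) →
             LoopResult s j

    prepend : ∀ {s s₁ j j' j''} → (∀ {s'} → Run (hopLoop child) s₁ j s' → Run (hopLoop child) s j' s') → j' ≤ j'' →
      LoopResult s₁ j → LoopResult s j''
    prepend f le (hit c y≤ r)  = hit c y≤ (weaken le (f r))
    prepend f le (miss e x r) = miss e x (weaken le (f r))

    chain-bounds : ∀ {ℓ k r rs h hs} → Chain ℓ (suc k) r rs h hs → ℓ ≤ β × k ≤ β
    chain-bounds {ℓ} {k} ch = m+n≤o⇒m≤o ℓ (≤-reflexive e) , m+n≤o⇒n≤o ℓ (≤-reflexive e)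
      where
      e : ℓ + k ≡ β
      e = cong pred (trans (sym (+-suc ℓ k)) (chain-sum ch))

    childShort : ∀ {ℓ k r rs h hs q'} → Chain ℓ (suc k) r rs h hs → length q' ≤ d + (β + 2) →
      Short (d + (β + 2)) (rs ++ p) (hs ++ t) q' (suc ℓ ∷ l) (suc k ∷ m) f c w
    childShort {ℓ} {rs = rs} {hs = hs} ch q'≤ = record
      { p≤ = appended rs (proj₁ (chain-length ch)) p≤ ; t≤ = appended hs (proj₂ (chain-length ch)) t≤ ; q≤ = q'≤
      ; l≤ = plus1 l≤ ; m≤ = plus1 m≤ ; f≤ = plus0 f≤ ; c≤ = plus0 c≤ ; w≤ = plus0 w≤ }
      where
      plus0 : ∀ {a} → a ≤ d → a ≤ d + (β + 2)
      plus0 le = ≤-trans le (m≤m+n d _)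
      plus1 : ∀ {a} → a ≤ d → suc a ≤ d + (β + 2)
      plus1 {a} le = ≤-trans (≤-reflexive (+-comm 1 a)) (+-mono-≤ le (≤-trans (s≤s z≤n) (m≤n+m 2 β)))
      appended : ∀ (l₁ : List ℕ) {l₂ : List ℕ} → length l₁ ≡ ℓ → length l₂ ≤ d → length (l₁ ++ l₂) ≤ d + (β + 2)
      appended l₁ {l₂} e le = ≤-trans (≤-reflexive (trans (length-++ l₁) (trans (cong (_+ length l₂) e) (+-comm ℓ (length l₂)))))
        (+-mono-≤ le (≤-trans (proj₁ (chain-bounds ch)) (m≤m+n β 2)))

    firstCost : 4 + (9 + κ) ≡ 3 + (1 + ((κ + (4 + 1)) + 4))
    firstCost = solve₁ κ
      where
      solve₁ : ∀ κ → 4 + (9 + κ) ≡ 3 + (1 + ((κ + (4 + 1)) + 4))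
      solve₁ = solve-∀

    loopCost : ∀ j → 3 + (1 + ((κ + (4 + 1)) + (4 + j))) ≡ 4 + ((9 + κ) + j)
    loopCost = solve₁ κ
      where
      solve₁ : ∀ κ j → 3 + (1 + ((κ + (4 + 1)) + (4 + j))) ≡ 4 + ((9 + κ) + j)
      solve₁ = solve-∀

    once : ∀ fuel → 3 + (1 + ((κ + (4 + 1)) + 4)) ≤ 4 + suc fuel * (9 + κ)
    once fuel = ≤-trans (≤-reflexive (sym firstCost)) (+-monoʳ-≤ 4 (m≤m+n (9 + κ) _))

    mutual
      -- fuel bounds 2 * weight + (number of hops to go), which every iteration decreases.
      loop : ∀ fuel {ℓ k r rs h hs bs ip} → Chain ℓ (suc k) r rs h hs → Bounds (suc ℓ) k bs → ip ≤ X →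
        2 * (weight (r ∷ rs) + weight bs) + suc k ≤ fuel →
        LoopResult (st ip (r ∷ rs ++ p) (h ∷ hs ++ t) (bs ++ y₀ ∷ q) (suc ℓ ∷ l) (suc k ∷ m) f c w) (4 + fuel * (9 + κ))
      loop zero {k = k} {r} {rs} {bs = bs} ch bds ip≤ le =
        ⊥-elim (<⇒≱ (≤-trans (s≤s z≤n) (m≤n+m (suc k) (2 * (weight (r ∷ rs) + weight bs)))) le)
      -- No intermediate bound is left, so this hop is the last one and the caller's `y₀` is on top
      -- of `vQ`. Success here ends the loop.
      loop (suc fuel) {ℓ} {r = r} {rs} {h} {hs} ch [] ip≤ le
        with child-spec {b = y₀} ip≤ (≤-trans (proj₁ (path-≤ (chain-path ch))) r₀≤) (≤-trans (proj₂ (path-≤ (chain-path ch))) h₀≤)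
               (childShort ch (≤-trans q≤ (m≤m+n d _))) room'
      ... | none fails , ip' , run₁ = loop-miss fuel ch (last-bound ch) fails [] ip≤ run₁ le
        where
        last-bound : ∀ {ℓ r rs h hs} → Chain ℓ 1 r rs h hs → Explored (suc ℓ) 0 y₀
        last-bound ch _ s<y₀ [] = s<y₀
      ... | found r' h' hp y≤ least , ip' , run₁ with ℓ≡β
        where
        ℓ≡β : ℓ ≡ β
        ℓ≡β = cong pred (trans (+-comm 1 ℓ) (chain-sum ch))
      ... | refl = hit (extend ch hp (explored-push ch explored-last hp least)) y≤
        (weaken (once fuel) (while-t refl (run₁ ⨟ₙ ite-t refl (op (roomy β<M) ⨟ₙ op positive) ⨟ₙ op nonEmpty) (while-f refl)))
      loop (suc fuel) {ℓ} {suc k} {r} {rs} {h} {hs} {b ∷ bs} ch (eb ∷ bds) ip≤ le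
        with child-spec {b = b} ip≤ (≤-trans (proj₁ (path-≤ (chain-path ch))) r₀≤) (≤-trans (proj₂ (path-≤ (chain-path ch))) h₀≤)
               (childShort ch short-q) room'
        where
        short-q : length (bs ++ y₀ ∷ q) ≤ d + (β + 2)
        short-q = ≤-trans (≤-reflexive (trans (length-++ bs) (trans (cong (_+ suc (length q)) (bounds-length bds))
            (trans (+-suc k (length q)) (+-comm (suc k) (length q))))))
          (+-mono-≤ q≤ (≤-trans (proj₂ (chain-bounds ch)) (m≤m+n β 2)))
      ... | none fails , ip' , run₁ = loop-miss fuel ch eb fails (eb ∷ bds) ip≤ run₁ le
      ... | found r' h' hp b≤ least , ip' , run₁ =
        prepend (λ r → while-t refl first r) (≤-reflexive (loopCost _))
          (loop fuel (extend ch hp (explored-push ch eb hp least)) bds (run-inp≤ first ip≤) decreases)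
        where
        first = run₁ ⨟ₙ ite-t refl (op (roomy (≤-trans (s≤s (s≤s (proj₁ (chain-bounds ch)))) β<M)) ⨟ₙ op positive) ⨟ₙ op nonEmpty
        decreases : 2 * (weight (r' ∷ r ∷ rs) + weight bs) + suc k ≤ fuel
        decreases = ≤-pred (≤-trans (≤-reflexive (sym (+-suc _ (suc k)))) (≤-trans (+-monoˡ-≤ (suc (suc k)) (*-monoʳ-≤ 2
          (≤-trans (+-monoˡ-≤ (weight bs) (+-monoˡ-≤ (weight (r ∷ rs)) (∸-monoʳ-≤ (suc iₜ) b≤)))
                   (≤-reflexive (solve₁ (suc iₜ ∸ b) (weight (r ∷ rs)) (weight bs)))))) le))
          where
          solve₁ : ∀ x y z → (x + y) + z ≡ y + (x + z)
          solve₁ = solve-∀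

      -- Stated for an arbitrary bound b, since the failing hop may lead to an intermediate layer or
      -- to the last one, whose bound is `y₀`. Popping the origin ends the loop; any other pop
      -- resumes it one layer back.
      loop-miss : ∀ fuel {ℓ k r rs h hs bs b ip ip' pp tp qp} → Chain ℓ (suc k) r rs h hs → Explored (suc ℓ) k b →
        (∀ {s u} → Path hop r h s u → s < b) → Bounds (suc ℓ) k bs → ip ≤ X →
        Run child (st ip pp tp qp (suc ℓ ∷ l) (suc k ∷ m) f c w) κ
          (st ip' (rs ++ p) (hs ++ t) (suc r ∷ bs ++ y₀ ∷ q) (suc ℓ ∷ l) (suc k ∷ m) (0 ∷ f) c w) →
        2 * (weight (r ∷ rs) + weight bs) + suc k ≤ suc fuel →
        LoopResult (st ip pp tp qp (suc ℓ ∷ l) (suc k ∷ m) f c w) (4 + suc fuel * (9 + κ))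
      loop-miss fuel origin eb fails bds ip≤ run₁ le = miss (bounds-length bds) (explored-pop origin eb fails)
        (weaken (once fuel) (while-t refl (run₁ ⨟ₙ ite-f refl (op positive ⨟ₙ op (roomy β<M)) ⨟ₙ op nonEmpty) (while-f refl)))
      loop-miss fuel {suc ℓ} {k} {r} {r₂ ∷ rs} {bs = bs} ch@(extend ch' _ _) eb fails bds ip≤ run₁ le =
        prepend (λ r → while-t refl first r) (≤-reflexive (loopCost _))
          (loop fuel ch' (explored-pop ch eb fails ∷ bds) (run-inp≤ first ip≤) decreases)
        where
        first = run₁ ⨟ₙ ite-f refl (op positive ⨟ₙ op (roomy (≤-trans (s≤s (s≤s (proj₂ (chain-bounds ch)))) β<M))) ⨟ₙ op nonEmpty
        decreases : 2 * (weight (r₂ ∷ rs) + weight (suc r ∷ bs)) + suc (suc k) ≤ fuel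
        decreases = ≤-pred (≤-trans (≤-reflexive (trans (solve₁ (weight (r₂ ∷ rs)) (suc iₜ ∸ suc r) (weight bs) k)
            (cong (λ z → 2 * ((z + weight (r₂ ∷ rs)) + weight bs) + suc k)
              (sym (+-∸-assoc 1 (s≤s (≤-trans (proj₁ (path-≤ (chain-path ch))) r₀≤)))))))
          le)
          where
          solve₁ : ∀ x y z k → suc (2 * (x + (y + z)) + suc (suc k)) ≡ 2 * ((suc y + x) + z) + suc k
          solve₁ = solve-∀

    unwindFound-run : ∀ {ip r' h' l m} rs hs → length rs ≡ β → length hs ≡ β →
      Run unwindFound (st ip (r' ∷ rs ++ r₀ ∷ p) (h' ∷ hs ++ h₀ ∷ t) q l m f c w) (14 + n I * 5)
        (st ip (r' ∷ r₀ ∷ p) (h' ∷ h₀ ∷ t) q l m (1 ∷ f) c w)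
    unwindFound-run {ip} {r'} {h'} {l} {m} rs hs rs≡ hs≡ = weaken (≤-trans (≤-reflexive (solve₁ β)) (+-monoʳ-≤ 14 (*-monoˡ-≤ 5 β≤n)))
      (op ((λ ()) , nonEmpty , fits 1 {q} (m≤m+n 1 3) q≤) ⨟ₙ op ((λ ()) , nonEmpty , fits 2 {q} (m≤m+n 2 2) q≤) ⨟ₙ
       op nonEmpty ⨟ₙ op nonEmpty ⨟ₙ drops ⨟ₙ
       op ((λ ()) , nonEmpty , fits 2 {t} (m≤m+n 2 2) t≤) ⨟ₙ op nonEmpty ⨟ₙ
       op ((λ ()) , nonEmpty , fits 2 {p} (m≤m+n 2 2) p≤) ⨟ₙ op nonEmpty ⨟ₙ
       op (fits 1 {f} (m≤m+n 1 3) f≤) ⨟ₙ op (roomy (≤-trans (s≤s z≤n) β<M)))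
      where
      solve₁ : ∀ β → 1 + (1 + (1 + (1 + ((4 + β * 5) + (1 + (1 + (1 + (1 + 2)))))))) ≡ 14 + β * 5
      solve₁ = solve-∀
      gone : ∀ l {l₂} → length l ≡ β → List.drop β l ++ l₂ ≡ l₂
      gone l refl = cong (_++ _) (drop-all l)
      drops : Run (forN vB (op (drop vP) ⨟ₙ op (drop vT))) (st ip (rs ++ r₀ ∷ p) (hs ++ h₀ ∷ t) (h' ∷ r' ∷ q) l m f c w)
        (4 + β * 5) (st ip (r₀ ∷ p) (h₀ ∷ t) (h' ∷ r' ∷ q) l m f c w)
      drops = subst₂ (λ y y' → Run (forN vB (op (drop vP) ⨟ₙ op (drop vT))) (st ip (rs ++ r₀ ∷ p) (hs ++ h₀ ∷ t) (h' ∷ r' ∷ q) l m f c w)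
          (4 + β * 5) (st ip y y' (h' ∷ r' ∷ q) l m f c w)) (gone rs rs≡) (gone hs hs≡)
        (for-run vB (λ _ → ip) (λ i → List.drop i rs ++ r₀ ∷ p) (λ i → List.drop i hs ++ h₀ ∷ t) (λ _ → h' ∷ r' ∷ q)
          (λ ()) refl (fits 1 {c} (m≤m+n 1 3) c≤) body)
        where
        body : ∀ i o → i + suc o ≡ β → Run (op (drop vP) ⨟ₙ op (drop vT))
          (st ip (List.drop i rs ++ r₀ ∷ p) (List.drop i hs ++ h₀ ∷ t) (h' ∷ r' ∷ q) l m f (o ∷ c) w) 2
          (st ip (List.drop (suc i) rs ++ r₀ ∷ p) (List.drop (suc i) hs ++ h₀ ∷ t) (h' ∷ r' ∷ q) l m f (o ∷ c) w)
        body i o e with drop-cons i rs (trans e (sym rs≡)) | drop-cons i hs (trans e (sym hs≡))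
        ... | a , eq | a' , eq' rewrite eq | eq' = op nonEmpty ⨟ₙ op nonEmpty

    unwindNone-run : ∀ {ip a l m} bs → length bs ≡ β →
      Run unwindNone (st ip p t (a ∷ bs ++ y₀ ∷ q) l m f c w) (14 + n I * 5) (st ip p t (a ∷ y₀ ∷ q) l m (0 ∷ f) c w)
    unwindNone-run {ip} {a} {l} {m} bs bs≡ = weaken (≤-trans (≤-reflexive (solve₁ β)) (+-mono-≤ (m≤m+n 9 5) (*-mono-≤ β≤n (m≤m+n 4 1))))
      (op ((λ ()) , nonEmpty , fits 1 {p} (m≤m+n 1 3) p≤) ⨟ₙ op nonEmpty ⨟ₙ drops ⨟ₙ
       op ((λ ()) , nonEmpty , fits 2 {q} (m≤m+n 2 2) q≤) ⨟ₙ op nonEmpty ⨟ₙ op (fits 1 {f} (m≤m+n 1 3) f≤))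
      where
      solve₁ : ∀ β → 1 + (1 + ((4 + β * 4) + (1 + (1 + 1)))) ≡ 9 + β * 4
      solve₁ = solve-∀
      drops : Run (forN vB (op (drop vQ))) (st ip (a ∷ p) t (bs ++ y₀ ∷ q) l m f c w) (4 + β * 4) (st ip (a ∷ p) t (y₀ ∷ q) l m f c w)
      drops = subst (λ y → Run (forN vB (op (drop vQ))) (st ip (a ∷ p) t (bs ++ y₀ ∷ q) l m f c w) (4 + β * 4) (st ip (a ∷ p) t y l m f c w))
        (trans (cong (λ z → List.drop z bs ++ y₀ ∷ q) (sym bs≡)) (cong (_++ y₀ ∷ q) (drop-all bs)))
        (for-run vB (λ _ → ip) (λ _ → a ∷ p) (λ _ → t) (λ i → List.drop i bs ++ y₀ ∷ q) (λ ()) refl (fits 1 {c} (m≤m+n 1 3) c≤) body)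
        where
        body : ∀ i o → i + suc o ≡ β → Run (op (drop vQ)) (st ip (a ∷ p) t (List.drop i bs ++ y₀ ∷ q) l m f (o ∷ c) w) 1
          (st ip (a ∷ p) t (List.drop (suc i) bs ++ y₀ ∷ q) l m f (o ∷ c) w)
        body i o e with drop-cons i bs (trans e (sym bs≡))
        ... | _ , eq rewrite eq = op nonEmpty

    fill-run : ∀ {ip p t} → Run (forN vB (op (push0 vQ))) (st ip p t (y₀ ∷ q) l m f c w) (4 + n I * 4)
      (st ip p t (replicate β 0 ++ y₀ ∷ q) l m f c w)
    fill-run {ip} {p} {t} = weaken (+-monoʳ-≤ 4 (*-monoˡ-≤ 4 β≤n))
      (for-run vB (λ _ → ip) (λ _ → p) (λ _ → t) (λ i → replicate i 0 ++ y₀ ∷ q) (λ ()) refl (fits 1 {c} (m≤m+n 1 3) c≤)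
        (λ i o e → op (≤-trans (s≤s (≤-reflexive (trans (length-++ (replicate i 0)) (cong (_+ suc (length q)) (length-replicate i)))))
          (≤-trans (+-mono-≤ (≤-trans (m≤m+n (suc i) o) (≤-reflexive (trans (sym (+-suc i o)) e))) (≤-trans (s≤s q≤) (≤-reflexive (+-comm 1 d))))
            (≤-trans (≤-reflexive (solve₁ β d)) (≤-trans (+-monoʳ-≤ d (≤-trans (+-monoʳ-≤ β (m≤m+n 1 3)) (m≤n+m (β + 4) need))) room))))))
      where
      solve₁ : ∀ β d → β + (d + 1) ≡ d + (β + 1)
      solve₁ = solve-∀

    start-weight : 2 * (weight (r₀ ∷ []) + weight (replicate β 0)) + suc β ≤ fuel₀
    start-weight = +-mono-≤ (*-monoʳ-≤ 2 (≤-trans (+-mono-≤ (≤-trans (≤-reflexive (+-identityʳ _)) (m∸n≤m (suc iₜ) r₀)) (zeros β))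
        (*-mono-≤ (s≤s β≤n) iₜ<))) (s≤s β≤n)
      where
      zeros : ∀ k → weight (replicate k 0) ≤ k * suc iₜ
      zeros zero    = z≤n
      zeros (suc k) = +-monoʳ-≤ (suc iₜ) (zeros k)

    call : ∀ {ip} → ip ≤ X → Σ (Verdict (suc β * hop) r₀ h₀ y₀) λ v → Σ ℕ λ ip' →
      Run (hops child) (st ip (r₀ ∷ p) (h₀ ∷ t) (y₀ ∷ q) l m f c w) (hopsCost κ (n I)) (after v ip' p t q l m f c w)
    call {ip} ip≤ with loop fuel₀ {ip = ip} origin (bounds-zero 1 β) ip≤ start-weight
    ... | hit {r} {rs} {h} {hs} {r'} {h'} {ip'} ch y≤ run₁ with chain-rs (pred-chain ch) | chain-hs (pred-chain ch)
      where
      pred-chain : ∀ {r rs h hs r' h'} → Chain (suc β) 0 r' (r ∷ rs) h' (h ∷ hs) → Chain β 1 r rs h hs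
      pred-chain (extend ch _ _) = ch
    ... | rs₀ , eq , len | hs₀ , eq' , len' =
      -- An end s < r' in the last layer is explored, and with no hop left dead means s < y₀.
      found r' h' (chain-path ch) y≤ (λ pth y≤s → ≮⇒≥ (λ s<r' → <⇒≱ (chain-explored ch pth s<r' []) y≤s)) , ip' ,
      (fill-run ⨟ₙ op (fits 1 {l} (m≤m+n 1 3) l≤) ⨟ₙ op (roomy (≤-trans (s≤s z≤n) β<M)) ⨟ₙ
       op ((λ ()) , nonEmpty , fits 1 {m} (m≤m+n 1 3) m≤) ⨟ₙ op (roomy (<⇒≤ β<M)) ⨟ₙ run₁ ⨟ₙ
       ite-t refl (subst₂ (λ y y' → Run unwindFound (st ip' (r' ∷ y) (h' ∷ y') q (suc (suc β) ∷ l) (0 ∷ m) f c w) (14 + n I * 5)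
                            (st ip' (r' ∷ r₀ ∷ p) (h' ∷ h₀ ∷ t) q (suc (suc β) ∷ l) (0 ∷ m) (1 ∷ f) c w))
         (sym (trans (cong (_++ p) eq) (++-assoc rs₀ (r₀ ∷ []) p))) (sym (trans (cong (_++ t) eq') (++-assoc hs₀ (h₀ ∷ []) t)))
         (unwindFound-run rs₀ hs₀ len len')) ⨟ₙ
       op nonEmpty ⨟ₙ op nonEmpty)
    call {ip} ip≤ | miss {bs} {ip'} len ex run₁ =
      -- The bound of layer 0 has passed r₀, so the origin itself is dead.
      none (λ pth → ex [] ≤-refl pth) , ip' ,
      (fill-run ⨟ₙ op (fits 1 {l} (m≤m+n 1 3) l≤) ⨟ₙ op (roomy (≤-trans (s≤s z≤n) β<M)) ⨟ₙ
       op ((λ ()) , nonEmpty , fits 1 {m} (m≤m+n 1 3) m≤) ⨟ₙ op (roomy (<⇒≤ β<M)) ⨟ₙ run₁ ⨟ₙ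
       ite-f refl (unwindNone-run bs len) ⨟ₙ op nonEmpty ⨟ₙ op nonEmpty)

  hops-spec : NextSpec (hops child) (suc β * hop) (hopsCost κ (n I)) (need + (β + 4))
  hops-spec ip≤ r≤ h≤ short room = Call.call r≤ h≤ short room ip≤

module NextCorrect (I : Instance) (M Lm β : ℕ) (n≤M : n I ≤ M) (β<M : 2 + β ≤ M) (β≤n : β ≤ n I) where

  open OneEdge I M Lm β n≤M public

  nextNeed : ℕ → ℕ
  nextNeed zero    = 3
  nextNeed (suc e) = nextNeed e + (β + 4)

  next-spec : ∀ e → NextSpec (next e) (suc β ^ e) (nextCost e (n I)) (nextNeed e)
  next-spec zero    = nextEdge-spec
  next-spec (suc e) = Level.hops-spec I M Lm β n≤M β<M β≤n (next e) (suc β ^ e) (nextCost e (n I)) (nextNeed e) (next-spec e)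

-- Reading the input and choosing the base

readUnary : Fin 12 → NProg
readUnary v = while (inp one?) (op (inc v) ⨟ₙ op (head R)) ⨟ₙ op (head R)

-- Reads k into v while replacing the tops a of u and 0 of u' by a ∸ k and k ∸ a.
readOffset : (v u u' : Fin 12) → NProg
readOffset v u u' = while (inp one?) (op (inc v) ⨟ₙ ite (nz u) (op (dec u)) (op (inc u')) ⨟ₙ op (head R)) ⨟ₙ op (head R)

readHeader : NProg
readHeader = op (head R) ⨟ₙ op (push0 vN) ⨟ₙ op (push0 vP) ⨟ₙ op (push0 vT) ⨟ₙ op (push0 vI) ⨟ₙ op (push0 vJ) ⨟ₙ
  op (push0 vQ) ⨟ₙ op (push0 vL) ⨟ₙ
  readUnary vN ⨟ₙ readUnary vP ⨟ₙ readUnary vT ⨟ₙ readOffset vI vP vQ ⨟ₙ readOffset vJ vT vL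

-- Advances the input head by (β + 1) ^ e, but not beyond the unary block that it scans.
power : ℕ → NProg
power zero    = ite (inp one?) (op (head R)) (op (head S))
power (suc e) = forN vB (power e) ⨟ₙ power e

-- The root of n is found by head moves: after (β + 1) ^ D moves along the unary n the head still
-- reads a one iff (β + 1) ^ D < n. The main program rejects at once when s exceeds t in a
-- coordinate, which the truncated differences on `vP` and `vT` reveal; otherwise the offsets wait
-- on `vQ` and `vL`.
attempt findBase mainProg : ℕ → NProg
attempt D  = rewind ⨟ₙ power D
findBase D = attempt D ⨟ₙ while (inp one?) (op (inc vB) ⨟ₙ attempt D)
mainProg D = readHeader ⨟ₙ op (push0 vB) ⨟ₙ op (inc vB) ⨟ₙ
  ite (z vP and z vT)
    (op (drop vP) ⨟ₙ op (dup vQ vP) ⨟ₙ op (drop vQ) ⨟ₙ op (drop vT) ⨟ₙ op (dup vL vT) ⨟ₙ op (drop vL) ⨟ₙ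
     op (push0 vQ) ⨟ₙ findBase D ⨟ₙ next (suc D))
    (op (push0 vF))

-- A trace of the loop in `findBase`, one constructor per round, so that the loop's run is built by
-- recursion on it.
data Base (D k : ℕ) : (steps β β* : ℕ) → Set where
  stop : ∀ {β} → k ≤ suc β ^ D → Base D k 0 β β
  more : ∀ {j β β*} → suc β ^ D < k → Base D k j (suc β) β* → Base D k (suc j) β β*

m≤m^ : ∀ m D → m ≤ m ^ suc D
m≤m^ zero    D = z≤n
m≤m^ (suc m) D = ≤-trans (≤-reflexive (sym (*-identityʳ (suc m)))) (*-monoʳ-≤ (suc m) (m^n>0 (suc m) D))

-- The search stops at the latest when β reaches k, because a positive power of β + 1 is at least β
-- + 1.
base : ∀ D k fuel β → k ≤ fuel + β → Σ ℕ λ j → Σ ℕ λ β* → Base (suc D) k j β β*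
base D k zero β k≤ = 0 , β , stop (≤-trans k≤ (≤-trans (n≤1+n β) (m≤m^ (suc β) D)))
base D k (suc fuel) β k≤ with k ≤? suc β ^ suc D
... | yes le = 0 , β , stop le
... | no ≰ with base D k fuel (suc β) (≤-trans k≤ (≤-reflexive (sym (+-suc fuel β))))
... | j , β* , b = suc j , β* , more (≰⇒> ≰) b

base-steps : ∀ {D k j β β*} → Base D k j β β* → j + β ≡ β*
base-steps (stop _)           = refl
base-steps (more {j} {β} _ b) = trans (sym (+-suc j β)) (base-steps b)

base-enough : ∀ {D k j β β*} → Base D k j β β* → k ≤ suc β* ^ D
base-enough (stop le)  = le
base-enough (more _ b) = base-enough b

base-tight : ∀ {D k j β β*} → Base D k j β β* → β* ≡ β ⊎ β* ^ D < k
base-tight (stop _) = inj₁ refl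
base-tight (more lt b) with base-tight b
... | inj₁ refl = inj₂ lt
... | inj₂ lt'  = inj₂ lt'

powerCost attemptCost findCost readCost mainCost : ℕ → ℕ → ℕ
powerCost zero    k = 3
powerCost (suc e) k = forCost k (powerCost e k) + powerCost e k
attemptCost D k = (3 + inputBound k * 3) + powerCost D k
findCost D k = attemptCost D k + (2 + k * (3 + attemptCost D k))
readCost _ k = 8 + ((3 + k * 7) + ((3 + k * 7) + ((3 + k * 7) + ((3 + k * 7) + (3 + k * 7)))))
mainCost D k = readCost D k + (1 + (1 + (4 + (7 + (findCost D k + nextCost (suc D) k)))))

module Main (I : Instance) (D M Lm β : ℕ) (n≤M : n I ≤ M) (β<M : 2 + β ≤ M) (β≤n : β ≤ n I) where

  open NextCorrect I M Lm β n≤M β<M β≤n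

  readUnary-run : ∀ v k {ip ys l} (σ : Vec (List ℕ) 12) → k ≤ M → At ip (unary k ++ ys) →
    Run (readUnary v) (ip , σ [ v ]≔ (0 ∷ l)) (3 + k * 4) (suc k + ip , σ [ v ]≔ (k ∷ l)) × At (suc k + ip) ys
  readUnary-run v k {ip} {ys} {l} σ k≤ at with ones k 0 (≤-trans (≤-reflexive (+-identityʳ k)) k≤) at
    where
    bump : ∀ {ip a} → suc a ≤ M → Run (op (inc v)) (ip , σ [ v ]≔ (a ∷ l)) 1 (ip , σ [ v ]≔ (suc a ∷ l))
    bump {ip} {a} lt = subst (λ s → Run (op (inc v)) (ip , σ [ v ]≔ (a ∷ l)) 1 (ip , s))
      (trans ([]≔-idempotent σ v) (cong (λ y → σ [ v ]≔ incTop y) (lookup∘update v σ (a ∷ l))))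
      (op (subst Roomy (sym (lookup∘update v σ (a ∷ l))) (roomy lt)))
    ones : ∀ k a {ip} → k + a ≤ M → At ip (unary k ++ ys) →
      Run (while (inp one?) (op (inc v) ⨟ₙ op (head R))) (ip , σ [ v ]≔ (a ∷ l)) (2 + k * 4) (k + ip , σ [ v ]≔ (k + a ∷ l)) ×
      At (k + ip) (false ∷ ys)
    ones zero    a le at = while-f (cong one? (at-read at 0)) , at
    ones (suc k) a {ip} le at with ones k (suc a) (≤-trans (≤-reflexive (+-suc k a)) le) (at-next at)
    ... | r , at' rewrite +-suc k ip | +-suc k a =
      while-t (cong one? (at-read at 0)) (bump (≤-trans (s≤s (m≤n+m a k)) le) ⨟ₙ at-right at) r , at'
  ... | r , at' rewrite +-identityʳ k = weaken (≤-reflexive (+-comm (2 + k * 4) 1)) (r ⨟ₙ at-right at') , at-next at'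

  -- `G` presents the store as a function of the three changing tops, so that both coordinates share
  -- one proof; for the two concrete stores the required facts hold by computation.
  module Offset (v u u' : Fin 12) (G : (a b c : ℕ) → Vec (List ℕ) 12)
    (inc-v : ∀ {ip a b c} → suc a ≤ M → Run (op (inc v)) (ip , G a b c) 1 (ip , G (suc a) b c))
    (u-pos : ∀ a b c → positive? (lookup (G a (suc b) c) u) ≡ true)
    (u-zero : ∀ a c → positive? (lookup (G a 0 c) u) ≡ false)
    (dec-u : ∀ {ip a b c} → Run (op (dec u)) (ip , G a (suc b) c) 1 (ip , G a b c))
    (inc-u' : ∀ {ip a b c} → suc c ≤ M → Run (op (inc u')) (ip , G a b c) 1 (ip , G a b (suc c))) where

    readOffset-run : ∀ k b {ip ys} → k ≤ M → At ip (unary k ++ ys) →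
      Run (readOffset v u u') (ip , G 0 b 0) (3 + k * 7) (suc k + ip , G k (b ∸ k) (k ∸ b)) × At (suc k + ip) ys
    readOffset-run k b {ip} {ys} k≤ at with ones k 0 b 0 (≤-trans (≤-reflexive (+-identityʳ k)) k≤) (≤-trans (≤-reflexive (+-identityʳ k)) k≤) at
      where
      ones : ∀ k a b c {ip} → k + a ≤ M → k + c ≤ M → At ip (unary k ++ ys) →
        Run (while (inp one?) (op (inc v) ⨟ₙ ite (nz u) (op (dec u)) (op (inc u')) ⨟ₙ op (head R))) (ip , G a b c) (2 + k * 7)
            (k + ip , G (k + a) (b ∸ k) ((k ∸ b) + c)) × At (k + ip) (false ∷ ys)
      ones zero a b c le le' at rewrite 0∸n≡0 b = while-f (cong one? (at-read at 0)) , at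
      ones (suc k) a zero c {ip} le le' at
        with ones k (suc a) 0 (suc c) (≤-trans (≤-reflexive (+-suc k a)) le) (≤-trans (≤-reflexive (+-suc k c)) le') (at-next at)
      ... | r , at' rewrite +-suc k ip | +-suc k a | +-suc k c | 0∸n≡0 k =
        while-t (cong one? (at-read at 0)) (inc-v (≤-trans (s≤s (m≤n+m a k)) le) ⨟ₙ
          ite-f (u-zero (suc a) c) (inc-u' (≤-trans (s≤s (m≤n+m c k)) le')) ⨟ₙ at-right at) r , at'
      ones (suc k) a (suc b) c {ip} le le' at
        with ones k (suc a) b c (≤-trans (≤-reflexive (+-suc k a)) le) (<⇒≤ le') (at-next at)
      ... | r , at' rewrite +-suc k ip | +-suc k a =
        while-t (cong one? (at-read at 0)) (inc-v (≤-trans (s≤s (m≤n+m a k)) le) ⨟ₙ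
          ite-t (u-pos (suc a) b c) dec-u ⨟ₙ at-right at) r , at'
    ... | r , at' rewrite +-identityʳ k | +-identityʳ (k ∸ b) =
      weaken (≤-reflexive (+-comm (2 + k * 7) 1)) (r ⨟ₙ at-right at') , at-next at'

  afterHeader : (p t q l nn i j : ℕ) → Vec (List ℕ) 12
  afterHeader p t q l nn i j =
    (p ∷ []) ∷ (t ∷ []) ∷ (q ∷ []) ∷ (l ∷ []) ∷ [] ∷ [] ∷ [] ∷ [] ∷ (nn ∷ []) ∷ (i ∷ []) ∷ (j ∷ []) ∷ [] ∷ []

  header-read : 1 ≤ Lm → Σ ℕ λ ip → Run readHeader (0 , empty) (readCost D (n I))
    (ip , afterHeader (iₛ ∸ iₜ) (jₛ ∸ jₜ) (iₜ ∸ iₛ) (jₜ ∸ jₛ) (n I) iₜ jₜ)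
  header-read 1≤Lm with readUnary-run vN (n I) (afterHeader 0 0 0 0 0 0 0) n≤M at-first
  ... | r₁ , a₁ with readUnary-run vP iₛ (afterHeader 0 0 0 0 (n I) 0 0) (≤-trans (<⇒≤ (toℕ<n (proj₁ (s I)))) n≤M) a₁
  ... | r₂ , a₂ with readUnary-run vT jₛ (afterHeader iₛ 0 0 0 (n I) 0 0) (≤-trans (<⇒≤ (toℕ<n (proj₂ (s I)))) n≤M) a₂
  ... | r₃ , a₃ with Offset.readOffset-run vI vP vQ (λ a b c → afterHeader b jₛ c 0 (n I) a 0)
                       (λ lt → op (roomy lt)) (λ _ _ _ → refl) (λ _ _ → refl) (op positive) (λ lt → op (roomy lt))
                       iₜ iₛ (≤-trans (<⇒≤ iₜ<) n≤M) a₃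
  ... | r₄ , a₄ with Offset.readOffset-run vJ vT vL (λ a b c → afterHeader (iₛ ∸ iₜ) b (iₜ ∸ iₛ) c (n I) iₜ a)
                       (λ lt → op (roomy lt)) (λ _ _ _ → refl) (λ _ _ → refl) (op positive) (λ lt → op (roomy lt))
                       jₜ jₛ (≤-trans (<⇒≤ jₜ<) n≤M) a₄
  ... | r₅ , a₅ = _ ,
    (right-run z≤n ⨟ₙ op 1≤Lm ⨟ₙ op 1≤Lm ⨟ₙ op 1≤Lm ⨟ₙ op 1≤Lm ⨟ₙ op 1≤Lm ⨟ₙ op 1≤Lm ⨟ₙ op 1≤Lm ⨟ₙ
     weaken (small ≤-refl (m≤m+n 4 3)) r₁ ⨟ₙ weaken (small (<⇒≤ (toℕ<n (proj₁ (s I)))) (m≤m+n 4 3)) r₂ ⨟ₙ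
     weaken (small (<⇒≤ (toℕ<n (proj₂ (s I)))) (m≤m+n 4 3)) r₃ ⨟ₙ
     weaken (small (<⇒≤ iₜ<) ≤-refl) r₄ ⨟ₙ weaken (small (<⇒≤ jₜ<) ≤-refl) r₅)
    where
    small : ∀ {k a} → k ≤ n I → a ≤ 7 → 3 + k * a ≤ 3 + n I * 7
    small k≤ a≤ = +-monoʳ-≤ 3 (*-mono-≤ k≤ a≤)

  pos : ℕ → ℕ
  pos a = suc (a ⊓ n I)

  n≤length : n I ≤ length x
  n≤length = ≤-trans (≤-trans (m≤m+n (n I) 1) (≤-trans (≤-reflexive len) (m≤m+n _ _))) (≤-reflexive (sym (length-++ (unary (n I)))))
    where
    len : n I + 1 ≡ length (unary (n I))
    len = sym (trans (length-++ (replicate (n I) true)) (cong (_+ 1) (length-replicate (n I))))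

  unary-inside : ∀ k {o} ys → o < k → readIn (unary k ++ ys) (suc o) ≡ bit true
  unary-inside (suc k) {zero}  ys _        = refl
  unary-inside (suc k) {suc o} ys (s≤s lt) = unary-inside k ys lt

  unary-end : ∀ k ys → readIn (unary k ++ ys) (suc k) ≡ bit false
  unary-end zero    ys = refl
  unary-end (suc k) ys = unary-end k ys

  pos-< : ∀ {a} → a < n I → pos a ≡ suc a × one? (readIn x (pos a)) ≡ true
  pos-< {a} lt with a ⊓ n I | m≤n⇒m⊓n≡m (<⇒≤ lt)
  ... | _ | refl = refl , cong one? (unary-inside (n I) _ lt)

  pos-≥ : ∀ {a} → n I ≤ a → pos a ≡ suc (n I) × one? (readIn x (pos a)) ≡ false
  pos-≥ {a} le with a ⊓ n I | m≥n⇒m⊓n≡n le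
  ... | _ | refl = refl , cong one? (unary-end (n I) _)

  module At-base (γ : ℕ) = Loops x M Lm (n I) iₜ jₜ γ

  run-to : ∀ {p s ip ip' σ j} → ip ≡ ip' → Run p s j (ip , σ) → Run p s j (ip' , σ)
  run-to refl r = r

  -- The e nested loops keep one counter each on `vC`, hence the room required. Capping positions at
  -- the end of the unary block makes the moves additive without any assumption on a.
  power-run : ∀ e γ a {p t q l m f c w} → γ ≤ n I → e + length c ≤ Lm →
    Run (power e) (At-base.st γ (pos a) p t q l m f c w) (powerCost e (n I)) (At-base.st γ (pos (suc γ ^ e + a)) p t q l m f c w)
  power-run zero γ a γ≤ room with a <? n I
  ... | yes a< = ite-t (proj₂ (pos-< a<)) (run-from (proj₁ (pos-< a<))
    (run-to (cong suc (sym (m≤n⇒m⊓n≡m a<))) (right-run (≤-trans a< n≤length))))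
  -- The head already rests on the zero that ends the block, where `pos a` and `pos (1 + a)`
  -- coincide.
  ... | no a≮ = ite-f (proj₂ (pos-≥ (≮⇒≥ a≮)))
    (run-to (trans (proj₁ (pos-≥ (≮⇒≥ a≮))) (sym (proj₁ (pos-≥ (≤-trans (≮⇒≥ a≮) (n≤1+n a)))))) (op tt))
  power-run (suc e) γ a {p} {t} {q} {l} {m} {f} {c} {w} γ≤ room =
    weaken (+-monoˡ-≤ (powerCost e (n I)) (forCost-mono {j = powerCost e (n I)} γ≤))
      (At-base.for-run γ vB (λ i → pos (i * suc γ ^ e + a)) (λ _ → p) (λ _ → t) (λ _ → q) (λ ()) refl
          (≤-trans (s≤s (m≤n+m (length c) e)) room)
          (λ i o _ → run-to (cong pos (sym (+-assoc (suc γ ^ e) (i * suc γ ^ e) a)))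
            (power-run e γ (i * suc γ ^ e + a) γ≤ (≤-trans (≤-reflexive (+-suc e (length c))) room))) ⨟ₙ
       run-to (cong pos (sym (+-assoc (suc γ ^ e) (γ * suc γ ^ e) a))) (power-run e γ (γ * suc γ ^ e + a) γ≤ (<⇒≤ room)))

  attempt-run : ∀ γ {ip p t q l m f c w} → ip ≤ X → γ ≤ n I → D + length c ≤ Lm →
    Run (attempt D) (At-base.st γ ip p t q l m f c w) (attemptCost D (n I)) (At-base.st γ (pos (suc γ ^ D)) p t q l m f c w)
  attempt-run γ {ip} ip≤ γ≤ room =
    weaken (+-monoˡ-≤ (powerCost D (n I)) (+-monoʳ-≤ 3 (*-monoˡ-≤ 3 (≤-trans ip≤ X≤inputBound))))
      (rewind-run ip ⨟ₙ run-to (cong pos (+-identityʳ (suc γ ^ D))) (power-run D γ 0 γ≤ room))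

  pos≤X : ∀ a → pos a ≤ X
  pos≤X a = s≤s (≤-trans (m⊓n≤n a (n I)) n≤length)

  findLoop-run : ∀ {j γ p t q l m f c w} → Base D (n I) j γ β → D + length c ≤ Lm →
    Run (while (inp one?) (op (inc vB) ⨟ₙ attempt D)) (At-base.st γ (pos (suc γ ^ D)) p t q l m f c w)
        (2 + j * (3 + attemptCost D (n I))) (st (pos (suc β ^ D)) p t q l m f c w)
  findLoop-run (stop le) room = while-f (proj₂ (pos-≥ le))
  findLoop-run {suc j} {γ} (more lt b) room = weaken (≤-reflexive (solve₁ (attemptCost D (n I)) (j * (3 + attemptCost D (n I)))))
    (while-t (proj₂ (pos-< lt)) (op (roomy (≤-trans γ<n n≤M)) ⨟ₙ attempt-run (suc γ) (pos≤X (suc γ ^ D)) γ<n room) (findLoop-run b room))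
    where
    γ<n : suc γ ≤ n I
    γ<n = ≤-trans (m≤n+m (suc γ) j) (≤-trans (≤-reflexive (base-steps b)) β≤n)
    solve₁ : ∀ a y → 1 + (1 + ((1 + a) + (2 + y))) ≡ 2 + ((3 + a) + y)
    solve₁ = solve-∀

  findBase-run : ∀ {j γ ip p t q l m f c w} → Base D (n I) j γ β → ip ≤ X → D + length c ≤ Lm →
    Run (findBase D) (At-base.st γ ip p t q l m f c w) (findCost D (n I)) (st (pos (suc β ^ D)) p t q l m f c w)
  findBase-run {j} {γ} b ip≤ room =
    attempt-run γ ip≤ (≤-trans (m≤n+m γ j) j+γ≤) room ⨟ₙ
    weaken (+-monoʳ-≤ 2 (*-monoˡ-≤ (3 + attemptCost D (n I)) (≤-trans (m≤m+n j γ) j+γ≤))) (findLoop-run b room)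
    where
    j+γ≤ : j + γ ≤ n I
    j+γ≤ = ≤-trans (≤-reflexive (base-steps b)) β≤n

  Answer : Set
  Answer = Σ Bool λ b → ((b ≡ true → Reachable I) × (Reachable I → b ≡ true)) ×
    Σ NState λ s' → Run (mainProg D) (0 , empty) (mainCost D (n I)) s' × holds (nz vF) s' ≡ b

  module Outcome {j : ℕ} (b : Base D (n I) j 1 β) (room : nextNeed (suc D) ≤ Lm) (room' : D + 2 ≤ Lm) where

    1≤Lm : 1 ≤ Lm
    1≤Lm = ≤-trans (≤-trans (s≤s z≤n) (m≤n+m 2 D)) room'

    1≤M : 1 ≤ M
    1≤M = ≤-trans (s≤s z≤n) β<M

    -- The distance is at most 2n. The base search starts at β = 1, so that β + 1 ≥ 2, and it ends
    -- with n ≤ (β + 1) ^ D: one level more than D absorbs the factor 2.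
    far : (iₜ ∸ iₛ) + (jₜ ∸ jₛ) ≤ suc β ^ suc D
    far = ≤-trans (+-mono-≤ (≤-trans (m∸n≤m iₜ iₛ) (<⇒≤ iₜ<)) (≤-trans (m∸n≤m jₜ jₛ) (<⇒≤ jₜ<)))
      (≤-trans (≤-reflexive (cong (n I +_) (sym (+-identityʳ (n I)))))
        (*-mono-≤ (s≤s (≤-trans (m≤n+m 1 j) (≤-reflexive (base-steps b)))) (base-enough b)))

    ip₀ : ℕ
    ip₀ = proj₁ (header-read 1≤Lm)

    header : Run readHeader (0 , empty) (readCost D (n I))
      (ip₀ , afterHeader (iₛ ∸ iₜ) (jₛ ∸ jₜ) (iₜ ∸ iₛ) (jₜ ∸ jₛ) (n I) iₜ jₜ)
    header = proj₂ (header-read 1≤Lm)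

    reject-run : zero? (iₛ ∸ iₜ ∷ []) ∧ zero? (jₛ ∸ jₜ ∷ []) ≡ false → Σ NState λ s' →
      Run (mainProg D) (0 , empty) (mainCost D (n I)) s' × holds (nz vF) s' ≡ false
    reject-run g = _ , weaken (+-monoʳ-≤ (readCost D (n I)) (s≤s (s≤s (+-monoʳ-≤ 4 (s≤s z≤n)))))
      (header ⨟ₙ op 1≤Lm ⨟ₙ op (roomy 1≤M) ⨟ₙ ite-f g (op 1≤Lm)) , refl

    search-run : ∀ {s'} → iₛ ≤ iₜ → jₛ ≤ jₜ →
      Run (next (suc D)) (st (pos (suc β ^ D)) (iₜ ∸ iₛ ∷ []) (jₜ ∸ jₛ ∷ []) (0 ∷ []) [] [] [] [] []) (nextCost (suc D) (n I)) s' →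
      Run (mainProg D) (0 , empty) (mainCost D (n I)) s'
    search-run i≤ j≤ r = header ⨟ₙ op 1≤Lm ⨟ₙ op (roomy 1≤M) ⨟ₙ
      ite-t (cong₂ _∧_ (zero-∸ {iₜ} {iₛ} {[]} i≤) (zero-∸ {jₜ} {jₛ} {[]} j≤))
        (op nonEmpty ⨟ₙ op ((λ ()) , nonEmpty , 1≤Lm) ⨟ₙ op nonEmpty ⨟ₙ op nonEmpty ⨟ₙ op ((λ ()) , nonEmpty , 1≤Lm) ⨟ₙ op nonEmpty ⨟ₙ
         op 1≤Lm ⨟ₙ findBase-run b (run-inp≤ header z≤n) (≤-trans (+-monoʳ-≤ D z≤n) room') ⨟ₙ r)

    reject : (Reachable I → ⊥) → zero? (iₛ ∸ iₜ ∷ []) ∧ zero? (jₛ ∸ jₜ ∷ []) ≡ false → Answer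
    reject no-path g = false , ((λ ()) , λ p → ⊥-elim (no-path p)) , reject-run g

    search-answer : iₛ ≤ iₜ → jₛ ≤ jₜ → (v : Verdict (suc β ^ suc D) (iₜ ∸ iₛ) (jₜ ∸ jₛ) 0) → ∀ ip' →
      Run (next (suc D)) (st (pos (suc β ^ D)) (iₜ ∸ iₛ ∷ []) (jₜ ∸ jₛ ∷ []) (0 ∷ []) [] [] [] [] []) (nextCost (suc D) (n I))
        (after v ip' [] [] [] [] [] [] [] []) → Answer
    search-answer i≤ j≤ v@(found _ _ p _ _) ip' r =
      true , ((λ _ → path⇒reachable i≤ j≤ far p) , λ _ → refl) , after v ip' [] [] [] [] [] [] [] [] , search-run i≤ j≤ r , refl
    search-answer i≤ j≤ v@(none fails) ip' r =
      false , ((λ ()) , λ p → ⊥-elim (n≮0 (fails (reachable⇒path p far)))) , after v ip' [] [] [] [] [] [] [] [] , search-run i≤ j≤ r , refl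

    cases : Dec (iₛ ≤ iₜ) → Dec (jₛ ≤ jₜ) → Answer
    cases (no i≰) _ = reject (λ p → i≰ (proj₁ (toT⇒path p))) (cong (_∧ zero? (jₛ ∸ jₜ ∷ [])) (zero-∸-< {iₜ} {iₛ} {[]} (≰⇒> i≰)))
    cases (yes _) (no j≰) = reject (λ p → j≰ (proj₁ (proj₂ (toT⇒path p))))
      (trans (cong (zero? (iₛ ∸ iₜ ∷ []) ∧_) (zero-∸-< {jₜ} {jₛ} {[]} (≰⇒> j≰))) (∧-zeroʳ _))
    cases (yes i≤) (yes j≤) =
      let (v , ip' , r) = next-spec (suc D) {ip = pos (suc β ^ D)} {iₜ ∸ iₛ} {jₜ ∸ jₛ} {0} {[]} {[]} {[]} {[]} {[]} {[]} {[]} {[]} {0}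
            (pos≤X (suc β ^ D)) (m∸n≤m iₜ iₛ) (m∸n≤m jₜ jₛ)
            (record { p≤ = z≤n ; t≤ = z≤n ; q≤ = z≤n ; l≤ = z≤n ; m≤ = z≤n ; f≤ = z≤n ; c≤ = z≤n ; w≤ = z≤n }) room
      in search-answer i≤ j≤ v ip' r

    main-answer : Answer
    main-answer = cases (iₛ ≤? iₜ) (jₛ ≤? jₜ)

-- Polynomial bounds

record Poly (f : ℕ → ℕ) : Set where
  constructor poly
  field
    coeff degree : ℕ
    bound        : ∀ k → f k ≤ coeff * suc k ^ degree

module _ where
  open ≤-Reasoning

  const-poly : ∀ a → Poly (λ _ → a)
  const-poly a = poly a 0 λ k → ≤-reflexive (sym (*-identityʳ a))

  id-poly : Poly (λ k → k)
  id-poly = poly 1 1 λ k → begin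
    k                  ≤⟨ n≤1+n k ⟩
    suc k              ≡⟨ sym (*-identityʳ (suc k)) ⟩
    suc k ^ 1          ≡⟨ sym (*-identityˡ (suc k ^ 1)) ⟩
    1 * suc k ^ 1      ∎

  infixl 6 _⊞_
  infixl 7 _⊠_

  _⊞_ : ∀ {f g} → Poly f → Poly g → Poly (λ k → f k + g k)
  _⊞_ {f} {g} (poly a d f≤) (poly b e g≤) = poly (a + b) (d + e) λ k → begin
    f k + g k                                    ≤⟨ +-mono-≤ (f≤ k) (g≤ k) ⟩
    a * suc k ^ d + b * suc k ^ e                ≤⟨ +-mono-≤ (*-monoʳ-≤ a (^-monoʳ-≤ (suc k) (m≤m+n d e))) (*-monoʳ-≤ b (^-monoʳ-≤ (suc k) (m≤n+m e d))) ⟩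
    a * suc k ^ (d + e) + b * suc k ^ (d + e)    ≡⟨ sym (*-distribʳ-+ (suc k ^ (d + e)) a b) ⟩
    (a + b) * suc k ^ (d + e)                    ∎

  _⊠_ : ∀ {f g} → Poly f → Poly g → Poly (λ k → f k * g k)
  _⊠_ {f} {g} (poly a d f≤) (poly b e g≤) = poly (a * b) (d + e) λ k → begin
    f k * g k                                    ≤⟨ *-mono-≤ (f≤ k) (g≤ k) ⟩
    (a * suc k ^ d) * (b * suc k ^ e)            ≡⟨ solve₁ a b (suc k ^ d) (suc k ^ e) ⟩
    (a * b) * (suc k ^ d * suc k ^ e)            ≡⟨ cong (a * b *_) (sym (^-distribˡ-+-* (suc k) d e)) ⟩
    (a * b) * suc k ^ (d + e)                    ∎
    where
    solve₁ : ∀ a b x y → (a * x) * (b * y) ≡ (a * b) * (x * y)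
    solve₁ = solve-∀

private
  # : ∀ a → Poly (λ _ → a)
  # = const-poly

for-poly : ∀ {f g} → Poly f → Poly g → Poly (λ k → forCost (f k) (g k))
for-poly f g = # 4 ⊞ f ⊠ (# 3 ⊞ g)

input-poly : Poly inputBound
input-poly = id-poly ⊠ (id-poly ⊠ # 2) ⊞ (id-poly ⊠ # 5 ⊞ # 6)

linear-poly : ∀ a b → Poly (λ k → a + k * b)
linear-poly a b = # a ⊞ id-poly ⊠ # b

edge-poly : Poly edgeCost
edge-poly = # 1 ⊞ (# 1 ⊞ (linear-poly 4 6 ⊞ (seek-poly ⊞ # 33)))
  where
  header-poly : Poly headerCost
  header-poly = linear-poly 3 3 ⊞ (linear-poly 3 3 ⊞ (linear-poly 3 3 ⊞ (linear-poly 3 3 ⊞ linear-poly 3 3)))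
  seek-poly : Poly seekCost
  seek-poly = (# 3 ⊞ input-poly ⊠ # 3) ⊞ (header-poly ⊞
    (for-poly id-poly (for-poly id-poly (# 2)) ⊞ (for-poly id-poly (# 2) ⊞ (for-poly id-poly (for-poly id-poly (# 2)) ⊞ for-poly id-poly (# 2)))))

next-poly : ∀ e → Poly (nextCost e)
next-poly zero    = edge-poly
next-poly (suc e) = linear-poly 4 4 ⊞ (# 4 ⊞ ((# 4 ⊞ fuel-poly ⊠ (# 9 ⊞ next-poly e)) ⊞ ((# 2 ⊞ linear-poly 14 5) ⊞ # 2)))
  where
  fuel-poly : Poly fuelBound
  fuel-poly = # 2 ⊠ ((# 1 ⊞ id-poly) ⊠ id-poly) ⊞ (# 1 ⊞ id-poly)

power-poly : ∀ e → Poly (powerCost e)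
power-poly zero    = # 3
power-poly (suc e) = for-poly id-poly (power-poly e) ⊞ power-poly e

main-poly : ∀ D → Poly (mainCost D)
-- The 13 is the sum of the constants 1, 1, 4 and 7 in `mainCost`, merged by computation.
main-poly D = read-poly ⊞ (# 13 ⊞ (find-poly ⊞ next-poly (suc D)))
  where
  attempt-poly : Poly (attemptCost D)
  attempt-poly = (# 3 ⊞ input-poly ⊠ # 3) ⊞ power-poly D
  find-poly : Poly (findCost D)
  find-poly = attempt-poly ⊞ (# 2 ⊞ id-poly ⊠ (# 3 ⊞ attempt-poly))
  read-poly : Poly (readCost D)
  read-poly = # 8 ⊞ (linear-poly 3 7 ⊞ (linear-poly 3 7 ⊞ (linear-poly 3 7 ⊞ (linear-poly 3 7 ⊞ linear-poly 3 7))))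

m≤2^m : ∀ m → m ≤ 2 ^ m
m≤2^m zero    = z≤n
m≤2^m (suc m) = +-mono-≤ (m^n>0 2 m) (≤-trans (m≤2^m m) (≤-reflexive (sym (+-identityʳ (2 ^ m)))))

*-^ : ∀ a b d → (a * b) ^ d ≡ a ^ d * b ^ d
*-^ a b zero    = refl
*-^ a b (suc d) = trans (cong (a * b *_) (*-^ a b d)) (solve₁ a b (a ^ d) (b ^ d))
  where
  solve₁ : ∀ a b x y → (a * b) * (x * y) ≡ (a * x) * (b * y)
  solve₁ = solve-∀

-- Sizes of the simulation for the base β + 1: number of entries of a stack, digits of a number, work cells.
entries digitBound cellBound : (D β : ℕ) → ℕ
entries D β    = (3 + suc D * (β + 4)) + (D + 2)
digitBound D β = 2 + suc β * D
cellBound D β  = entries D β * suc (digitBound D β)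

-- `entries` and `suc digitBound` are affine in β, with a slope not exceeding the value at β = 0;
-- each is therefore at most that value times β + 1. The two factors are these values, and the 1
-- pays for the additional cell.
spaceCoeff : ℕ → ℕ
spaceCoeff D = 1 + (suc D * 4 + (D + 5)) * (3 + D)

cellBound≤ : ∀ D β → suc (cellBound D β) ≤ spaceCoeff D * suc β ^ 2
cellBound≤ D β = begin
  suc (entries D β * suc (digitBound D β))
    ≤⟨ s≤s (*-mono-≤ entries≤ digits≤) ⟩
  1 + (suc D * 4 + (D + 5)) * B * ((3 + D) * B)
    ≤⟨ +-monoˡ-≤ _ (m^n>0 B 2) ⟩
  B ^ 2 + (suc D * 4 + (D + 5)) * B * ((3 + D) * B)
    ≡⟨ solve₁ (suc D * 4 + (D + 5)) (3 + D) B ⟩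
  spaceCoeff D * B ^ 2 ∎
  where
  open ≤-Reasoning
  B = suc β
  solve₁ : ∀ a b B → B * (B * 1) + a * B * (b * B) ≡ (1 + a * b) * (B * (B * 1))
  solve₁ = solve-∀
  solve₂ : ∀ D β → (3 + suc D * (β + 4)) + (D + 2) + (suc D * 3 + D + 5) * β ≡ (suc D * 4 + (D + 5)) * suc β
  solve₂ = solve-∀
  entries≤ : entries D β ≤ (suc D * 4 + (D + 5)) * B
  entries≤ = ≤-trans (m≤m+n _ _) (≤-reflexive (solve₂ D β))
  solve₃ : ∀ D β → 3 + suc β * D + 3 * β ≡ (3 + D) * suc β
  solve₃ = solve-∀
  digits≤ : suc (digitBound D β) ≤ (3 + D) * B
  digits≤ = ≤-trans (m≤m+n _ _) (≤-reflexive (solve₃ D β))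

timeBound : ℕ → ℕ → ℕ
timeBound D k = 2 + (mainCost D k * (13 * suc (digitBound D k)) + 1) * (8 + 4 * cellBound D k)

time-poly : ∀ D → Poly (timeBound D)
time-poly D = # 2 ⊞ (main-poly D ⊠ (# 13 ⊠ (# 1 ⊞ digit-poly)) ⊞ # 1) ⊠ (# 8 ⊞ # 4 ⊠ cell-poly)
  where
  digit-poly : Poly (digitBound D)
  digit-poly = # 2 ⊞ (# 1 ⊞ id-poly) ⊠ # D
  cell-poly : Poly (cellBound D)
  cell-poly = ((# 3 ⊞ # (suc D) ⊠ (id-poly ⊞ # 4)) ⊞ # (D + 2)) ⊠ (# 1 ⊞ digit-poly)

-- The machine for a fixed number of levels

lggMachine : ℕ → TM
lggMachine D = machine (decider (mainProg D) (nz vF)) accepting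

module Instantiate (D' : ℕ) (I : Instance) where

  D : ℕ
  D = suc D'

  1≤n : 1 ≤ n I
  1≤n = ≤-trans (s≤s z≤n) (toℕ<n (proj₁ (t I)))

  found-base : Σ ℕ λ j → Σ ℕ λ β → Base D (n I) j 1 β
  found-base = base D' (n I) (n I) 1 (m≤m+n (n I) 1)

  β : ℕ
  β = proj₁ (proj₂ found-base)

  β-base : Base D (n I) (proj₁ found-base) 1 β
  β-base = proj₂ (proj₂ found-base)

  β≤n : β ≤ n I
  β≤n with base-tight β-base
  ... | inj₁ e  = ≤-trans (≤-reflexive e) 1≤n
  ... | inj₂ lt = ≤-trans (m≤m^ β D') (<⇒≤ lt)

  -- Either β is still 1, or the search went past β - 1, so that β ^ D < n; then β + 1 ≤ 2β costs
  -- only the factor 2 ^ D.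
  B^D≤ : suc β ^ D ≤ 2 ^ D * n I
  B^D≤ with base-tight β-base
  ... | inj₁ e  = ≤-trans (≤-reflexive (trans (cong (λ z → suc z ^ D) e) (sym (*-identityʳ (2 ^ D))))) (*-monoʳ-≤ (2 ^ D) 1≤n)
  ... | inj₂ lt = ≤-trans (^-monoˡ-≤ D (≤-trans (+-monoˡ-≤ β 1≤β) (≤-reflexive (cong (β +_) (sym (+-identityʳ β))))))
                    (≤-trans (≤-reflexive (*-^ 2 β D)) (*-monoʳ-≤ (2 ^ D) (<⇒≤ lt)))
    where
    1≤β : 1 ≤ β
    1≤β = ≤-trans (m≤n+m 1 _) (≤-reflexive (base-steps β-base))

  M Lm : ℕ
  M = 2 + n I
  Lm = entries D β

  bits-ok : ∀ k → k ≤ M → length (bin k) ≤ digitBound D β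
  bits-ok k k≤ = ≮⇒≥ λ lt → <⇒≱ (^-monoʳ-< 2 (s≤s (s≤s z≤n)) lt) (begin
    2 ^ length (bin k)         ≤⟨ 2^length-bin≤ k ⟩
    suc k                      ≤⟨ s≤s k≤ ⟩
    3 + n I                    ≤⟨ +-monoˡ-≤ (n I) (*-monoʳ-≤ 3 1≤n) ⟩
    3 * n I + n I              ≡⟨ +-comm (3 * n I) (n I) ⟩
    4 * n I                    ≤⟨ *-monoʳ-≤ 4 (≤-trans (base-enough β-base) (^-monoˡ-≤ D (m≤2^m (suc β)))) ⟩
    4 * (2 ^ suc β) ^ D        ≡⟨ cong (4 *_) (^-*-assoc 2 (suc β) D) ⟩
    4 * 2 ^ (suc β * D)        ≡⟨ *-assoc 2 2 (2 ^ (suc β * D)) ⟩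
    2 ^ digitBound D β         ∎)
    where open ≤-Reasoning

  nextNeed≡ : ∀ e → NextCorrect.nextNeed I M Lm β (m≤n+m (n I) 2) (+-monoʳ-≤ 2 β≤n) β≤n e ≡ 3 + e * (β + 4)
  nextNeed≡ zero    = refl
  nextNeed≡ (suc e) = trans (cong (_+ (β + 4)) (nextNeed≡ e)) (cong (3 +_) (+-comm (e * (β + 4)) (β + 4)))

  outcome : Main.Answer I D M Lm β (m≤n+m (n I) 2) (+-monoʳ-≤ 2 β≤n) β≤n
  outcome = Main.Outcome.main-answer I D M Lm β (m≤n+m (n I) 2) (+-monoʳ-≤ 2 β≤n) β≤n β-base
    (≤-trans (≤-reflexive (nextNeed≡ (suc D))) (m≤m+n (3 + suc D * (β + 4)) (D + 2))) (m≤n+m (D + 2) (3 + suc D * (β + 4)))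

  open Semanticsₙ (encode I) M Lm
  open Compiled (digitBound D β) bits-ok

  Halts : Set
  Halts = Σ Bool λ b → HaltsWithin (lggMachine D) (encode I) (timeBound D (n I)) (suc (cellBound D β)) b ×
    ((b ≡ true → Reachable I) × (Reachable I → b ≡ true))

  in-time : 2 + (mainCost D (n I) * opUnit + 1) * unit ≤ timeBound D (n I)
  in-time = +-monoʳ-≤ 2 (*-mono-≤ (+-monoˡ-≤ 1 (*-monoʳ-≤ (mainCost D (n I)) (*-monoʳ-≤ 13 (s≤s digit≤))))
      (+-monoʳ-≤ 8 (*-monoʳ-≤ 4 (*-mono-≤ entries≤ (s≤s digit≤)))))
    where
    digit≤ : digitBound D β ≤ digitBound D (n I)
    digit≤ = +-monoʳ-≤ 2 (*-monoˡ-≤ D (s≤s β≤n))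
    entries≤ : entries D β ≤ entries D (n I)
    entries≤ = +-monoˡ-≤ (D + 2) (+-monoʳ-≤ 3 (*-monoʳ-≤ (suc D) (+-monoˡ-≤ 4 β≤n)))

  answer-halts : Main.Answer I D M Lm β (m≤n+m (n I) 2) (+-monoʳ-≤ 2 β≤n) β≤n → Halts
  answer-halts (b , correct , s' , whole , verdict) = b , decider-halts {mainProg D} {nz vF} whole verdict in-time , correct

  halts : Halts
  halts = answer-halts outcome

haltsWithin-weaken : ∀ {M x T T' Sp b} → T ≤ T' → HaltsWithin M x T Sp b → HaltsWithin M x T' Sp b
haltsWithin-weaken T≤ (τ , τ≤ , rest) = τ , ≤-trans τ≤ T≤ , rest

theorem3 : (p q : ℕ) → 1 ≤ p → 1 ≤ q → DecidesLGGReachTISP p q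
theorem3 (suc p) (suc q) _ _ = lggMachine D , C , degree , λ I →
  suc (cellBound D (β I)) , space I , proj₁ (halts I) , in-time I , proj₂ (proj₂ (halts I))
  where
  D' D : ℕ
  -- Chosen so that `suc D'` computes to `2 * suc q`: the power `suc q` of the space O(B²) is then
  -- O(B ^ D), hence O(n).
  D' = q + (suc q + 0)
  D = suc D'
  open Instantiate D' using (β; B^D≤; halts)
  open Poly (time-poly D)
  spaceC C : ℕ
  spaceC = spaceCoeff D ^ suc q * 2 ^ D
  C = spaceC + coeff
  space : ∀ I → suc (cellBound D (β I)) ^ suc q ≤ C * suc (n I) ^ suc p
  space I = begin
    suc (cellBound D (β I)) ^ suc q                    ≤⟨ ^-monoˡ-≤ (suc q) (cellBound≤ D (β I)) ⟩
    (spaceCoeff D * suc (β I) ^ 2) ^ suc q             ≡⟨ *-^ (spaceCoeff D) (suc (β I) ^ 2) (suc q) ⟩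
    spaceCoeff D ^ suc q * (suc (β I) ^ 2) ^ suc q     ≡⟨ cong (spaceCoeff D ^ suc q *_) (^-*-assoc (suc (β I)) 2 (suc q)) ⟩
    spaceCoeff D ^ suc q * suc (β I) ^ D               ≤⟨ *-monoʳ-≤ (spaceCoeff D ^ suc q) (B^D≤ I) ⟩
    spaceCoeff D ^ suc q * (2 ^ D * n I)               ≡⟨ sym (*-assoc (spaceCoeff D ^ suc q) (2 ^ D) (n I)) ⟩
    spaceC * n I                                       ≤⟨ *-mono-≤ (m≤m+n spaceC coeff) (≤-trans (n≤1+n (n I)) (m≤m^ (suc (n I)) p)) ⟩
    C * suc (n I) ^ suc p                              ∎
    where open ≤-Reasoning
  in-time : ∀ I → HaltsWithin (lggMachine D) (encode I) (C * suc (n I) ^ degree) (suc (cellBound D (β I))) (proj₁ (halts I))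
  in-time I = haltsWithin-weaken {lggMachine D} {encode I} {Sp = suc (cellBound D (β I))} (≤-trans (bound (n I)) (*-monoˡ-≤ (suc (n I) ^ degree) (m≤n+m coeff spaceC))) (proj₁ (proj₂ (halts I)))
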